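{- For every integer $g$ there exists a nontrivial snark $G$ of girth at least $g$ that contains a pair $\{u,v\}$ of adjacent vertices which is non-removable, i.e. such that the graph $G-\{u,v\}$ is $3$-edge-colourable.
   Context: Graphs are finite; multiple edges and loops are permitted. A snark is a $2$-connected cubic graph that admits no proper $3$-edge-colouring. A cubic graph is cyclically $k$-edge-connected if the removal of fewer than $k$ edges cannot create a graph with at least two components containing circuits. A snark is nontrivial if it is cyclically $4$-edge-connected and has girth at least $5$. An induced subgraph $H$ of a snark $G$ is called non-removable if $G-V(H)$ is $3$-edge-colourable (edge-colourings of graphs with vertices of degree less than $3$ are defined in the usual way: edges sharing a vertex get distinct colours). -}

module Defs where

open import Data.Nat using (ℕ; zero; suc; _+_; _<_; _≤_)
open import Data.Fin using (Fin; zero; suc; inject₁; fromℕ; _≟_)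
open import Data.Fin.Subset using (Subset; _∈_; _∉_; ∣_∣)
open import Data.List using (List; allFin; filter; length)
open import Data.Product using (Σ; ∃; ∃-syntax; _×_; _,_)
open import Data.Sum using (_⊎_)
open import Relation.Nullary using (¬_)
open import Data.Unit using (⊤)
open import Relation.Binary.PropositionalEquality using (_≡_; _≢_)
open import Function.Definitions using (Injective)

-- A finite multigraph: loops and parallel edges allowed.
-- Vertices are Fin n, edges are Fin m; edge e has endpoints src e, tgt e
-- (orientation is irrelevant; a loop has src e ≡ tgt e).
record Graph : Set where
  field
    n : ℕ
    m : ℕ
    src : Fin m → Fin n
    tgt : Fin m → Fin n

module _ (G : Graph) where
  open Graph G

  Vertex : Set
  Vertex = Fin n

  Edge : Set
  Edge = Fin m

  Joins : Edge → Vertex → Vertex → Set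
  Joins e a b = (src e ≡ a × tgt e ≡ b) ⊎ (src e ≡ b × tgt e ≡ a)

  IncidentTo : Edge → Vertex → Set
  IncidentTo e v = src e ≡ v ⊎ tgt e ≡ v

  Adjacent : Vertex → Vertex → Set
  Adjacent a b = ∃[ e ] Joins e a b

  -- degree (a loop counts twice)
  degree : Vertex → ℕ
  degree v = length (filter (λ e → src e ≟ v) (allFin m))
           + length (filter (λ e → tgt e ≟ v) (allFin m))

  Cubic : Set
  Cubic = ∀ v → degree v ≡ 3

  -- An edge subgraph is given by a predicate K on edges ("kept" edges);
  -- all vertices stay.
  EdgePred : Set₁
  EdgePred = Edge → Set

  data Reach (K : EdgePred) : Vertex → Vertex → Set where
    here : ∀ {a} → Reach K a a
    step : ∀ {a b c} (e : Edge) → K e → Joins e a b → Reach K b c → Reach K a c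

  record Circuit (K : EdgePred) (len : ℕ) : Set where
    field
      k : ℕ
      len≡ : len ≡ suc k
      vs : Fin (suc k) → Vertex
      es : Fin (suc k) → Edge
      vs-inj : Injective _≡_ _≡_ vs
      es-inj : Injective _≡_ _≡_ es
      kept : ∀ i → K (es i)
      path : ∀ (i : Fin k) → Joins (es (inject₁ i)) (vs (inject₁ i)) (vs (suc i))
      close : Joins (es (fromℕ k)) (vs (fromℕ k)) (vs zero)

  AllEdges : EdgePred
  AllEdges _ = ⊤

  GirthAtLeast : ℕ → Set
  GirthAtLeast g = ∀ len → Circuit AllEdges len → g ≤ len

  Connected : Set
  Connected = ∀ a b → Reach AllEdges a b

  ConnectedWithout : Vertex → Set
  ConnectedWithout w = ∀ a b → a ≢ w → b ≢ w → Reach (λ e → ¬ IncidentTo e w) a b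

  TwoConnected : Set
  TwoConnected = 3 ≤ n × Connected × (∀ w → ConnectedWithout w)

  CyclicallyEdgeConnected : ℕ → Set
  CyclicallyEdgeConnected κ =
    ∀ (S : Subset m) → ∣ S ∣ < κ →
      ¬ (Σ ℕ λ l₁ → Σ ℕ λ l₂ →
           Σ (Circuit (λ e → e ∉ S) l₁) λ C₁ → Σ (Circuit (λ e → e ∉ S) l₂) λ C₂ →
             ¬ Reach (λ e → e ∉ S) (Circuit.vs C₁ zero) (Circuit.vs C₂ zero))

  ThreeEdgeColourableOn : EdgePred → Set
  ThreeEdgeColourableOn K =
    Σ (Edge → Fin 3) λ c →
      ∀ e f v → K e → K f → e ≢ f → IncidentTo e v → IncidentTo f v → c e ≢ c f

  ThreeEdgeColourable : Set
  ThreeEdgeColourable = ThreeEdgeColourableOn AllEdges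

  EdgesOfMinus : (Vertex → Set) → EdgePred
  EdgesOfMinus X e = ¬ X (src e) × ¬ X (tgt e)

  NonRemovable : (Vertex → Set) → Set
  NonRemovable X = ThreeEdgeColourableOn (EdgesOfMinus X)

  Snark : Set
  Snark = Cubic × TwoConnected × ¬ ThreeEdgeColourable

  NontrivialSnark : Set
  NontrivialSnark = Snark × CyclicallyEdgeConnected 4 × GirthAtLeast 5

{-# OPTIONS --safe #-}
module Submission where

-- Two constructions on cubic graphs are combined.
--
-- Adding an edge.  Subdivide two disjoint edges and join the new vertices.  This keeps every cut with at
-- most three edges trivial, so cyclic 4-edge-connectivity is preserved.
--
-- Superposition.  Call some edges labelled, and suppose that the graph has no nowhere-zero flow with
-- values in Z₂ × Z₂ even after all edges of the same label have been subdivided and their midpoints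
-- identified.  Adding edges between labelled edges of the same label then preserves this property, hence
-- uncolourability.  If moreover the unlabelled edges form a forest, every circuit uses a labelled edge e
-- and can be lengthened by adding an edge from e to a labelled edge f far away, which creates no short
-- circuit.  Since balls of a given radius have bounded size, f exists as soon as the labelled edges have
-- been subdivided often enough, and repeating this gives arbitrarily large girth.
--
-- When both ends of the new edges lie on the same original edge, the segments of that edge can be coloured
-- alternately with two colours and the new edges with the third.  So a 3-edge-colouring of the initial
-- graph without two adjacent vertices survives.
--
-- The initial graph is made of seven Petersen graphs.  Removing three suitable vertices from a Petersen
-- graph leaves a tree; its three bundles of edges cannot all have flow zero, since the Petersen graph has
-- no nowhere-zero flow.  Replacing two disjoint edges of a Petersen graph by such trees gives a block with
-- two free bundles that always carry the same nonzero flow, and replacing two disjoint edges of a further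
-- Petersen graph by such blocks leaves no flow at all.

open import Algebra.Structures using (IsCommutativeMonoid)
open import Data.Bool using (Bool; true; false; not; if_then_else_; T; _∨_; _xor_)
open import Data.Bool.Properties using (xor-assoc; xor-comm; xor-same; xor-identityʳ; not-involutive)
import Data.Bool.Properties as Bool
open import Data.Empty using (⊥; ⊥-elim)
open import Data.Fin using (Fin; zero; suc; toℕ; inject₁; fromℕ; splitAt; _↑ʳ_)
import Data.Fin as Fin
open import Data.Fin.Induction using (<-weakInduction; >-weakInduction)
open import Data.Fin.Patterns using (0F; 1F; 2F; 3F; 4F; 5F; 6F; 7F; 8F; 9F)
import Data.Fin.Properties as Fin
open import Data.Fin.Relation.Unary.Top using (‵fromℕ; ‵inject₁) renaming (view to top)
open import Data.Fin.Subset using (Subset; ⁅_⁆; _∪_; ∣_∣; _-_) renaming (_∈_ to _∈ₛ_; _∉_ to _∉ₛ_)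
open import Data.Fin.Subset.Induction using (⊃-wellFounded; Acc; acc)
open import Data.Fin.Subset.Properties using (x∈⁅x⁆; x∈⁅y⁆⇒x≡y; p⊆p∪q; q⊆p∪q; x∈p∪q⁻; nonempty?; x∈p∧x≢y⇒x∈p-y; x∈p⇒∣p-x∣<∣p∣; anySubset?) renaming (_∈?_ to _∈ₛ?_)
open import Data.List using (List; []; _∷_; _++_; map; foldr; filter; concat; length; lookup; allFin)
open import Data.List.Membership.Propositional using (_∈_)
open import Data.List.Membership.Propositional.Properties using (∈-map⁺; ∈-++⁺ˡ; ∈-++⁺ʳ; ∈-allFin; ∈-filter⁺; ∈-filter⁻; ∈-lookup)
open import Data.List.Membership.Propositional.Properties.WithK using (unique∧set⇒bag)
import Data.List.Membership.DecPropositional as DecMembership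
open import Data.List.Properties using (map-∘; map-cong; length-++; map-tabulate; tabulate-lookup)
open import Data.List.Relation.Binary.BagAndSetEquality using (∼bag⇒↭)
open import Data.List.Relation.Binary.Permutation.Propositional using (_↭_; ↭⇒↭ₛ)
open import Data.List.Relation.Binary.Permutation.Propositional.Properties using (map⁺)
import Data.List.Relation.Binary.Permutation.Setoid.Properties as Permₛ
open import Data.List.Relation.Unary.All using (All; []; _∷_)
import Data.List.Relation.Unary.All as All
import Data.List.Relation.Unary.All.Properties as All
open import Data.List.Relation.Unary.Any using (here; there; index)
open import Data.List.Relation.Unary.Any.Properties using (lookup-index)
open import Data.List.Relation.Unary.Unique.Propositional using (Unique; []; _∷_)
import Data.List.Relation.Unary.Unique.Propositional.Properties as Unique
open import Data.Maybe using (Maybe; just; nothing; is-just; _>>=_)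
import Data.Maybe.Properties as Maybe
open import Data.Nat using (ℕ; zero; suc; _+_; _*_; _∸_; _≤_; _<_; z≤n; s≤s; _<ᵇ_; NonZero)
open import Data.Nat.DivMod using (_/_; _mod_)
import Data.Nat.Properties as ℕ
open import Data.Product using (Σ; ∃; _×_; _,_; proj₁; proj₂)
open import Data.Product.Properties using (≡-dec)
open import Data.Sum using (_⊎_; inj₁; inj₂)
import Data.Sum as Sum
import Data.Sum.Properties as Sum
open import Data.Unit using (⊤; tt)
open import Data.Vec using (Vec; []; _∷_) renaming (lookup to lookupᵛ; tabulate to tabulateᵛ)
open import Data.Vec.Properties using (lookup∘tabulate)
open import Function using (_∘_; case_of_; id; mk⇔)
open import Relation.Binary.Definitions using (tri<; tri≈; tri>)
open import Relation.Binary.PropositionalEquality using (_≡_; _≢_; refl; sym; trans; cong; cong₂; subst; subst₂; setoid; isEquivalence; module ≡-Reasoning)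
open import Relation.Nullary using (¬_; Dec; yes; no; does; ¬?; _×-dec_; _⊎-dec_; _→-dec_)
open import Relation.Nullary.Decidable using (decidable-stable; toWitness; from-no; map′)
open import Relation.Nullary.Negation using (contradiction)
open import Relation.Unary using (Decidable)
open import Defs

-- The graph with identified midpoints is never built. A flow is a function on darts, and
-- conservation at the vertex identified for a label says that the values of all darts with this
-- label add up to zero; the two darts of a labelled edge may therefore carry different values. New
-- edges need two disjoint edges, so an edge that has not been subdivided cannot receive both ends
-- of one. The initial graph therefore already contains new edges between different edges of the
-- same label, and new edges get one colour per label. The initial graph is too large for a search
-- over vertex sets or over flows. Its cuts are controlled by obtaining it from `K₄` by edge
-- additions, so the inheritance of small cuts serves both before and during the growth. Its lack of
-- flows is reduced by linear relations over the field with two elements to a single search on the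
-- Petersen graph.

Dart : ℕ → Set
Dart n = Fin n × Fin 3

_≟ᵈ_ : ∀ {n} (d e : Dart n) → Dec (d ≡ e)
_≟ᵈ_ = ≡-dec Fin._≟_ Fin._≟_

-- An edge is an orbit of `inv`, and regularity is built into the darts. By `loopless` the
-- involution has no fixed point; parallel edges remain possible.
record CubicGraph (n : ℕ) : Set where
  field
    inv      : Dart n → Dart n
    inv-inv  : ∀ d → inv (inv d) ≡ d
    loopless : ∀ d → proj₁ (inv d) ≢ proj₁ d

  tgt : Dart n → Fin n
  tgt d = proj₁ (inv d)

  inv-injective : ∀ {d e} → inv d ≡ inv e → d ≡ e
  inv-injective {d} {e} p = trans (sym (inv-inv d)) (trans (cong inv p) (inv-inv e))

-- Cuts with at most three edges

OneOf : {A : Set} → A → A → A → A → Set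
OneOf x a b c = x ≡ a ⊎ x ≡ b ⊎ x ≡ c

AtMostOne : ∀ {n} → (Fin n → Bool) → Set
AtMostOne X = ∀ v w → X v ≡ true → X w ≡ true → v ≡ w

-- In a cubic graph a nonempty acyclic side with k vertices is left by at least k + 2 edges. For
-- cuts with at most three edges, having an acyclic side thus amounts to having a side with at most
-- one vertex.
TrivialCut : ∀ {n} → (Fin n → Bool) → Set
TrivialCut X = AtMostOne X ⊎ AtMostOne (not ∘ X)

module _ {n} (G : CubicGraph n) where
  open CubicGraph G

  -- The three darts may coincide and need not leave `X`, so all cuts with at most three edges are
  -- covered.
  CutWithin : (Fin n → Bool) → Dart n → Dart n → Dart n → Set
  CutWithin X a b c = ∀ d → X (proj₁ d) ≡ true → X (tgt d) ≡ false → OneOf d a b c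

  SmallCutsTrivial : Set
  SmallCutsTrivial = ∀ X a b c → CutWithin X a b c → TrivialCut X

not-true : ∀ {b} → not b ≡ true → b ≡ false
not-true {false} _ = refl

not-false : ∀ {b} → not b ≡ false → b ≡ true
not-false {true} _ = refl

module _ {n} (G : CubicGraph n) where
  open CubicGraph G

  complement : ∀ {X a b c} → CutWithin G X a b c → CutWithin G (not ∘ X) (inv a) (inv b) (inv c)
  complement {X} cut d p q with cut (inv d) (not-false q) (trans (cong (X ∘ proj₁) (inv-inv d)) (not-true p))
  ... | inj₁ r = inj₁ (trans (sym (inv-inv d)) (cong inv r))
  ... | inj₂ (inj₁ r) = inj₂ (inj₁ (trans (sym (inv-inv d)) (cong inv r)))
  ... | inj₂ (inj₂ r) = inj₂ (inj₂ (trans (sym (inv-inv d)) (cong inv r)))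

true≢false : ∀ {b} → b ≡ true → b ≢ false
true≢false refl ()

3-in-2 : {A : Set} {x y z a b : A} → x ≢ y → y ≢ z → x ≢ z →
         x ≡ a ⊎ x ≡ b → y ≡ a ⊎ y ≡ b → z ≡ a ⊎ z ≡ b → ⊥
3-in-2 p q r (inj₁ refl) (inj₁ refl) _ = p refl
3-in-2 p q r (inj₁ refl) (inj₂ refl) (inj₁ refl) = r refl
3-in-2 p q r (inj₁ refl) (inj₂ refl) (inj₂ refl) = q refl
3-in-2 p q r (inj₂ refl) (inj₂ refl) _ = p refl
3-in-2 p q r (inj₂ refl) (inj₁ refl) (inj₁ refl) = q refl
3-in-2 p q r (inj₂ refl) (inj₁ refl) (inj₂ refl) = r refl

module _ {A : Set} {x a b c : A} where
  drop₁ : OneOf x a b c → x ≢ a → x ≡ b ⊎ x ≡ c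
  drop₁ (inj₁ p) q = contradiction p q
  drop₁ (inj₂ p) q = p

  rotate : OneOf x a b c → OneOf x b c a
  rotate (inj₁ p) = inj₂ (inj₂ p)
  rotate (inj₂ (inj₁ p)) = inj₁ p
  rotate (inj₂ (inj₂ p)) = inj₂ (inj₁ p)

4-in-3 : {A : Set} {x y z w a b c : A} → x ≢ y → x ≢ z → x ≢ w → y ≢ z → z ≢ w → y ≢ w →
         OneOf x a b c → OneOf y a b c → OneOf z a b c → OneOf w a b c → ⊥
4-in-3 xy xz xw yz zw yw (inj₁ refl) y z w =
  3-in-2 yz zw yw (drop₁ y (xy ∘ sym)) (drop₁ z (xz ∘ sym)) (drop₁ w (xw ∘ sym))
4-in-3 xy xz xw yz zw yw (inj₂ (inj₁ refl)) y z w =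
  3-in-2 yz zw yw (drop₁ (rotate y) (xy ∘ sym)) (drop₁ (rotate z) (xz ∘ sym)) (drop₁ (rotate w) (xw ∘ sym))
4-in-3 xy xz xw yz zw yw (inj₂ (inj₂ refl)) y z w =
  3-in-2 yz zw yw (drop₁ (rotate (rotate y)) (xy ∘ sym)) (drop₁ (rotate (rotate z)) (xz ∘ sym))
    (drop₁ (rotate (rotate w)) (xw ∘ sym))

module Cuts {n} (G : CubicGraph n) (sct : SmallCutsTrivial G) where
  open CubicGraph G

  singleton-boundary : ∀ {X} → AtMostOne X → ∀ v → X v ≡ true → ∀ i → X (tgt (v , i)) ≡ false
  singleton-boundary {X} one v p i with X (tgt (v , i)) in eq
  ... | false = refl
  ... | true = contradiction (one _ _ eq p) (loopless (v , i))

  -- Without loops all three darts of a lone vertex leave `X`, and two darts cannot account for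
  -- them.
  singleton-cut : ∀ {X a b} → AtMostOne X → CutWithin G X a b b → ∀ v → X v ≡ false
  singleton-cut {X} {a} {b} one cut v with X v in eq
  ... | false = refl
  ... | true = ⊥-elim (3-in-2 {x = v , 0F} {v , 1F} {v , 2F} (λ ()) (λ ()) (λ ()) (in₂ 0F) (in₂ 1F) (in₂ 2F))
    where
    in₂ : ∀ i → (v , i) ≡ a ⊎ (v , i) ≡ b
    in₂ i with cut (v , i) eq (singleton-boundary one v eq i)
    ... | inj₁ p = inj₁ p
    ... | inj₂ (inj₁ p) = inj₂ p
    ... | inj₂ (inj₂ p) = inj₂ p

  no-2-cuts : ∀ X a b → CutWithin G X a b b → (∀ v → X v ≡ false) ⊎ (∀ v → X v ≡ true)
  no-2-cuts X a b cut with sct X a b b cut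
  ... | inj₁ one = inj₁ (singleton-cut one cut)
  ... | inj₂ one = inj₂ (λ v → not-false (singleton-cut one (complement G {X} cut) v))

-- Adding an edge between two disjoint edges

flip : Fin 2 → Fin 2
flip 0F = 1F
flip 1F = 0F

flip-flip : ∀ i → flip (flip i) ≡ i
flip-flip 0F = refl
flip-flip 1F = refl

≡or≡flip : ∀ (i j : Fin 2) → i ≡ j ⊎ i ≡ flip j
≡or≡flip 0F 0F = inj₁ refl
≡or≡flip 0F 1F = inj₂ refl
≡or≡flip 1F 0F = inj₂ refl
≡or≡flip 1F 1F = inj₁ refl

-- Two disjoint edges; D j 0F and D j 1F are the darts of the j-th one.
record Sites {n} (G : CubicGraph n) : Set where
  open CubicGraph G
  field
    D     : Fin 2 → Fin 2 → Dart n
    D-inv : ∀ j i → inv (D j i) ≡ D j (flip i)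
    apart : ∀ j i i′ → proj₁ (D j i) ≢ proj₁ (D (flip j) i′)

  D-injective : ∀ {j i j′ i′} → D j i ≡ D j′ i′ → j ≡ j′ × i ≡ i′
  D-injective {j} {i} {j′} {i′} p with ≡or≡flip j j′
  ... | inj₂ refl = ⊥-elim (apart j′ i′ i (cong proj₁ (sym p)))
  ... | inj₁ refl with ≡or≡flip i i′
  ...   | inj₁ refl = refl , refl
  ...   | inj₂ refl = ⊥-elim (loopless (D j i′) (cong proj₁ (trans (D-inv j i′) p)))

module AddEdge {n} (G : CubicGraph n) (S : Sites G) where
  open CubicGraph G
  open Sites S

  old : Dart n → Dart (2 + n)
  old (v , i) = suc (suc v) , i

  newV : Fin 2 → Fin (2 + n)
  newV 0F = 0F
  newV 1F = 1F

  side : Fin 2 → Fin 3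
  side 0F = 0F
  side 1F = 1F

  new : Fin 2 → Fin 2 → Dart (2 + n)
  new j i = newV j , side i

  chordD : Fin 2 → Dart (2 + n)
  chordD j = newV j , 2F

  newV-flip : ∀ j → newV (flip j) ≢ newV j
  newV-flip 0F ()
  newV-flip 1F ()

  data Cut? (d : Dart n) : Set where
    cut   : ∀ j i → d ≡ D j i → Cut? d
    uncut : (∀ j i → d ≢ D j i) → Cut? d

  cut? : ∀ d → Cut? d
  cut? d with d ≟ᵈ D 0F 0F | d ≟ᵈ D 0F 1F | d ≟ᵈ D 1F 0F | d ≟ᵈ D 1F 1F
  ... | yes p | _ | _ | _ = cut 0F 0F p
  ... | no _ | yes p | _ | _ = cut 0F 1F p
  ... | no _ | no _ | yes p | _ = cut 1F 0F p
  ... | no _ | no _ | no _ | yes p = cut 1F 1F p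
  ... | no p | no q | no r | no s = uncut λ where
    0F 0F → p
    0F 1F → q
    1F 0F → r
    1F 1F → s

  inv⁺-old : (d : Dart n) → Cut? d → Dart (2 + n)
  inv⁺-old d (cut j i _) = new j i
  inv⁺-old d (uncut _) = old (inv d)

  inv⁺ : Dart (2 + n) → Dart (2 + n)
  inv⁺ (0F , 0F) = old (D 0F 0F)
  inv⁺ (0F , 1F) = old (D 0F 1F)
  inv⁺ (0F , 2F) = 1F , 2F
  inv⁺ (1F , 0F) = old (D 1F 0F)
  inv⁺ (1F , 1F) = old (D 1F 1F)
  inv⁺ (1F , 2F) = 0F , 2F
  inv⁺ (suc (suc v) , i) = inv⁺-old (v , i) (cut? (v , i))

  inv⁺-new : ∀ j i → inv⁺ (new j i) ≡ old (D j i)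
  inv⁺-new 0F 0F = refl
  inv⁺-new 0F 1F = refl
  inv⁺-new 1F 0F = refl
  inv⁺-new 1F 1F = refl

  inv⁺-chord : ∀ j → inv⁺ (chordD j) ≡ chordD (flip j)
  inv⁺-chord 0F = refl
  inv⁺-chord 1F = refl

  inv⁺-cut : ∀ j i → inv⁺ (old (D j i)) ≡ new j i
  inv⁺-cut j i with cut? (D j i)
  ... | cut j′ i′ p with refl , refl ← D-injective {j} {i} p = refl
  ... | uncut p = ⊥-elim (p j i refl)

  inv⁺-uncut : ∀ {d} → (∀ j i → d ≢ D j i) → inv⁺ (old d) ≡ old (inv d)
  inv⁺-uncut {d} p with cut? d
  ... | cut j i q = ⊥-elim (p j i q)
  ... | uncut _ = refl

  uncut-inv : ∀ {d} → (∀ j i → d ≢ D j i) → ∀ j i → inv d ≢ D j i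
  uncut-inv {d} p j i q = p j (flip i) (trans (sym (inv-inv d)) (trans (cong inv q) (D-inv j i)))

  data View : Dart (2 + n) → Set where
    old-uncut : ∀ d → (∀ j i → d ≢ D j i) → View (old d)
    old-cut   : ∀ j i → View (old (D j i))
    at-new    : ∀ j i → View (new j i)
    on-chord  : ∀ j → View (chordD j)

  view : ∀ d → View d
  view (0F , 0F) = at-new 0F 0F
  view (0F , 1F) = at-new 0F 1F
  view (0F , 2F) = on-chord 0F
  view (1F , 0F) = at-new 1F 0F
  view (1F , 1F) = at-new 1F 1F
  view (1F , 2F) = on-chord 1F
  view (suc (suc v) , i) with cut? (v , i)
  ... | cut j i′ refl = old-cut j i′
  ... | uncut p = old-uncut (v , i) p

  inv⁺-inv⁺ : ∀ d → inv⁺ (inv⁺ d) ≡ d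
  inv⁺-inv⁺ d with view d
  ... | old-uncut e p = trans (cong inv⁺ (inv⁺-uncut p)) (trans (inv⁺-uncut (uncut-inv p)) (cong old (inv-inv e)))
  ... | old-cut j i = trans (cong inv⁺ (inv⁺-cut j i)) (inv⁺-new j i)
  ... | at-new j i = trans (cong inv⁺ (inv⁺-new j i)) (inv⁺-cut j i)
  ... | on-chord j = trans (cong inv⁺ (inv⁺-chord j)) (trans (inv⁺-chord (flip j)) (cong chordD (flip-flip j)))

  suc-suc-injective : ∀ {v w : Fin n} → Fin.suc (Fin.suc v) ≡ suc (suc w) → v ≡ w
  suc-suc-injective refl = refl

  newV≢old : ∀ {j} {v : Fin n} → newV j ≢ suc (suc v)
  newV≢old {0F} ()
  newV≢old {1F} ()

  loopless⁺ : ∀ d → proj₁ (inv⁺ d) ≢ proj₁ d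
  loopless⁺ d p with view d
  ... | old-uncut e q = loopless e (suc-suc-injective (trans (sym (cong proj₁ (inv⁺-uncut q))) p))
  ... | old-cut j i = newV≢old (trans (sym (cong proj₁ (inv⁺-cut j i))) p)
  ... | at-new j i = newV≢old (trans (sym p) (cong proj₁ (inv⁺-new j i)))
  ... | on-chord j = newV-flip j (trans (sym (cong proj₁ (inv⁺-chord j))) p)

  G⁺ : CubicGraph (2 + n)
  G⁺ = record { inv = inv⁺ ; inv-inv = inv⁺-inv⁺ ; loopless = loopless⁺ }

  module _ (X : Fin (2 + n) → Bool) where
    X₀ : Fin n → Bool
    X₀ v = X (suc (suc v))

    -- The dart of G whose crossing is witnessed by a crossing dart of G⁺; the value z at the chord is arbitrary.
    trace : Dart n → Dart (2 + n) → Dart n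
    trace z (0F , 0F) = D 0F 1F
    trace z (0F , 1F) = D 0F 0F
    trace z (0F , 2F) = z
    trace z (1F , 0F) = D 1F 1F
    trace z (1F , 1F) = D 1F 0F
    trace z (1F , 2F) = z
    trace z (suc (suc v) , i) = v , i

    trace-new : ∀ z j i → trace z (new j i) ≡ D j (flip i)
    trace-new z 0F 0F = refl
    trace-new z 0F 1F = refl
    trace-new z 1F 0F = refl
    trace-new z 1F 1F = refl

    trace-chord : ∀ z j → trace z (chordD j) ≡ z
    trace-chord z 0F = refl
    trace-chord z 1F = refl

    trace-trace : ∀ z b → trace (trace z b) b ≡ trace z b
    trace-trace z (0F , 0F) = refl
    trace-trace z (0F , 1F) = refl
    trace-trace z (0F , 2F) = refl
    trace-trace z (1F , 0F) = refl
    trace-trace z (1F , 1F) = refl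
    trace-trace z (1F , 2F) = refl
    trace-trace z (suc (suc v) , i) = refl

    module _ {a b c} (within : CutWithin G⁺ X a b c) where

      via : ∀ z e {d} → trace z e ≡ d → OneOf e a b c → OneOf d (trace z a) (trace z b) (trace z c)
      via z e refl (inj₁ refl) = inj₁ refl
      via z e refl (inj₂ (inj₁ refl)) = inj₂ (inj₁ refl)
      via z e refl (inj₂ (inj₂ refl)) = inj₂ (inj₂ refl)

      -- If a subdivided edge crosses the cut of `G`, its new vertex lies on one of the two sides,
      -- so one of its halves crosses in the same direction, and `trace` takes this half back to the
      -- crossing dart.
      restrict : ∀ z → CutWithin G X₀ (trace z a) (trace z b) (trace z c)
      restrict z d p q with cut? d
      ... | uncut r = via z (old d) refl (within (old d) p (trans (cong (X ∘ proj₁) (inv⁺-uncut r)) q))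
      ... | cut j i refl with X (newV j) in eq
      ...   | false = via z (old d) refl (within (old d) p (trans (cong (X ∘ proj₁) (inv⁺-cut j i)) eq))
      ...   | true = via z (new j (flip i)) (trans (trace-new z j (flip i)) (cong (D j) (flip-flip i)))
                       (within (new j (flip i)) eq
                         (trans (cong (X ∘ proj₁) (inv⁺-new j (flip i))) (trans (cong (X₀ ∘ proj₁) (sym (D-inv j i))) q)))

      new-crosses : ∀ j i → X (newV j) ≡ true → X₀ (proj₁ (D j i)) ≡ false → OneOf (new j i) a b c
      new-crosses j i p q = within (new j i) p (trans (cong (X ∘ proj₁) (inv⁺-new j i)) q)

      D-crosses : ∀ z j i → X (newV j) ≡ true → X₀ (proj₁ (D j (flip i))) ≡ false → OneOf (D j i) (trace z a) (trace z b) (trace z c)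
      D-crosses z j i p q =
        via z (new j (flip i)) (trans (trace-new z j (flip i)) (cong (D j) (flip-flip i))) (new-crosses j (flip i) p q)

  module _ (sct : SmallCutsTrivial G) where
    open Cuts G sct

    private z₀ = D 0F 0F

    -- A chord in the cut means that two edges already separate X₀.
    chord-cut : ∀ X j {b c} → CutWithin G⁺ X (chordD j) b c → X (newV j) ≡ true → X (newV (flip j)) ≡ false → TrivialCut X
    chord-cut X j {b} {c} within p q with no-2-cuts (X₀ X) _ _ two
      where
      -- With this value at the chord, `a` and `b` have the same trace, even if `b` is a chord dart
      -- itself; only two darts remain.
      z = trace X z₀ b
      two : CutWithin G (X₀ X) (trace X z c) z z
      two d r s with restrict X within z d r s
      ... | inj₁ t = inj₂ (inj₁ (trans t (trace-chord X z j)))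
      ... | inj₂ (inj₁ t) = inj₂ (inj₁ (trans t (trace-trace X z₀ b)))
      ... | inj₂ (inj₂ t) = inj₁ t
    ... | inj₁ none = inj₁ λ v w r s → trans (only v r) (sym (only w s))
      where
      only : ∀ v → X v ≡ true → v ≡ newV j
      only (suc (suc v)) r = ⊥-elim (true≢false r (none v))
      only 0F r with ≡or≡flip 0F j
      ... | inj₁ refl = refl
      ... | inj₂ t = ⊥-elim (true≢false r (trans (cong (X ∘ newV) t) q))
      only 1F r with ≡or≡flip 1F j
      ... | inj₁ refl = refl
      ... | inj₂ t = ⊥-elim (true≢false r (trans (cong (X ∘ newV) t) q))
    ... | inj₂ all = inj₂ λ v w r s → trans (only v r) (sym (only w s))
      where
      only : ∀ v → not (X v) ≡ true → v ≡ newV (flip j)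
      only (suc (suc v)) r = ⊥-elim (true≢false (all v) (not-true r))
      only 0F r with ≡or≡flip 0F j
      ... | inj₂ t = cong newV t
      ... | inj₁ refl = ⊥-elim (true≢false p (not-true r))
      only 1F r with ≡or≡flip 1F j
      ... | inj₂ t = cong newV t
      ... | inj₁ refl = ⊥-elim (true≢false p (not-true r))

    chord-cut′ : ∀ X j {a b c} → CutWithin G⁺ X a b c → X (newV j) ≡ true → X (newV (flip j)) ≡ false → TrivialCut X
    chord-cut′ X j within p q with within (chordD j) p (trans (cong (X ∘ proj₁) (inv⁺-chord j)) q)
    ... | inj₁ refl = chord-cut X j within p q
    ... | inj₂ (inj₁ refl) = chord-cut X j (λ d r s → rotate (within d r s)) p q
    ... | inj₂ (inj₂ refl) = chord-cut X j (λ d r s → rotate (rotate (within d r s))) p q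

    D≢D : ∀ {j i j′ i′} → (j , i) ≢ (j′ , i′) → D j i ≢ D j′ i′
    D≢D p q with refl , refl ← D-injective q = p refl

    not-on : ∀ v → ∃ λ j → ∀ i → proj₁ (D j i) ≢ v
    not-on v with proj₁ (D 0F 0F) Fin.≟ v | proj₁ (D 0F 1F) Fin.≟ v
    ... | yes refl | _ = 1F , λ i → apart 1F i 0F
    ... | no _ | yes refl = 1F , λ i → apart 1F i 1F
    ... | no p | no q = 0F , λ where
      0F → p
      1F → q

    one-side : ∀ X {a b c} → CutWithin G⁺ X a b c → AtMostOne (X₀ X) → TrivialCut X
    one-side X within one with X 0F in p | X 1F in q
    ... | true | false = chord-cut′ X 0F within p q
    ... | false | true = chord-cut′ X 1F within q p
    ... | false | false = inj₁ λ where
      0F _ r _ → ⊥-elim (true≢false r p)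
      1F _ r _ → ⊥-elim (true≢false r q)
      (suc (suc _)) 0F _ s → ⊥-elim (true≢false s p)
      (suc (suc _)) 1F _ s → ⊥-elim (true≢false s q)
      (suc (suc v)) (suc (suc w)) r s → cong (λ x → suc (suc x)) (one v w r s)
    ... | true | true with Fin.any? (λ v → X₀ X v Bool.≟ true)
    -- The two new vertices alone are left by four halves, which have different traces.
    ...   | no none = ⊥-elim (4-in-3 {x = D 0F 0F} {D 0F 1F} {D 1F 0F} {D 1F 1F}
              (D≢D λ ()) (D≢D λ ()) (D≢D λ ()) (D≢D λ ()) (D≢D λ ()) (D≢D λ ())
              (D-crosses X within z₀ 0F 0F p (out _)) (D-crosses X within z₀ 0F 1F p (out _))
              (D-crosses X within z₀ 1F 0F q (out _)) (D-crosses X within z₀ 1F 1F q (out _)))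
      where
      out : ∀ v → X₀ X v ≡ false
      out v with X₀ X v in eq
      ... | false = refl
      ... | true = ⊥-elim (none (v , eq))
    -- One of the two disjoint edges misses `v`. A half of it, leaving its new vertex, is added to
    -- the three darts of `v`.
    ...   | yes (v , r) with not-on v
    ...     | j , off = ⊥-elim (4-in-3 {x = v , 0F} {v , 1F} {v , 2F} {D j 0F} (λ ()) (λ ()) (at 0F) (λ ()) (at 2F) (at 1F)
                (leave 0F) (leave 1F) (leave 2F) (D-crosses X within z₀ j 0F (new-in j) (out (off 1F))))
      where
      at : ∀ i → (v , i) ≢ D j 0F
      at i s = off 0F (sym (cong proj₁ s))
      leave : ∀ i → OneOf (v , i) _ _ _
      leave i = restrict X within z₀ (v , i) r (singleton-boundary one v r i)
      new-in : ∀ j → X (newV j) ≡ true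
      new-in 0F = p
      new-in 1F = q
      out : ∀ {w} → w ≢ v → X₀ X w ≡ false
      out {w} s with X₀ X w in eq
      ... | false = refl
      ... | true = ⊥-elim (s (one w v eq r))

    -- The trace of a small cut is a small cut of `G`, hence one side has at most one old vertex. If
    -- it is the other side, the complement is used.
    small-cuts-trivial⁺ : SmallCutsTrivial G⁺
    small-cuts-trivial⁺ X a b c within with sct (X₀ X) _ _ _ (restrict X within z₀)
    ... | inj₁ one = one-side X within one
    ... | inj₂ one with one-side (not ∘ X) (complement G⁺ {X} within) one
    ...   | inj₁ t = inj₂ t
    ...   | inj₂ t = inj₁ λ v w r s → t v w (trans (cong not (cong not r)) refl) (cong not (cong not s))

-- Walks, and the effect of adding an edge between distant edges

module Walks {n} (G : CubicGraph n) where
  open CubicGraph G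

  data Walk (K : Dart n → Set) : Fin n → Fin n → ℕ → Set where
    []   : ∀ {a} → Walk K a a 0
    step : ∀ {a b l} i → K (a , i) → Walk K (tgt (a , i)) b l → Walk K a b (suc l)

  Any : Dart n → Set
  Any _ = ⊤

  Avoiding : Dart n → Dart n → Set
  Avoiding d e = e ≢ d × e ≢ inv d

  -- Circuits through the edge of `d` then have length at least `suc t`. Arbitrary walks are used
  -- instead of paths, so that pieces of walks can be joined and dropped freely.
  Far : Dart n → ℕ → Set
  Far d t = ∀ l → Walk (Avoiding d) (tgt d) (proj₁ d) l → t ≤ l

  module _ {K : Dart n → Set} where

    from : ∀ {a a′ b l} → a ≡ a′ → Walk K a b l → Walk K a′ b l
    from refl w = w

    to : ∀ {a b b′ l} → b ≡ b′ → Walk K a b l → Walk K a b′ l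
    to refl w = w

    _++ʷ_ : ∀ {a b c l m} → Walk K a b l → Walk K b c m → Walk K a c (l + m)
    [] ++ʷ v = v
    step i k w ++ʷ v = step i k (w ++ʷ v)

    forget : ∀ {a b l} → Walk K a b l → Walk Any a b l
    forget [] = []
    forget (step i _ w) = step i tt (forget w)

    snoc : ∀ {a b l} i → Walk K a b l → K (b , i) → Walk K a (tgt (b , i)) (suc l)
    snoc i [] k = step i k []
    snoc i (step j k′ w) k = step j k′ (snoc i w k)

    module _ (K-inv : ∀ d → K d → K (inv d)) where

      reverse : ∀ {a b l} → Walk K a b l → Walk K b a l
      reverse [] = []
      reverse {a} (step i k w) =
        to (cong proj₁ (inv-inv (a , i)))
          (snoc (proj₂ (inv (a , i))) (reverse w) (K-inv _ k))

  reverse-any : ∀ {a b l} → Walk Any a b l → Walk Any b a l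
  reverse-any = reverse (λ _ _ → tt)

  avoiding-inv : ∀ d e → Avoiding d e → Avoiding d (inv e)
  avoiding-inv d e (p , q) =
    (λ r → q (trans (sym (inv-inv e)) (cong inv r))) , (λ r → p (inv-injective r))

  far-inv : ∀ {d t} → Far d t → Far (inv d) t
  far-inv {d} {t} far l w =
    far l (reverse (avoiding-inv d) (from (cong proj₁ (inv-inv d)) (weaken w)))
    where
    weaken : ∀ {a b l} → Walk (Avoiding (inv d)) a b l → Walk (Avoiding d) a b l
    weaken [] = []
    weaken (step i (p , q) w) = step i ((λ r → q (trans r (sym (inv-inv d)))) , p) (weaken w)

  far-≤ : ∀ {d t t′} → t′ ≤ t → Far d t → Far d t′
  far-≤ p far l w = ℕ.≤-trans p (far l w)

module FarAddEdge {n} (G : CubicGraph n) (S : Sites G) where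
  open CubicGraph G
  open Sites S
  open AddEdge G S
  module W = Walks G
  module W⁺ = Walks G⁺

  Distant : ℕ → Set
  Distant R = ∀ j i i′ {l} → W.Walk W.Any (proj₁ (D j i)) (proj₁ (D (flip j) i′)) l → R ≤ l

  module _ {R} (distant : Distant R) {K⁺ : Dart (2 + n) → Set} {K : Dart n → Set}
           (K-uncut : ∀ {d} → (∀ j i → d ≢ D j i) → K⁺ (old d) → K d)
           -- Walking along both halves of a subdivided edge counts as walking along the edge.
           (K-cut : ∀ j i → K⁺ (old (D j i)) → K⁺ (new j (flip i)) → K (D j i)) where

    -- How a walk of the extended graph ending at an old vertex y looks in the original graph:
    -- it either never uses the chord, or it crosses from the j-th edge to the other one.
    data FromOld (y : Fin n) (x : Fin n) (l : ℕ) : Set where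
      direct : ∀ {l′} → W.Walk K x y l′ → l′ ≤ l → FromOld y x l
      crossing : ∀ j i i′ {l₁ l₂} → W.Walk K x (proj₁ (D j i)) l₁ → K⁺ (new (flip j) i′) →
                 W.Walk K (proj₁ (D (flip j) i′)) y l₂ → l₁ + l₂ < l → FromOld y x l
      long : R ≤ l → FromOld y x l

    -- The starting point is either new vertex: since the chord may be crossed before leaving,
    -- `exit` can be on either edge.
    data FromNew (y : Fin n) (l : ℕ) : Set where
      exit : ∀ j i {l′} → K⁺ (new j i) → W.Walk K (proj₁ (D j i)) y l′ → l′ < l → FromNew y l
      long : R ≤ l → FromNew y l

    data From (y : Fin n) (l : ℕ) : Fin (2 + n) → Set where
      at-old : ∀ {x} → FromOld y x l → From y l (suc (suc x))
      at-newV : ∀ {j} → FromNew y l → From y l (newV j)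

    from-old : ∀ {y l x} → From y l (suc (suc x)) → FromOld y x l
    from-old p = go p refl
      where
      go : ∀ {y l x p} → From y l p → p ≡ suc (suc x) → FromOld y x l
      go (at-old r) refl = r
      go (at-newV {j} r) q = ⊥-elim (newV≢old q)

    from-new : ∀ {y l j} → From y l (newV j) → FromNew y l
    from-new p = go p refl
      where
      go : ∀ {y l j p} → From y l p → p ≡ newV j → FromNew y l
      go (at-old r) q = ⊥-elim (newV≢old (sym q))
      go (at-newV r) q = r

    step-uncut : ∀ {y l x} i → K (x , i) → FromOld y (tgt (x , i)) l → FromOld y x (suc l)
    step-uncut i k (direct w p) = direct (W.step i k w) (s≤s p)
    step-uncut i k (crossing j i₁ i₂ w k′ w′ p) = crossing j i₁ i₂ (W.step i k w) k′ w′ (s≤s p)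
    step-uncut i k (long p) = long (ℕ.m≤n⇒m≤1+n p)

    step-cut : ∀ {y l} j i → K⁺ (old (D j i)) → FromNew y l → FromOld y (proj₁ (D j i)) (suc l)
    step-cut j i k (long p) = long (ℕ.m≤n⇒m≤1+n p)
    step-cut j i k (exit j′ i′ k′ w p) with ≡or≡flip j′ j
    ... | inj₂ refl = crossing j i i′ W.[] k′ w (ℕ.m≤n⇒m≤1+n p)
    ... | inj₁ refl with ≡or≡flip i′ i
    ...   | inj₁ refl = direct w (ℕ.m≤n⇒m≤1+n (ℕ.<⇒≤ p))
    ...   | inj₂ refl = direct (W.step (proj₂ (D j i)) (K-cut j i k k′)
                          (W.from (cong proj₁ (sym (D-inv j i))) w)) (ℕ.m≤n⇒m≤1+n p)

    step-new : ∀ {y l} j i → K⁺ (new j i) → FromOld y (proj₁ (D j i)) l → FromNew y (suc l)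
    step-new j i k (direct w p) = exit j i k w (s≤s p)
    step-new j i k (long p) = long (ℕ.m≤n⇒m≤1+n p)
    step-new j i k (crossing j′ i₁ i₂ {l₁} {l₂} w k′ w′ p) with ≡or≡flip j′ j
    -- A return to the same edge before the chord is a detour and is dropped; a passage to the other
    -- edge without the chord is already long.
    ... | inj₁ refl = exit (flip j) i₂ k′ w′ (ℕ.≤-trans (s≤s (ℕ.m≤n+m l₂ l₁)) (ℕ.m≤n⇒m≤1+n p))
    ... | inj₂ refl = long (ℕ.≤-trans (distant j i i₁ (W.forget w)) (ℕ.≤-trans (ℕ.m≤m+n l₁ l₂) (ℕ.m≤n⇒m≤1+n (ℕ.<⇒≤ p))))

    project : ∀ {y p l} → W⁺.Walk K⁺ p (suc (suc y)) l → From y l p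
    project-step : ∀ {y l} d → View d → K⁺ d → W⁺.Walk K⁺ (proj₁ (inv⁺ d)) (suc (suc y)) l → From y (suc l) (proj₁ d)
    project W⁺.[] = at-old (direct W.[] z≤n)
    project (W⁺.step {p} i k w) = project-step (p , i) (view (p , i)) k w
    project-step _ (old-uncut d q) k w =
      at-old (step-uncut (proj₂ d) (K-uncut q k) (from-old (subst (From _ _) (cong proj₁ (inv⁺-uncut q)) (project w))))
    project-step _ (old-cut j i) k w =
      at-old (step-cut j i k (from-new (subst (From _ _) (cong proj₁ (inv⁺-cut j i)) (project w))))
    project-step _ (at-new j i) k w =
      at-newV (step-new j i k (from-old (subst (From _ _) (cong proj₁ (inv⁺-new j i)) (project w))))
    project-step _ (on-chord j) k w with from-new {j = flip j} (subst (From _ _) (cong proj₁ (inv⁺-chord j)) (project w))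
    ... | exit j′ i k′ w′ p = at-newV (exit j′ i k′ w′ (ℕ.m≤n⇒m≤1+n p))
    ... | long p = at-newV (long (ℕ.m≤n⇒m≤1+n p))

  module _ {R} (distant : Distant R) where

    -- If the walk uses the chord, its two outer parts joined by `d` itself form a walk of `G`
    -- between the two subdivided edges, no longer than the given one, hence of length at least `R`.
    far-old : ∀ {d t} → t ≤ R → (∀ j i → d ≢ D j i) → W.Far d t → W⁺.Far (old d) t
    far-old {d} {t} t≤R un far l w
      with from-old distant {W⁺.Avoiding (old d)} {W.Avoiding d} K-uncut K-cut (project distant {W⁺.Avoiding (old d)} {W.Avoiding d} K-uncut K-cut (W⁺.from (cong proj₁ (inv⁺-uncut un)) w))
      where
      K-uncut : ∀ {e} → (∀ j i → e ≢ D j i) → W⁺.Avoiding (old d) (old e) → W.Avoiding d e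
      K-uncut _ (p , q) = p ∘ cong old , λ r → q (trans (cong old r) (sym (inv⁺-uncut un)))
      K-cut : ∀ j i → W⁺.Avoiding (old d) (old (D j i)) → _ → W.Avoiding d (D j i)
      K-cut j i _ _ = (λ r → un j i (sym r)) , λ r → uncut-inv un j i (sym r)
    ... | direct w′ p = ℕ.≤-trans (far _ w′) p
    ... | long p = ℕ.≤-trans t≤R p
    ... | crossing j i i′ {l₁} {l₂} w₁ _ w₂ p =
      ℕ.≤-trans t≤R (ℕ.≤-trans (distant (flip j) i′ i (W.to (cong (λ x → proj₁ (D x i)) (sym (flip-flip j)))
          (W.forget w₂ W.++ʷ W.step (proj₂ d) tt (W.forget w₁))))
        (ℕ.≤-trans (ℕ.≤-reflexive (trans (ℕ.+-suc l₂ l₁) (cong suc (ℕ.+-comm l₂ l₁)))) p))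

    -- This is the gain from subdividing: a walk from the new vertex that avoids one half leaves
    -- either by the other half, at the cost of one step more than in `G`, or by the chord, and then
    -- it has to come back from a distant edge.
    far-cut : ∀ {j i t} → suc t ≤ R → W.Far (D j i) t → W⁺.Far (old (D j i)) (suc t)
    far-cut {j} {i} {t} t<R far l w
      with from-new distant {W⁺.Avoiding (old (D j i))} {W.Avoiding (D j i)} K-uncut K-cut {j = j} (project distant {W⁺.Avoiding (old (D j i))} {W.Avoiding (D j i)} K-uncut K-cut (W⁺.from (cong proj₁ (inv⁺-cut j i)) w))
      where
      K-uncut : ∀ {e} → (∀ j i → e ≢ D j i) → _ → W.Avoiding (D j i) e
      K-uncut un _ = un j i , λ r → un j (flip i) (trans r (D-inv j i))
      K-cut : ∀ j′ i′ → W⁺.Avoiding (old (D j i)) (old (D j′ i′)) → W⁺.Avoiding (old (D j i)) (new j′ (flip i′)) →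
              W.Avoiding (D j i) (D j′ i′)
      K-cut j′ i′ (p , _) (_ , q) = p ∘ cong old , λ r → case D-injective {j′} {i′} (trans r (D-inv j i)) of λ where
        (refl , refl) → q (trans (cong (new j) (flip-flip i)) (sym (inv⁺-cut j i)))
    ... | long p = ℕ.≤-trans t<R p
    ... | exit j′ i′ (_ , q) w′ p with ≡or≡flip j′ j
    ...   | inj₂ refl = ℕ.≤-trans t<R (ℕ.≤-trans (distant (flip j) i′ i (W.to (cong (λ x → proj₁ (D x i)) (sym (flip-flip j)))
                          (W.forget w′))) (ℕ.<⇒≤ p))
    ...   | inj₁ refl with ≡or≡flip i′ i
    ...     | inj₁ refl = ⊥-elim (q (sym (inv⁺-cut j i)))
    ...     | inj₂ refl = ℕ.≤-trans (s≤s (far _ (W.from (cong proj₁ (sym (D-inv j i))) w′))) p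

    far-new : ∀ {j i t} → suc t ≤ R → W.Far (D j i) t → W⁺.Far (new j i) (suc t)
    far-new {j} {i} p far = subst (λ d → W⁺.Far d _) (inv⁺-cut j i) (W⁺.far-inv {old (D j i)} (far-cut p far))

-- Sums over all darts

shift : ∀ {n} → Dart n → Dart (suc n)
shift (v , i) = suc v , i

darts : ∀ n → List (Dart n)
darts zero = []
darts (suc n) = (zero , 0F) ∷ (zero , 1F) ∷ (zero , 2F) ∷ map shift (darts n)

∈-darts : ∀ {n} (d : Dart n) → d ∈ darts n
∈-darts (zero , 0F) = here refl
∈-darts (zero , 1F) = there (here refl)
∈-darts (zero , 2F) = there (there (here refl))
∈-darts (suc v , i) = there (there (there (∈-map⁺ shift (∈-darts (v , i)))))

darts-unique : ∀ n → Unique (darts n)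
darts-unique zero = []
darts-unique (suc n) =
  ((λ ()) ∷ (λ ()) ∷ fresh) ∷ ((λ ()) ∷ fresh) ∷ fresh ∷ Unique.map⁺ (λ { refl → refl }) (darts-unique n)
  where
  fresh : ∀ {i} → All ((zero , i) ≢_) (map shift (darts n))
  fresh = All.map⁺ (All.tabulate λ _ ())

module _ {n} (G : CubicGraph n) where
  open CubicGraph G

  darts-inv : map inv (darts n) ↭ darts n
  darts-inv = ∼bag⇒↭ (unique∧set⇒bag (Unique.map⁺ inv-injective (darts-unique n)) (darts-unique n)
    λ {d} → mk⇔ (λ _ → ∈-darts d) (λ _ → subst (_∈ map inv (darts n)) (inv-inv d) (∈-map⁺ inv (∈-darts (inv d)))))

  module _ {A : Set} {_∙_ : A → A → A} {ε : A} (cm : IsCommutativeMonoid _≡_ _∙_ ε) where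

    sum-inv : ∀ (f : Dart n → A) → foldr _∙_ ε (map (f ∘ inv) (darts n)) ≡ foldr _∙_ ε (map f (darts n))
    sum-inv f = trans (cong (foldr _∙_ ε) (map-∘ (darts n)))
      (Permₛ.foldr-commMonoid (setoid A) cm (↭⇒↭ₛ (map⁺ f darts-inv)))

    sum-∙ : ∀ (f g : Dart n → A) ds →
            foldr _∙_ ε (map (λ d → f d ∙ g d) ds) ≡ foldr _∙_ ε (map f ds) ∙ foldr _∙_ ε (map g ds)
    sum-∙ f g [] = sym (IsCommutativeMonoid.identityˡ cm ε)
    sum-∙ f g (d ∷ ds) = begin
      (f d ∙ g d) ∙ _  ≡⟨ cong ((f d ∙ g d) ∙_) (sum-∙ f g ds) ⟩
      (f d ∙ g d) ∙ (F ∙ H)  ≡⟨ assoc (f d) (g d) _ ⟩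
      f d ∙ (g d ∙ (F ∙ H))  ≡⟨ cong (f d ∙_) (sym (assoc (g d) F H)) ⟩
      f d ∙ ((g d ∙ F) ∙ H)  ≡⟨ cong (λ x → f d ∙ (x ∙ H)) (comm (g d) F) ⟩
      f d ∙ ((F ∙ g d) ∙ H)  ≡⟨ cong (f d ∙_) (assoc F (g d) H) ⟩
      f d ∙ (F ∙ (g d ∙ H))  ≡⟨ sym (assoc (f d) F _) ⟩
      (f d ∙ F) ∙ (g d ∙ H)  ∎
      where
      open ≡-Reasoning
      open IsCommutativeMonoid cm using (assoc; comm)
      F = foldr _∙_ ε (map f ds)
      H = foldr _∙_ ε (map g ds)

-- Flows with values in the four-group

V₄ : Set
V₄ = Bool × Bool

pattern O = false , false

infixr 6 _⊕_
_⊕_ : V₄ → V₄ → V₄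
(a , b) ⊕ (c , d) = (a xor c) , (b xor d)

⊕-assoc : ∀ x y z → (x ⊕ y) ⊕ z ≡ x ⊕ (y ⊕ z)
⊕-assoc (a , b) (c , d) (e , f) = cong₂ _,_ (xor-assoc a c e) (xor-assoc b d f)

⊕-comm : ∀ x y → x ⊕ y ≡ y ⊕ x
⊕-comm (a , b) (c , d) = cong₂ _,_ (xor-comm a c) (xor-comm b d)

⊕-self : ∀ x → x ⊕ x ≡ O
⊕-self (a , b) = cong₂ _,_ (xor-same a) (xor-same b)

⊕-identityʳ : ∀ x → x ⊕ O ≡ x
⊕-identityʳ (a , b) = cong₂ _,_ (xor-identityʳ a) (xor-identityʳ b)

⊕-isCommutativeMonoid : IsCommutativeMonoid _≡_ _⊕_ O
⊕-isCommutativeMonoid = record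
  { isMonoid = record
    { isSemigroup = record
      { isMagma = record { isEquivalence = isEquivalence ; ∙-cong = cong₂ _⊕_ }
      ; assoc = ⊕-assoc }
    ; identity = (λ _ → refl) , ⊕-identityʳ }
  ; comm = ⊕-comm }

⊕-cancel : ∀ x y → x ⊕ y ≡ O → x ≡ y
⊕-cancel x y p = begin
  x            ≡⟨ sym (⊕-identityʳ x) ⟩
  x ⊕ O        ≡⟨ cong (x ⊕_) (sym (⊕-self y)) ⟩
  x ⊕ (y ⊕ y)  ≡⟨ sym (⊕-assoc x y y) ⟩
  (x ⊕ y) ⊕ y  ≡⟨ cong (_⊕ y) p ⟩
  y            ∎
  where open ≡-Reasoning

total : ∀ {n} → (Dart n → V₄) → List (Dart n) → V₄
total f ds = foldr _⊕_ O (map f ds)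

module _ {n} (G : CubicGraph n) where
  open CubicGraph G

  -- Every edge contributes the same value twice. Formally, `h` keeps `f` on the darts towards a
  -- larger vertex, and `h` and `h ∘ inv` have equal totals.
  total-invariant : ∀ f → (∀ d → f (inv d) ≡ f d) → total f (darts n) ≡ O
  total-invariant f f-inv = begin
    total f (darts n)                                   ≡⟨ cong (foldr _⊕_ O) (map-cong split (darts n)) ⟩
    total (λ d → h d ⊕ h (inv d)) (darts n)             ≡⟨ sum-∙ G ⊕-isCommutativeMonoid h (h ∘ inv) (darts n) ⟩
    total h (darts n) ⊕ total (h ∘ inv) (darts n)       ≡⟨ cong (total h (darts n) ⊕_) (sum-inv G ⊕-isCommutativeMonoid h) ⟩
    total h (darts n) ⊕ total h (darts n)               ≡⟨ ⊕-self (total h (darts n)) ⟩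
    O                                                   ∎
    where
    open ≡-Reasoning
    when : ∀ {P : Set} → Dec P → V₄ → V₄
    when (yes _) x = x
    when (no _) x = O
    h : Dart n → V₄
    h d = when (proj₁ d Fin.<? tgt d) (f d)
    split : ∀ d → f d ≡ h d ⊕ h (inv d)
    split d with proj₁ d Fin.<? tgt d | tgt d Fin.<? tgt (inv d)
    ... | yes p | yes q = ⊥-elim (ℕ.<-asym p (subst (λ x → tgt d Fin.< proj₁ x) (inv-inv d) q))
    ... | yes p | no q = sym (⊕-identityʳ (f d))
    ... | no p | yes q = sym (f-inv d)
    ... | no p | no q with Fin.<-cmp (proj₁ d) (tgt d)
    ...   | tri< a _ _ = ⊥-elim (p a)
    ...   | tri≈ _ b _ = ⊥-elim (loopless d (sym b))
    ...   | tri> _ _ c = ⊥-elim (q (subst (λ x → tgt d Fin.< proj₁ x) (sym (inv-inv d)) c))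

select : ∀ {m} → Fin m → Maybe (Fin m) → V₄ → V₄
select b nothing x = O
select b (just b′) x = if does (b′ Fin.≟ b) then x else O

-- A nowhere-zero flow on the graph in which all edges labelled b are subdivided and
-- their midpoints identified.
record Flow {n m} (G : CubicGraph n) (label : Dart n → Maybe (Fin m)) (c : Dart n → V₄) : Set where
  open CubicGraph G
  field
    nonzero   : ∀ d → c d ≢ O
    conserved : ∀ v → c (v , 0F) ⊕ c (v , 1F) ⊕ c (v , 2F) ≡ O
    unlabelled : ∀ d → label d ≡ nothing → c (inv d) ≡ c d
    labelled  : ∀ b → total (λ d → select b (label d) (c d)) (darts n) ≡ O

NoFlow : ∀ {n m} → CubicGraph n → (Dart n → Maybe (Fin m)) → Set
NoFlow G label = ∀ c → ¬ Flow G label c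

module _ {m} (b : Fin m) where

  select-vertex : ∀ {x y z} l r → x ⊕ y ⊕ z ≡ O → select b l x ⊕ select b l y ⊕ select b l z ⊕ r ≡ r
  select-vertex nothing r p = refl
  select-vertex {x} {y} {z} (just b′) r p with does (b′ Fin.≟ b)
  ... | false = refl
  ... | true = begin
    x ⊕ y ⊕ z ⊕ r    ≡⟨ cong (x ⊕_) (sym (⊕-assoc y z r)) ⟩
    x ⊕ (y ⊕ z) ⊕ r  ≡⟨ sym (⊕-assoc x (y ⊕ z) r) ⟩
    (x ⊕ y ⊕ z) ⊕ r  ≡⟨ cong (_⊕ r) p ⟩
    r                ∎
    where open ≡-Reasoning

module _ {n} (G : CubicGraph n) (S : Sites G) where
  open CubicGraph G
  open Sites S
  open AddEdge G S

  -- Chords between edges of the same label stay inside the identified vertex.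
  no-flow⁺ : ∀ {m} {label : Dart n → Maybe (Fin m)} {label⁺ : Dart (2 + n) → Maybe (Fin m)} →
             (∀ d → label⁺ (old d) ≡ label d) → (∀ j i → label⁺ (newV j , i) ≡ label⁺ (newV j , 0F)) →
             (∀ j i → label (D j i) ≢ nothing) → NoFlow G label → NoFlow G⁺ label⁺
  no-flow⁺ {m} {label} {label⁺} label-old label-new label-D none c flow = none (c ∘ old) record
    { nonzero = λ d → nonzero (old d)
    ; conserved = λ v → conserved (suc (suc v))
    ; unlabelled = λ d p → trans (cong c (sym (inv⁺-uncut λ { j i refl → label-D j i p })))
                                 (unlabelled (old d) (trans (label-old d) p))
    ; labelled = λ b → trans (sym (old-total b)) (labelled b) }
    where
    open Flow flow
    open ≡-Reasoning
    old-total : ∀ b → total (λ d → select b (label⁺ d) (c d)) (darts (2 + n)) ≡ total (λ d → select b (label d) (c (old d))) (darts n)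
    old-total b = begin
      f (0F , 0F) ⊕ f (0F , 1F) ⊕ f (0F , 2F) ⊕ f (1F , 0F) ⊕ f (1F , 1F) ⊕ f (1F , 2F) ⊕ rest
        ≡⟨ at 0F _ ⟩
      f (1F , 0F) ⊕ f (1F , 1F) ⊕ f (1F , 2F) ⊕ rest
        ≡⟨ at 1F _ ⟩
      rest
        ≡⟨ cong (foldr _⊕_ O) (trans (sym (map-∘ (map shift (darts n)))) (sym (map-∘ (darts n)))) ⟩
      total (f ∘ old) (darts n)
        ≡⟨ cong (foldr _⊕_ O) (map-cong (λ d → cong (λ l → select b l (c (old d))) (label-old d)) (darts n)) ⟩
      total (λ d → select b (label d) (c (old d))) (darts n) ∎
      where
      f : Dart (2 + n) → V₄
      f d = select b (label⁺ d) (c d)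
      rest = total f (map shift (map shift (darts n)))
      at : ∀ j r → f (newV j , 0F) ⊕ f (newV j , 1F) ⊕ f (newV j , 2F) ⊕ r ≡ r
      at j r = trans (cong₂ (λ l l′ → f (newV j , 0F) ⊕ select b l (c (newV j , 1F)) ⊕ select b l′ (c (newV j , 2F)) ⊕ r)
                       (label-new j 1F) (label-new j 2F))
                     (select-vertex b (label⁺ (newV j , 0F)) r (conserved (newV j)))

-- An ordinary flow, with equal values on both darts of every edge, stays a flow after the
-- identification: the darts of a label cancel in pairs.
flow-of-colouring : ∀ {n m} (G : CubicGraph n) {label : Dart n → Maybe (Fin m)} {c : Dart n → V₄} →
  (∀ d → label (CubicGraph.inv G d) ≡ label d) → (∀ d → c (CubicGraph.inv G d) ≡ c d) → (∀ d → c d ≢ O) →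
  (∀ v → c (v , 0F) ⊕ c (v , 1F) ⊕ c (v , 2F) ≡ O) → Flow G label c
flow-of-colouring G label-inv c-inv nz cons = record
  { nonzero = nz
  ; conserved = cons
  ; unlabelled = λ d _ → c-inv d
  ; labelled = λ b → total-invariant G _ λ d → cong₂ (select b) (label-inv d) (c-inv d) }

-- States: a fixed frame, with paths in place of the labelled edges

odd : ℕ → Bool
odd zero = false
odd (suc n) = not (odd n)

-- low s and high s are the darts at the lower and the upper end of a segment of the path s.
data Kind (paths blobs : ℕ) : Set where
  plain    : Fin 3 → Kind paths blobs
  low high : Fin paths → Kind paths blobs
  chord    : Fin blobs → Kind paths blobs

-- The part common to all states. Its plain edges are never subdivided; `blob` gives the label of a
-- path, and `uF`, `vF` is the pair to be removed.
record Frame : Set where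
  field
    frames paths blobs : ℕ
    blob  : Fin paths → Fin blobs
    kindF : Fin frames → Fin 3 → Kind paths blobs
    mateF : Fin frames → Fin 3 → Dart frames
    uF vF : Fin frames

bit : Bool → ℕ
bit true = 1
bit false = 0

<ᵇ-true : ∀ {m n} → m < n → (m <ᵇ n) ≡ true
<ᵇ-true {m} {n} p with m <ᵇ n | ℕ.<⇒<ᵇ p
... | true | _ = refl

<ᵇ-false : ∀ {m n} → n ≤ m → (m <ᵇ n) ≡ false
<ᵇ-false {m} {n} p with m <ᵇ n in eq
... | false = refl
... | true = ⊥-elim (ℕ.<⇒≱ (ℕ.<ᵇ⇒< m n (subst T (sym eq) _)) p)

-- Renumbering of the segments of a path when its segments r₁ < r₂ are subdivided: a segment
-- of rank r has rank lo r at its lower end and rank up r at its upper end.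
module Renumber (r₁ r₂ : ℕ) where

  lo up : ℕ → ℕ
  lo r = bit (r₁ <ᵇ r) + (bit (r₂ <ᵇ r) + r)
  up r = bit (r₁ <ᵇ suc r) + (bit (r₂ <ᵇ suc r) + r)

  lo-suc : ∀ r → lo (suc r) ≡ suc (up r)
  lo-suc r = trans (cong (bit (r₁ <ᵇ suc r) +_) (ℕ.+-suc (bit (r₂ <ᵇ suc r)) r)) (ℕ.+-suc (bit (r₁ <ᵇ suc r)) _)

  bit≤1 : ∀ b → bit b ≤ 1
  bit≤1 true = s≤s z≤n
  bit≤1 false = z≤n

  lo≤ : ∀ {r l} → r ≤ l → lo r ≤ 2 + l
  lo≤ {r} p = ℕ.+-mono-≤ (bit≤1 (r₁ <ᵇ r)) (ℕ.+-mono-≤ (bit≤1 (r₂ <ᵇ r)) p)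

  module _ (r₁<r₂ : r₁ < r₂) where

    lo-below : ∀ {r} → r ≤ r₁ → lo r ≡ r
    lo-below {r} p = cong₂ (λ a b → bit a + (bit b + r)) (<ᵇ-false p) (<ᵇ-false (ℕ.≤-trans p (ℕ.<⇒≤ r₁<r₂)))

    lo-between : ∀ {r} → r₁ < r → r ≤ r₂ → lo r ≡ suc r
    lo-between {r} p q = cong₂ (λ a b → bit a + (bit b + r)) (<ᵇ-true p) (<ᵇ-false q)

    lo-above : ∀ {r} → r₂ < r → lo r ≡ 2 + r
    lo-above {r} p = cong₂ (λ a b → bit a + (bit b + r)) (<ᵇ-true (ℕ.<-trans r₁<r₂ p)) (<ᵇ-true p)

    data Region (r : ℕ) : Set where
      below   : r ≤ r₁ → Region r
      between : r₁ < r → r ≤ r₂ → Region r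
      above   : r₂ < r → Region r

    region : ∀ r → Region r
    region r with r ℕ.≤? r₁ | r ℕ.≤? r₂
    ... | yes p | _ = below p
    ... | no p | yes q = between (ℕ.≰⇒> p) q
    ... | no p | no q = above (ℕ.≰⇒> q)

    up-via : ∀ {r k} → lo (suc r) ≡ suc k → up r ≡ k
    up-via {r} p = ℕ.suc-injective (trans (sym (lo-suc r)) p)

    up-r₁ : up r₁ ≡ suc r₁
    up-r₁ = up-via {r₁} (lo-between ℕ.≤-refl r₁<r₂)

    up-above : ∀ {r} → r₂ ≤ r → up r ≡ 2 + r
    up-above {r} p = up-via {r} (lo-above (s≤s p))

    lo-r₂ : lo r₂ ≡ suc r₂
    lo-r₂ = lo-between r₁<r₂ ℕ.≤-refl

    lo≡up : ∀ {r} → r ≢ r₁ → r ≢ r₂ → lo r ≡ up r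
    lo≡up {r} p q with region r
    ... | below a = trans (lo-below a) (sym (up-via {r} (lo-below (ℕ.≤∧≢⇒< a p))))
    ... | between a b = trans (lo-between a b) (sym (up-via {r} (lo-between (ℕ.m≤n⇒m≤1+n a) (ℕ.≤∧≢⇒< b q))))
    ... | above a = trans (lo-above a) (sym (up-above (ℕ.<⇒≤ a)))

    lo-mono : ∀ {r t} → r < t → lo r < lo t
    lo-mono {r} {t} p with region r | region t
    ... | below a | below b = subst₂ _<_ (sym (lo-below a)) (sym (lo-below b)) p
    ... | below a | between b c = subst₂ _<_ (sym (lo-below a)) (sym (lo-between b c)) (ℕ.m≤n⇒m≤1+n p)
    ... | below a | above b = subst₂ _<_ (sym (lo-below a)) (sym (lo-above b)) (ℕ.m≤n⇒m≤1+n (ℕ.m≤n⇒m≤1+n p))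
    ... | between a b | below c = ⊥-elim (ℕ.<-irrefl refl (ℕ.<-trans a (ℕ.<-≤-trans p c)))
    ... | between a b | between c d = subst₂ _<_ (sym (lo-between a b)) (sym (lo-between c d)) (s≤s p)
    ... | between a b | above c = subst₂ _<_ (sym (lo-between a b)) (sym (lo-above c)) (s≤s (ℕ.m≤n⇒m≤1+n p))
    ... | above a | below c = ⊥-elim (ℕ.<-irrefl refl (ℕ.<-trans a (ℕ.<-≤-trans p (ℕ.≤-trans c (ℕ.<⇒≤ r₁<r₂)))))
    ... | above a | between c d = ⊥-elim (ℕ.<-irrefl refl (ℕ.<-trans a (ℕ.<-≤-trans p d)))
    ... | above a | above c = subst₂ _<_ (sym (lo-above a)) (sym (lo-above c)) (s≤s (s≤s p))

    lo-injective : ∀ {r t} → lo r ≡ lo t → r ≡ t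
    lo-injective {r} {t} p with ℕ.<-cmp r t
    ... | tri< a _ _ = ⊥-elim (ℕ.<-irrefl p (lo-mono a))
    ... | tri≈ _ b _ = b
    ... | tri> _ _ c = ⊥-elim (ℕ.<-irrefl (sym p) (lo-mono c))

    -- The numbers `suc r₁` and `2 + r₂` are exactly those skipped by `lo`; they become the ranks of
    -- the upper halves of the two split segments.
    lo≢suc-r₁ : ∀ r → lo r ≢ suc r₁
    lo≢suc-r₁ r p with region r
    ... | below a = ℕ.<-irrefl (trans (sym (lo-below a)) p) (s≤s a)
    ... | between a b = ℕ.<-irrefl (sym (ℕ.suc-injective (trans (sym (lo-between a b)) p))) a
    ... | above a = ℕ.<-irrefl (sym (ℕ.suc-injective (trans (sym (lo-above a)) p))) (ℕ.m≤n⇒m≤1+n (ℕ.<-trans r₁<r₂ a))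

    lo≢2+r₂ : ∀ r → lo r ≢ 2 + r₂
    lo≢2+r₂ r p with region r
    ... | below a = ℕ.<-irrefl (trans (sym (lo-below a)) p) (s≤s (ℕ.m≤n⇒m≤1+n (ℕ.≤-trans a (ℕ.<⇒≤ r₁<r₂))))
    ... | between a b = ℕ.<-irrefl (ℕ.suc-injective (trans (sym (lo-between a b)) p)) (s≤s b)
    ... | above a = ℕ.<-irrefl (sym (ℕ.suc-injective (ℕ.suc-injective (trans (sym (lo-above a)) p)))) a

module States (Φ : Frame) where
  open Frame Φ

  data Role : Set where
    point : Fin paths → Role
    frame : Fin frames → Role

  mate : Kind paths blobs → Kind paths blobs
  mate (plain c) = plain c
  mate (low s) = high s
  mate (high s) = low s
  mate (chord b) = chord b

  label : Kind paths blobs → Maybe (Fin blobs)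
  label (plain _) = nothing
  label (low s) = just (blob s)
  label (high s) = just (blob s)
  label (chord b) = just b

  kind-at : Role → Fin 3 → Kind paths blobs
  kind-at (point s) 0F = high s
  kind-at (point s) 1F = low s
  kind-at (point s) 2F = chord (blob s)
  kind-at (frame x) i = kindF x i

  rank-frame : (Fin paths → ℕ) → Kind paths blobs → ℕ
  rank-frame len (high s) = len s
  rank-frame len _ = 0

  rank-at : (Fin paths → ℕ) → ℕ → Role → Fin 3 → ℕ
  rank-at len r (point s) 0F = r
  rank-at len r (point s) 1F = suc r
  rank-at len r (point s) 2F = 0
  rank-at len r (frame x) i = rank-frame len (kindF x i)

  -- A path runs from the frame through points to the frame.  Its segments are ranked 0, …, len;
  -- a point has its lower segment at dart 0, its upper segment at dart 1 and its chord at dart 2.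
  record State (n : ℕ) : Set where
    field
      graph : CubicGraph n
      role  : Fin n → Role
      rk    : Fin n → ℕ
      len   : Fin paths → ℕ
      frameV : Fin frames → Fin n
    open CubicGraph graph public

    kind : Dart n → Kind paths blobs
    kind d = kind-at (role (proj₁ d)) (proj₂ d)

    rank : Dart n → ℕ
    rank d = rank-at len (rk (proj₁ d)) (role (proj₁ d)) (proj₂ d)

    field
      small-cuts   : SmallCutsTrivial graph
      no-flow      : NoFlow graph (label ∘ kind)
      kind-inv     : ∀ d → kind (inv d) ≡ mate (kind d)
      rank-inv     : ∀ d → rank (inv d) ≡ rank d
      -- Path and rank determine a segment, so an uncut segment never has the rank of a cut one.
      low-unique   : ∀ {s d e} → kind d ≡ low s → kind e ≡ low s → rank d ≡ rank e → d ≡ e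
      rank≤len     : ∀ {s d} → kind d ≡ low s → rank d ≤ len s
      -- The alternating colours of a path then agree at its two end segments, of ranks 0 and
      -- `len s`.
      len-even     : ∀ s → odd (len s) ≡ false
      -- This keeps the first and the last segment of a path disjoint.
      2≤len        : ∀ s → 2 ≤ len s
      role-frameV  : ∀ x → role (frameV x) ≡ frame x
      frame-unique : ∀ {v x} → role v ≡ frame x → v ≡ frameV x
      frame-inv    : ∀ {x i c} → kindF x i ≡ plain c → inv (frameV x , i) ≡ (frameV (proj₁ (mateF x i)) , proj₂ (mateF x i))

  module Subdivide {n} (st : State n) {s : Fin paths} {d₁ d₂ : Dart n}
                   (low₁ : State.kind st d₁ ≡ low s) (low₂ : State.kind st d₂ ≡ low s)
                   (r₁<r₂ : State.rank st d₁ < State.rank st d₂)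
                   (disjoint : ∀ e₁ e₂ → e₁ ≡ d₁ ⊎ e₁ ≡ State.inv st d₁ → e₂ ≡ d₂ ⊎ e₂ ≡ State.inv st d₂ → proj₁ e₁ ≢ proj₁ e₂) where
    open State st

    dart : Fin 2 → Dart n
    dart 0F = d₁
    dart 1F = d₂

    D : Fin 2 → Fin 2 → Dart n
    D j 0F = dart j
    D j 1F = inv (dart j)

    sites : Sites graph
    sites = record
      { D = D
      ; D-inv = λ { j 0F → refl ; j 1F → inv-inv (dart j) }
      ; apart = λ { 0F i i′ → disjoint _ _ (is-D 0F i) (is-D 1F i′) ; 1F i i′ p → disjoint _ _ (is-D 0F i′) (is-D 1F i) (sym p) } }
      where
      is-D : ∀ j i → D j i ≡ dart j ⊎ D j i ≡ inv (dart j)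
      is-D j 0F = inj₁ refl
      is-D j 1F = inj₂ refl

    open Sites sites hiding (D)
    open AddEdge graph sites

    r : Fin 2 → ℕ
    r j = rank (dart j)

    open Renumber (r 0F) (r 1F)

    rank-D : ∀ j i → rank (D j i) ≡ r j
    rank-D j 0F = refl
    rank-D j 1F = rank-inv (dart j)

    kind-dart : ∀ j → kind (dart j) ≡ low s
    kind-dart 0F = low₁
    kind-dart 1F = low₂

    kind-D : Fin 2 → Kind paths blobs
    kind-D 0F = low s
    kind-D 1F = high s

    kind-D≡ : ∀ j i → kind (D j i) ≡ kind-D i
    kind-D≡ j 0F = kind-dart j
    kind-D≡ j 1F = trans (kind-inv (dart j)) (cong mate (kind-dart j))

    role⁺ : Fin (2 + n) → Role
    role⁺ 0F = point s
    role⁺ 1F = point s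
    role⁺ (suc (suc v)) = role v

    rk-old : Role → ℕ → ℕ
    rk-old (frame _) k = k
    rk-old (point s′) k with s′ Fin.≟ s
    ... | yes _ = up k
    ... | no _ = k

    rk⁺ : Fin (2 + n) → ℕ
    rk⁺ 0F = r 0F
    -- The first new point lies below the second, hence the shift by one.
    rk⁺ 1F = suc (r 1F)
    rk⁺ (suc (suc v)) = rk-old (role v) (rk v)

    len⁺ : Fin paths → ℕ
    len⁺ s′ with s′ Fin.≟ s
    ... | yes _ = 2 + len s′
    ... | no _ = len s′

    len⁺-s : len⁺ s ≡ 2 + len s
    len⁺-s with s Fin.≟ s
    ... | yes _ = refl
    ... | no p = ⊥-elim (p refl)

    len⁺-≢ : ∀ {s′} → s′ ≢ s → len⁺ s′ ≡ len s′
    len⁺-≢ {s′} p with s′ Fin.≟ s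
    ... | yes q = ⊥-elim (p q)
    ... | no _ = refl

    kind⁺ : Dart (2 + n) → Kind paths blobs
    kind⁺ d = kind-at (role⁺ (proj₁ d)) (proj₂ d)

    rank⁺ : Dart (2 + n) → ℕ
    rank⁺ d = rank-at len⁺ (rk⁺ (proj₁ d)) (role⁺ (proj₁ d)) (proj₂ d)

    r₂≤len : r 1F ≤ len s
    r₂≤len = rank≤len low₂

    kind-new : ∀ j i → kind⁺ (new j i) ≡ mate (kind-D i)
    kind-new 0F 0F = refl
    kind-new 0F 1F = refl
    kind-new 1F 0F = refl
    kind-new 1F 1F = refl

    kind-chord : ∀ j → kind⁺ (chordD j) ≡ chord (blob s)
    kind-chord 0F = refl
    kind-chord 1F = refl

    -- On a cut segment the two darts end up in different halves, so their ranks change differently;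
    -- on an uncut one `lo` and `up` agree.
    renumber : Kind paths blobs → ℕ → ℕ
    renumber (low s′) k with s′ Fin.≟ s
    ... | yes _ = lo k
    ... | no _ = k
    renumber (high s′) k with s′ Fin.≟ s
    ... | yes _ = up k
    ... | no _ = k
    renumber _ k = k

    renumber-low : ∀ k → renumber (low s) k ≡ lo k
    renumber-low k with s Fin.≟ s
    ... | yes _ = refl
    ... | no p = ⊥-elim (p refl)

    renumber-high : ∀ k → renumber (high s) k ≡ up k
    renumber-high k with s Fin.≟ s
    ... | yes _ = refl
    ... | no p = ⊥-elim (p refl)

    rank-old : ∀ d → rank⁺ (old d) ≡ renumber (kind d) (rank d)
    rank-old (v , i) = go (role v) (rk v) i
      where
      frames-ok : ∀ k → rank-frame len⁺ k ≡ renumber k (rank-frame len k)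
      frames-ok (plain _) = refl
      frames-ok (chord _) = refl
      frames-ok (low s′) with s′ Fin.≟ s
      ... | yes _ = refl
      ... | no _ = refl
      frames-ok (high s′) with s′ Fin.≟ s
      ... | yes refl = sym (up-above r₁<r₂ r₂≤len)
      ... | no _ = refl
      go : ∀ ρ k i → rank-at len⁺ (rk-old ρ k) ρ i ≡ renumber (kind-at ρ i) (rank-at len k ρ i)
      go (frame x) k i = frames-ok (kindF x i)
      go (point s′) k 0F with s′ Fin.≟ s
      ... | yes _ = refl
      ... | no _ = refl
      go (point s′) k 1F with s′ Fin.≟ s
      ... | yes _ = sym (lo-suc k)
      ... | no _ = refl
      go (point s′) k 2F = refl

    renumber-cut : ∀ j i → renumber (kind-D i) (r j) ≡ rank⁺ (new j i)
    renumber-cut 0F 0F = trans (renumber-low (r 0F)) (lo-below r₁<r₂ ℕ.≤-refl)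
    renumber-cut 0F 1F = trans (renumber-high (r 0F)) (up-r₁ r₁<r₂)
    renumber-cut 1F 0F = trans (renumber-low (r 1F)) (lo-r₂ r₁<r₂)
    renumber-cut 1F 1F = trans (renumber-high (r 1F)) (up-above r₁<r₂ ℕ.≤-refl)

    rank-cut : ∀ j i → rank⁺ (old (D j i)) ≡ rank⁺ (new j i)
    rank-cut j i = trans (rank-old (D j i)) (trans (cong₂ renumber (kind-D≡ j i) (rank-D j i)) (renumber-cut j i))

    low-rank≢ : ∀ {d} j → (∀ j i → d ≢ D j i) → kind d ≡ low s → rank d ≢ r j
    low-rank≢ j un p q = un j 0F (low-unique p (kind-dart j) q)

    renumber-mate : ∀ {d} → (∀ j i → d ≢ D j i) → renumber (kind (inv d)) (rank (inv d)) ≡ renumber (kind d) (rank d)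
    renumber-mate {d} un with kind d in eq | kind (inv d) in eq′ | kind-inv d
    ... | plain _ | _ | refl = rank-inv d
    ... | chord _ | _ | refl = rank-inv d
    ... | low s′ | _ | refl with s′ Fin.≟ s
    ...   | no _ = rank-inv d
    ...   | yes refl = trans (cong up (rank-inv d)) (sym (lo≡up r₁<r₂ (low-rank≢ 0F un eq) (low-rank≢ 1F un eq)))
    renumber-mate {d} un | high s′ | _ | refl with s′ Fin.≟ s
    ...   | no _ = rank-inv d
    ...   | yes refl = trans (lo≡up r₁<r₂ (low-rank≢ 0F (uncut-inv un) eq′) (low-rank≢ 1F (uncut-inv un) eq′)) (cong up (rank-inv d))

    rank-chord : ∀ j → rank⁺ (chordD j) ≡ 0
    rank-chord 0F = refl
    rank-chord 1F = refl

    kind-inv⁺ : ∀ d → kind⁺ (inv⁺ d) ≡ mate (kind⁺ d)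
    kind-inv⁺ d with view d
    ... | old-uncut e un = trans (cong kind⁺ (inv⁺-uncut un)) (kind-inv e)
    ... | old-cut j i = trans (cong kind⁺ (inv⁺-cut j i)) (trans (kind-new j i) (cong mate (sym (kind-D≡ j i))))
    ... | at-new j i = trans (cong kind⁺ (inv⁺-new j i)) (trans (kind-D≡ j i) (trans (sym (mate-mate i)) (cong mate (sym (kind-new j i)))))
      where
      mate-mate : ∀ i → mate (mate (kind-D i)) ≡ kind-D i
      mate-mate 0F = refl
      mate-mate 1F = refl
    ... | on-chord j = trans (cong kind⁺ (inv⁺-chord j)) (trans (kind-chord (flip j)) (cong mate (sym (kind-chord j))))

    rank-inv⁺ : ∀ d → rank⁺ (inv⁺ d) ≡ rank⁺ d
    rank-inv⁺ d with view d
    ... | old-uncut e un = trans (cong rank⁺ (inv⁺-uncut un)) (trans (rank-old (inv e)) (trans (renumber-mate un) (sym (rank-old e))))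
    ... | old-cut j i = trans (cong rank⁺ (inv⁺-cut j i)) (sym (rank-cut j i))
    ... | at-new j i = trans (cong rank⁺ (inv⁺-new j i)) (rank-cut j i)
    ... | on-chord j = trans (cong rank⁺ (inv⁺-chord j)) (trans (rank-chord (flip j)) (sym (rank-chord j)))

    data LowView (s′ : Fin paths) : Dart (2 + n) → Set where
      old-low : ∀ d → kind d ≡ low s′ → LowView s′ (old d)
      new-low : ∀ j → s′ ≡ s → LowView s′ (new j 1F)

    low-view : ∀ {s′} d → kind⁺ d ≡ low s′ → LowView s′ d
    low-view (0F , 0F) ()
    low-view (0F , 2F) ()
    low-view (1F , 0F) ()
    low-view (1F , 2F) ()
    low-view (0F , 1F) refl = new-low 0F refl
    low-view (1F , 1F) refl = new-low 1F refl
    low-view (suc (suc v) , i) p = old-low (v , i) p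

    rank-low : ∀ d → kind d ≡ low s → rank⁺ (old d) ≡ lo (rank d)
    rank-low d p = trans (rank-old d) (trans (cong (λ k → renumber k (rank d)) p) (renumber-low (rank d)))

    rank-low-≢ : ∀ {s′} d → s′ ≢ s → kind d ≡ low s′ → rank⁺ (old d) ≡ rank d
    rank-low-≢ {s′} d q p = trans (rank-old d) (trans (cong (λ k → renumber k (rank d)) p) unchanged)
      where
      unchanged : renumber (low s′) (rank d) ≡ rank d
      unchanged with s′ Fin.≟ s
      ... | yes t = ⊥-elim (q t)
      ... | no _ = refl

    old≢new : ∀ d j → kind d ≡ low s → rank⁺ (old d) ≢ rank⁺ (new j 1F)
    old≢new d 0F p q = lo≢suc-r₁ r₁<r₂ (rank d) (trans (sym (rank-low d p)) q)
    old≢new d 1F p q = lo≢2+r₂ r₁<r₂ (rank d) (trans (sym (rank-low d p)) q)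

    low-unique⁺ : ∀ {s′ d e} → kind⁺ d ≡ low s′ → kind⁺ e ≡ low s′ → rank⁺ d ≡ rank⁺ e → d ≡ e
    low-unique⁺ {s′} {d} {e} p q t with low-view d p | low-view e q
    ... | new-low j refl | old-low e′ q′ = ⊥-elim (old≢new e′ j q′ (sym t))
    ... | old-low d′ p′ | new-low j refl = ⊥-elim (old≢new d′ j p′ t)
    ... | new-low 0F _ | new-low 0F _ = refl
    ... | new-low 1F _ | new-low 1F _ = refl
    ... | new-low 0F _ | new-low 1F _ = ⊥-elim (ℕ.<-irrefl t (s≤s (ℕ.m≤n⇒m≤1+n r₁<r₂)))
    ... | new-low 1F _ | new-low 0F _ = ⊥-elim (ℕ.<-irrefl (sym t) (s≤s (ℕ.m≤n⇒m≤1+n r₁<r₂)))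
    ... | old-low d′ p′ | old-low e′ q′ with s′ Fin.≟ s
    ...   | yes refl = cong old (low-unique p′ q′ (lo-injective r₁<r₂ (trans (sym (rank-low d′ p′)) (trans t (rank-low e′ q′)))))
    ...   | no ne = cong old (low-unique p′ q′ (trans (sym (rank-low-≢ d′ ne p′)) (trans t (rank-low-≢ e′ ne q′))))

    rank≤len⁺ : ∀ {s′ d} → kind⁺ d ≡ low s′ → rank⁺ d ≤ len⁺ s′
    rank≤len⁺ {s′} {d} p with low-view d p
    ... | new-low 0F refl = ℕ.≤-trans (s≤s (ℕ.m≤n⇒m≤1+n (ℕ.≤-trans (ℕ.<⇒≤ r₁<r₂) r₂≤len))) (ℕ.≤-reflexive (sym len⁺-s))
    ... | new-low 1F refl = ℕ.≤-trans (s≤s (s≤s r₂≤len)) (ℕ.≤-reflexive (sym len⁺-s))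
    ... | old-low d′ p′ = case s′ Fin.≟ s of λ where
      (yes refl) → ℕ.≤-trans (ℕ.≤-reflexive (rank-low d′ p′)) (ℕ.≤-trans (lo≤ (rank≤len p′)) (ℕ.≤-reflexive (sym len⁺-s)))
      (no ne) → ℕ.≤-trans (ℕ.≤-reflexive (rank-low-≢ d′ ne p′)) (ℕ.≤-trans (rank≤len p′) (ℕ.≤-reflexive (sym (len⁺-≢ ne))))

    label-vertex : ∀ j i → label (kind⁺ (newV j , i)) ≡ label (kind⁺ (newV j , 0F))
    label-vertex 0F 0F = refl
    label-vertex 0F 1F = refl
    label-vertex 0F 2F = refl
    label-vertex 1F 0F = refl
    label-vertex 1F 1F = refl
    label-vertex 1F 2F = refl

    label-D : ∀ j i → label (kind (D j i)) ≢ nothing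
    label-D j 0F p = case trans (sym p) (cong label (kind-D≡ j 0F)) of λ ()
    label-D j 1F p = case trans (sym p) (cong label (kind-D≡ j 1F)) of λ ()

    state⁺ : State (2 + n)
    state⁺ = record
      { graph = G⁺
      ; role = role⁺
      ; rk = rk⁺
      ; len = len⁺
      ; frameV = λ x → suc (suc (frameV x))
      ; small-cuts = small-cuts-trivial⁺ small-cuts
      ; no-flow = no-flow⁺ graph sites (λ _ → refl) label-vertex label-D no-flow
      ; kind-inv = kind-inv⁺
      ; rank-inv = rank-inv⁺
      ; low-unique = λ {_} {d} {e} → low-unique⁺ {d = d} {e}
      ; rank≤len = λ {_} {d} → rank≤len⁺ {d = d}
      ; len-even = λ s′ → even s′
      ; 2≤len = λ s′ → ≥2 s′
      ; role-frameV = role-frameV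
      ; frame-unique = unique
      ; frame-inv = λ {x} p → trans (inv⁺-uncut (λ j i q → plain≢D j i (trans (cong kind (sym q)) (trans (cong (λ ρ → kind-at ρ _) (role-frameV x)) p))))
                                    (cong old (frame-inv p)) }
      where
      even : ∀ s′ → odd (len⁺ s′) ≡ false
      even s′ with s′ Fin.≟ s
      ... | yes _ = trans (not-involutive (odd (len s′))) (len-even s′)
      ... | no _ = len-even s′
      ≥2 : ∀ s′ → 2 ≤ len⁺ s′
      ≥2 s′ with s′ Fin.≟ s
      ... | yes _ = s≤s (s≤s z≤n)
      ... | no _ = 2≤len s′
      unique : ∀ {v x} → role⁺ v ≡ frame x → v ≡ suc (suc (frameV x))
      unique {suc (suc v)} p = cong (λ w → suc (suc w)) (frame-unique p)
      plain≢D : ∀ j i {c} → kind (D j i) ≢ plain c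
      plain≢D j 0F p = case trans (sym p) (kind-D≡ j 0F) of λ ()
      plain≢D j 1F p = case trans (sym p) (kind-D≡ j 1F) of λ ()

-- Growth: enough points on every path, and ever longer detours around segments

ball-size : ℕ → ℕ
ball-size zero = 1
ball-size (suc k) = suc (ball-size k + (ball-size k + ball-size k))

module Balls {n} (G : CubicGraph n) where
  open CubicGraph G
  open Walks G using (Walk; Any; []; step)
  open DecMembership (Fin._≟_ {n}) using (_∈?_)

  ball : ℕ → Fin n → List (Fin n)
  ball zero v = v ∷ []
  ball (suc k) v = v ∷ ball k (tgt (v , 0F)) ++ (ball k (tgt (v , 1F)) ++ ball k (tgt (v , 2F)))

  length-ball : ∀ k v → length (ball k v) ≡ ball-size k
  length-ball zero v = refl
  length-ball (suc k) v = cong suc (trans (length-++ (ball k _)) (cong₂ _+_ (length-ball k _)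
    (trans (length-++ (ball k _)) (cong₂ _+_ (length-ball k _) (length-ball k _)))))

  ∈-ball : ∀ {k v w l} → Walk Any v w l → l ≤ k → w ∈ ball k v
  ∈-ball {zero} [] p = here refl
  ∈-ball {suc k} [] p = here refl
  ∈-ball {suc k} (step 0F _ w) (s≤s p) = there (∈-++⁺ˡ (∈-ball w p))
  ∈-ball {suc k} {v} (step 1F _ w) (s≤s p) = there (∈-++⁺ʳ (ball k (tgt (v , 0F))) (∈-++⁺ˡ (∈-ball w p)))
  ∈-ball {suc k} {v} (step 2F _ w) (s≤s p) =
    there (∈-++⁺ʳ (ball k (tgt (v , 0F))) (∈-++⁺ʳ (ball k (tgt (v , 1F))) (∈-ball w p)))

  -- Otherwise the `m` different vertices would occupy different positions in a list of length
  -- `ball-size k`.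
  escape : ∀ k v {m} → ball-size k < m → (f : Fin m → Fin n) → (∀ {i j} → f i ≡ f j → i ≡ j) →
           ∃ λ i → ∀ {l} → l ≤ k → ¬ Walk Any v (f i) l
  escape k v {m} big f inj with Fin.all? (λ i → f i ∈? ball k v)
  ... | no some with Fin.¬∀⟶∃¬ m _ (λ i → f i ∈? ball k v) some
  ...   | i , p = i , λ q w → p (∈-ball w q)
  escape k v {m} big f inj | yes inside
    with Fin.pigeonhole (subst (_< m) (sym (length-ball k v)) big) (λ i → index (inside i))
  ... | i , j , i<j , eq = ⊥-elim (ℕ.<-irrefl (cong toℕ (inj (trans (lookup-index (inside i))
          (trans (cong (lookup (ball k v)) eq) (sym (lookup-index (inside j))))))) i<j)

record Ends (Φ : Frame) : Set where
  open Frame Φ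
  field
    start finish : Fin paths → Dart frames
    kind-start   : ∀ s → kindF (proj₁ (start s)) (proj₂ (start s)) ≡ low s
    kind-finish  : ∀ s → kindF (proj₁ (finish s)) (proj₂ (finish s)) ≡ high s
    distinct     : ∀ s → proj₁ (start s) ≢ proj₁ (finish s)

module Growth (Φ : Frame) (ends : Ends Φ) where
  open Frame Φ
  open States Φ
  open Ends ends

  OnPath : Kind paths blobs → Set
  OnPath k = ∃ λ s → k ≡ low s ⊎ k ≡ high s

  HasPoints : ∀ {n} → State n → Fin paths → ℕ → Set
  HasPoints {n} st s m = Σ (Fin m → Fin n) λ f → (∀ {i j} → f i ≡ f j → i ≡ j) × (∀ i → State.role st (f i) ≡ point s)

  module _ {n} (st : State n) where
    open State st

    frame-low : ∀ {d s x} → kind d ≡ low s → role (proj₁ d) ≡ frame x → rank d ≡ 0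
    frame-low {v , i} p q with role v
    frame-low {v , i} p refl | frame x = cong (rank-frame len) p

    frame-high : ∀ {d s x} → kind d ≡ high s → role (proj₁ d) ≡ frame x → rank d ≡ len s
    frame-high {v , i} p q with role v
    frame-high {v , i} p refl | frame x = cong (rank-frame len) p

    point-low : ∀ {v i s s′} → role v ≡ point s′ → kind (v , i) ≡ low s → rank (v , i) ≡ suc (rk v)
    point-low {v} q p with role v
    point-low {v} {1F} refl p | point _ = refl
    point-low {v} {0F} refl () | point _
    point-low {v} {2F} refl () | point _

    point-high : ∀ {v i s s′} → role v ≡ point s′ → kind (v , i) ≡ high s → rank (v , i) ≡ rk v
    point-high {v} q p with role v
    point-high {v} {0F} refl p | point _ = refl
    point-high {v} {1F} refl () | point _
    point-high {v} {2F} refl () | point _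

    frameV-injective : ∀ {x y} → frameV x ≡ frameV y → x ≡ y
    frameV-injective {x} {y} p with refl ← trans (sym (role-frameV x)) (trans (cong role p) (role-frameV y)) = refl

    kind-frameV : ∀ x i → kind (frameV x , i) ≡ kindF x i
    kind-frameV x i = cong (λ ρ → kind-at ρ i) (role-frameV x)

  -- Joining the first and the last segment serves only to put more points on the path; distances do
  -- not matter yet.
  module Prolong {n} (st : State n) (s : Fin paths) where
    open State st

    first last : Dart n
    first = frameV (proj₁ (start s)) , proj₂ (start s)
    last = frameV (proj₁ (finish s)) , proj₂ (finish s)

    kind-first : kind first ≡ low s
    kind-first = trans (kind-frameV st _ _) (kind-start s)

    kind-last : kind last ≡ high s
    kind-last = trans (kind-frameV st _ _) (kind-finish s)

    rank-first : rank first ≡ 0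
    rank-first = frame-low st kind-first (role-frameV _)

    rank-last : rank last ≡ len s
    rank-last = frame-high st kind-last (role-frameV _)

    kind-inv-first : kind (inv first) ≡ high s
    kind-inv-first = trans (kind-inv first) (cong mate kind-first)

    kind-inv-last : kind (inv last) ≡ low s
    kind-inv-last = trans (kind-inv last) (cong mate kind-last)

    0≢len : 0 ≢ len s
    0≢len p = case subst (2 ≤_) (sym p) (2≤len s) of λ ()

    inv-first≢frame : ∀ x → tgt first ≢ frameV x
    inv-first≢frame x p = 0≢len (trans (sym (trans (rank-inv first) rank-first))
      (frame-high st kind-inv-first (trans (cong role p) (role-frameV x))))

    inv-last≢frame : ∀ x → tgt last ≢ frameV x
    inv-last≢frame x p = 0≢len (trans (sym (frame-low st kind-inv-last (trans (cong role p) (role-frameV x))))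
      (trans (rank-inv last) rank-last))

    -- A common end would be a point with the first segment below it and the last one above it, so
    -- the path would have length 1.
    inv-first≢inv-last : tgt first ≢ tgt last
    inv-first≢inv-last p with role (tgt first) in eq
    ... | frame x = inv-first≢frame x (frame-unique eq)
    ... | point s′ = case subst (2 ≤_) len≡1 (2≤len s) of λ { (s≤s ()) }
      where
      rk≡0 : rk (tgt first) ≡ 0
      rk≡0 = trans (sym (point-high st eq kind-inv-first)) (trans (rank-inv first) rank-first)
      len≡1 : len s ≡ 1
      len≡1 = trans (sym rank-last) (trans (sym (rank-inv last))
        (trans (point-low st (trans (cong role (sym p)) eq) kind-inv-last) (cong suc (trans (cong rk (sym p)) rk≡0))))

    disjoint : ∀ e₁ e₂ → e₁ ≡ first ⊎ e₁ ≡ inv first → e₂ ≡ inv last ⊎ e₂ ≡ inv (inv last) → proj₁ e₁ ≢ proj₁ e₂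
    disjoint _ _ (inj₁ refl) (inj₁ refl) p = inv-last≢frame _ (sym p)
    disjoint _ _ (inj₁ refl) (inj₂ refl) p = distinct s (frameV-injective st (trans p (cong proj₁ (inv-inv last))))
    disjoint _ _ (inj₂ refl) (inj₁ refl) p = inv-first≢inv-last p
    disjoint _ _ (inj₂ refl) (inj₂ refl) p = inv-first≢frame _ (trans p (cong proj₁ (inv-inv last)))

    first<last : rank first < rank (inv last)
    first<last = subst₂ _<_ (sym rank-first) (sym (trans (rank-inv last) rank-last)) (ℕ.≤-trans (s≤s z≤n) (2≤len s))

    open Subdivide st kind-first kind-inv-last first<last disjoint using (state⁺) public

  open Subdivide using (state⁺)

  points⁺ : ∀ {n} {st : State n} {s d₁ d₂} l₁ l₂ r δ {s′ m} →
            HasPoints st s′ m → HasPoints (state⁺ st {s} {d₁} {d₂} l₁ l₂ r δ) s′ m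
  points⁺ l₁ l₂ r δ (f , inj , pt) = (λ i → suc (suc (f i))) , (λ p → inj (Fin.suc-injective (Fin.suc-injective p))) , pt

  Grown : ∀ {n} → State n → Set
  Grown st = ∃ λ n′ → Σ (State n′) λ st′ → ∀ s m → HasPoints st s m → HasPoints st′ s m

  prolong : ∀ {n} (st : State n) s m → Σ (Grown st) λ g → HasPoints (proj₁ (proj₂ g)) s m
  prolong st s zero = (_ , st , λ _ _ h → h) , (λ ()) , (λ { {()} }) , λ ()
  prolong st s (suc m) with prolong st s m
  ... | (n′ , st′ , keep) , f , inj , pt =
    (_ , Prolong.state⁺ st′ s , λ s′ m′ h → points⁺ kind-first kind-inv-last first<last disjoint (keep s′ m′ h)) , g , g-inj , g-pt
    where
    open Prolong st′ s
    g : Fin (suc m) → Fin (2 + n′)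
    g zero = zero
    g (suc i) = suc (suc (f i))
    g-inj : ∀ {i j} → g i ≡ g j → i ≡ j
    g-inj {zero} {zero} _ = refl
    g-inj {suc i} {suc j} p = cong suc (inj (Fin.suc-injective (Fin.suc-injective p)))
    g-pt : ∀ i → State.role (Prolong.state⁺ st′ s) (g i) ≡ point s
    g-pt zero = refl
    g-pt (suc i) = pt i

  prolong-all : ∀ {n} (st : State n) m (ss : List (Fin paths)) →
                Σ (Grown st) λ g → ∀ s → s ∈ ss → HasPoints (proj₁ (proj₂ g)) s m
  prolong-all st m [] = (_ , st , λ _ _ h → h) , λ _ ()
  prolong-all st m (s ∷ ss) with prolong-all st m ss
  ... | (_ , st′ , keep) , has with prolong st′ s m
  ...   | (_ , st″ , keep′) , h = (_ , st″ , λ s′ m′ → keep′ s′ m′ ∘ keep s′ m′) , λ where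
    _ (here refl) → h
    s′ (there p) → keep′ s′ m (has s′ p)

  -- A walk shorter than `R` between any ends of two segments becomes one of length at most `suc R`
  -- between prescribed ends, with at most one more step on either side. This explains the radius.
  Ready : ∀ {n} → ℕ → State n → Set
  Ready R st = ∀ s → HasPoints st s (suc (ball-size (suc R)))

  -- Only segments are concerned: by `circuit-on-path` every circuit contains one.
  FarFrom : ∀ {n} → State n → ℕ → Set
  FarFrom st t = ∀ d → OnPath (State.kind st d) → Walks.Far (State.graph st) d t

  module _ {R t : ℕ} (t<R : t < R) where

    Result : Set
    Result = ∃ λ n → Σ (State n) λ st → Ready R st × FarFrom st (suc t)

    module _ {n} (st : State n) (ready : Ready R st) (far : FarFrom st t) {k} (todo : Fin (suc k) → Dart n)
             (done : ∀ d → OnPath (State.kind st d) → (∃ λ i → todo i ≡ d) ⊎ Walks.Far (State.graph st) d (suc t))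
             (continue : ∀ {n} (st : State n) → Ready R st → FarFrom st t → (todo : Fin k → Dart n) →
                (∀ d → OnPath (State.kind st d) → (∃ λ i → todo i ≡ d) ⊎ Walks.Far (State.graph st) d (suc t)) → Result) where
      open State st

      skip : (∀ {s} → kind (todo zero) ≢ low s) → (∀ {s} → kind (todo zero) ≢ high s) → Result
      skip ¬low ¬high = continue st ready far (todo ∘ suc) λ d p → case done d p of λ where
        (inj₂ q) → inj₂ q
        (inj₁ (suc i , q)) → inj₁ (i , q)
        (inj₁ (zero , refl)) → case p of λ where
          (_ , inj₁ q) → ⊥-elim (¬low q)
          (_ , inj₂ q) → ⊥-elim (¬high q)

      module _ {s : Fin paths} {d₁ d₂ : Dart n} (low₁ : kind d₁ ≡ low s) (low₂ : kind d₂ ≡ low s) (r₁<r₂ : rank d₁ < rank d₂)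
               (δ : ∀ e₁ e₂ → e₁ ≡ d₁ ⊎ e₁ ≡ inv d₁ → e₂ ≡ d₂ ⊎ e₂ ≡ inv d₂ → proj₁ e₁ ≢ proj₁ e₂) where
        open Subdivide st low₁ low₂ r₁<r₂ δ hiding (state⁺)
        open AddEdge graph sites
        open FarAddEdge graph sites

        on-path-D : ∀ j i → OnPath (kind (D j i))
        on-path-D j 0F = s , inj₁ (kind-D≡ j 0F)
        on-path-D j 1F = s , inj₂ (kind-D≡ j 1F)

        chord-off-path : ∀ j → ¬ OnPath (kind⁺ (chordD j))
        chord-off-path j (_ , inj₁ p) = case trans (sym p) (kind-chord j) of λ ()
        chord-off-path j (_ , inj₂ p) = case trans (sym p) (kind-chord j) of λ ()

        subdivide : Distant R → (∃ λ j → ∃ λ i → todo zero ≡ D j i) → Result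
        subdivide distant (j₀ , i₀ , head) = continue (state⁺ st low₁ low₂ r₁<r₂ δ) (λ s′ → points⁺ low₁ low₂ r₁<r₂ δ (ready s′))
          (λ d p → far⁺ d p (view d)) (λ i → old (todo (suc i))) (λ d p → done⁺ d p (view d))
          where
          far⁺ : ∀ d → OnPath (kind⁺ d) → View d → W⁺.Far d t
          far⁺ _ p (old-uncut d un) = far-old distant (ℕ.<⇒≤ t<R) un (far d p)
          far⁺ _ p (old-cut j i) = W⁺.far-≤ {old (D j i)} (ℕ.n≤1+n t) (far-cut distant {j} {i} t<R (far _ (on-path-D j i)))
          far⁺ _ p (at-new j i) = W⁺.far-≤ {new j i} (ℕ.n≤1+n t) (far-new distant {j} {i} t<R (far _ (on-path-D j i)))
          far⁺ _ p (on-chord j) = ⊥-elim (chord-off-path j p)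
          done⁺ : ∀ d → OnPath (kind⁺ d) → View d → (∃ λ i → old (todo (suc i)) ≡ d) ⊎ W⁺.Far d (suc t)
          done⁺ _ p (old-uncut d un) with done d p
          ... | inj₂ q = inj₂ (far-old distant t<R un q)
          ... | inj₁ (suc i , q) = inj₁ (i , cong old q)
          ... | inj₁ (zero , q) = ⊥-elim (un j₀ i₀ (trans (sym q) head))
          done⁺ _ p (old-cut j i) = inj₂ (far-cut distant {j} {i} t<R (far _ (on-path-D j i)))
          done⁺ _ p (at-new j i) = inj₂ (far-new distant {j} {i} t<R (far _ (on-path-D j i)))
          done⁺ _ p (on-chord j) = ⊥-elim (chord-off-path j p)

      open Walks graph using (Walk; Any; []; step; snoc; reverse-any) renaming (to to walk-to)

      -- The partner is the segment above a point of the same path outside the ball around `d`. It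
      -- may be lower or higher on the path, whence the comparison of ranks.
      treat : ∀ {s d} → kind d ≡ low s → todo zero ≡ d ⊎ todo zero ≡ inv d → Result
      treat {s} {d} kd head with ready s
      ... | f , inj , pt with Balls.escape graph (suc R) (proj₁ d) ℕ.≤-refl f inj
      ...   | i , away = go (ℕ.<-cmp (rank d) (rank e))
        where
        p : Fin n
        p = f i
        e : Dart n
        e = p , 1F
        ke : kind e ≡ low s
        ke = cong (λ ρ → kind-at ρ 1F) (pt i)
        distance : ∀ {e₁ e₂ l} → e₁ ≡ d ⊎ e₁ ≡ inv d → e₂ ≡ e ⊎ e₂ ≡ inv e → Walk Any (proj₁ e₁) (proj₁ e₂) l → R ≤ l
        distance {e₁} {e₂} {l} p₁ p₂ w with R ℕ.≤? l
        ... | yes q = q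
        ... | no q = ⊥-elim (close p₁ p₂ w)
          where
          l<R : suc l ≤ R
          l<R = ℕ.≰⇒> q
          back : tgt (inv e) ≡ p
          back = cong proj₁ (inv-inv e)
          close : e₁ ≡ d ⊎ e₁ ≡ inv d → e₂ ≡ e ⊎ e₂ ≡ inv e → ¬ Walk Any (proj₁ e₁) (proj₁ e₂) l
          close (inj₁ refl) (inj₁ refl) w = away (ℕ.≤-trans (ℕ.n≤1+n l) (ℕ.m≤n⇒m≤1+n l<R)) w
          close (inj₂ refl) (inj₁ refl) w = away (ℕ.m≤n⇒m≤1+n l<R) (step (proj₂ d) tt w)
          close (inj₁ refl) (inj₂ refl) w = away (ℕ.m≤n⇒m≤1+n l<R) (walk-to back (snoc (proj₂ (inv e)) w tt))
          close (inj₂ refl) (inj₂ refl) w = away (s≤s l<R) (walk-to back (snoc (proj₂ (inv e)) (step (proj₂ d) tt w) tt))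
        apart : ∀ e₁ e₂ → e₁ ≡ d ⊎ e₁ ≡ inv d → e₂ ≡ e ⊎ e₂ ≡ inv e → proj₁ e₁ ≢ proj₁ e₂
        apart e₁ e₂ p₁ p₂ q = ℕ.<⇒≱ t<R (ℕ.≤-trans (distance p₁ p₂ (walk-to q [])) z≤n)
        go : _ → Result
        go (tri≈ _ eq _) = ⊥-elim (apart d e (inj₁ refl) (inj₁ refl) (cong proj₁ (low-unique kd ke eq)))
        go (tri< lt _ _) = subdivide kd ke lt apart distant (case head of λ { (inj₁ q) → 0F , 0F , q ; (inj₂ q) → 0F , 1F , q })
          where
          open Subdivide st kd ke lt apart using (D; sites)
          is : ∀ j i → D j i ≡ D j 0F ⊎ D j i ≡ inv (D j 0F)
          is j 0F = inj₁ refl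
          is j 1F = inj₂ refl
          distant : FarAddEdge.Distant graph sites R
          distant 0F i i′ w = distance (is 0F i) (is 1F i′) w
          distant 1F i i′ w = distance (is 0F i′) (is 1F i) (reverse-any w)
        go (tri> _ _ gt) = subdivide ke kd gt apart′ distant (case head of λ { (inj₁ q) → 1F , 0F , q ; (inj₂ q) → 1F , 1F , q })
          where
          apart′ : ∀ e₁ e₂ → e₁ ≡ e ⊎ e₁ ≡ inv e → e₂ ≡ d ⊎ e₂ ≡ inv d → proj₁ e₁ ≢ proj₁ e₂
          apart′ e₁ e₂ p₁ p₂ q = apart e₂ e₁ p₂ p₁ (sym q)
          open Subdivide st ke kd gt apart′ using (D; sites)
          is : ∀ j i → D j i ≡ D j 0F ⊎ D j i ≡ inv (D j 0F)
          is j 0F = inj₁ refl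
          is j 1F = inj₂ refl
          distant : FarAddEdge.Distant graph sites R
          distant 1F i i′ w = distance (is 1F i) (is 0F i′) w
          distant 0F i i′ w = distance (is 1F i′) (is 0F i) (reverse-any w)

      next : Result
      next with kind (todo zero) in eq
      ... | plain _ = skip (λ p → case trans (sym eq) p of λ ()) (λ p → case trans (sym eq) p of λ ())
      ... | chord _ = skip (λ p → case trans (sym eq) p of λ ()) (λ p → case trans (sym eq) p of λ ())
      ... | low s = treat eq (inj₁ refl)
      ... | high s = treat (trans (kind-inv (todo zero)) (cong mate eq)) (inj₂ (sym (inv-inv (todo zero))))

    process : ∀ k {n} (st : State n) → Ready R st → FarFrom st t → (todo : Fin k → Dart n) →
              (∀ d → OnPath (State.kind st d) → (∃ λ i → todo i ≡ d) ⊎ Walks.Far (State.graph st) d (suc t)) → Result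
    process zero st ready far todo done = _ , st , ready , λ d p → case done d p of λ { (inj₂ q) → q }
    process (suc k) st ready far todo done = next st ready far todo done (process k)

  -- With `R` fixed, the points provided for `t = 0` last for all rounds, because later subdivisions
  -- keep every point on its path.
  enlarge : ∀ {n} → State n → ∀ R t → t ≤ R → ∃ λ n′ → Σ (State n′) λ st → Ready R st × FarFrom st t
  enlarge st R zero _ with prolong-all st (suc (ball-size (suc R))) (allFin paths)
  ... | (_ , st′ , _) , has = _ , st′ , (λ s → has s (∈-allFin s)) , λ _ _ _ _ → z≤n
  enlarge st R (suc t) t<R with enlarge st R t (ℕ.<⇒≤ t<R)
  ... | n , st′ , ready , far = process t<R (length (darts n)) st′ ready far (lookup (darts n))
          λ d _ → inj₁ (index (∈-darts d) , sym (lookup-index (∈-darts d)))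

-- Counting, and reachability in multigraphs

indicator : ∀ {P : Set} → Dec P → ℕ
indicator (yes _) = 1
indicator (no _) = 0

count : {A : Set} → (A → ℕ) → List A → ℕ
count f xs = foldr _+_ 0 (map f xs)

length-filter : ∀ {A : Set} {P : A → Set} (P? : Decidable P) xs → length (filter P? xs) ≡ count (indicator ∘ P?) xs
length-filter P? [] = refl
length-filter P? (x ∷ xs) with P? x
... | yes _ = cong suc (length-filter P? xs)
... | no _ = length-filter P? xs

count-filter : ∀ {A : Set} {P : A → Set} (P? : Decidable P) (f g : A → ℕ) →
               (∀ x → P x → f x ≡ g x) → (∀ x → ¬ P x → g x ≡ 0) → ∀ xs → count f (filter P? xs) ≡ count g xs
count-filter P? f g yes-eq no-eq [] = refl
count-filter P? f g yes-eq no-eq (x ∷ xs) with P? x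
... | yes p = cong₂ _+_ (yes-eq x p) (count-filter P? f g yes-eq no-eq xs)
... | no p = trans (count-filter P? f g yes-eq no-eq xs) (cong (_+ count g xs) (sym (no-eq x p)))

lookup-injective : ∀ {A : Set} {xs : List A} → Unique xs → ∀ {i j} → lookup xs i ≡ lookup xs j → i ≡ j
lookup-injective (_ ∷ _) {zero} {zero} _ = refl
lookup-injective (x ∷ _) {zero} {suc j} p = ⊥-elim (All.lookup x (∈-lookup j) p)
lookup-injective (x ∷ _) {suc i} {zero} p = ⊥-elim (All.lookup x (∈-lookup i) (sym p))
lookup-injective (_ ∷ u) {suc i} {suc j} p = cong suc (lookup-injective u p)

count-vertex : ∀ {n} (v : Fin n) → count (λ d → indicator (proj₁ d Fin.≟ v)) (darts n) ≡ 3
count-vertex {suc n} zero = cong (3 +_) (trans (cong (foldr _+_ 0) (sym (map-∘ (darts n)))) (zeros (darts n)))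
  where
  zeros : ∀ ds → count (λ d → indicator (suc (proj₁ d) Fin.≟ Fin.zero {n})) ds ≡ 0
  zeros [] = refl
  zeros (d ∷ ds) = zeros ds
count-vertex {suc n} (suc v) = trans (cong (foldr _+_ 0) (sym (map-∘ (darts n))))
  (trans (cong (foldr _+_ 0) (map-cong same (darts n))) (count-vertex v))
  where
  same : ∀ d → indicator (suc (proj₁ d) Fin.≟ suc v) ≡ indicator (proj₁ d Fin.≟ v)
  same d with proj₁ d Fin.≟ v
  ... | yes _ = refl
  ... | no _ = refl

module Closure (Γ : Graph) {K : Edge Γ → Set} (K? : Decidable K) where
  open Graph Γ

  joins? : ∀ e a b → Dec (Joins Γ e a b)
  joins? e a b = ((src e Fin.≟ a) ×-dec (tgt e Fin.≟ b)) ⊎-dec ((src e Fin.≟ b) ×-dec (tgt e Fin.≟ a))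

  reach-snoc : ∀ {a b c} → Reach Γ K a b → ∀ e → K e → Joins Γ e b c → Reach Γ K a c
  reach-snoc here e k j = step e k j here
  reach-snoc (step e′ k′ j′ r) e k j = step e′ k′ j′ (reach-snoc r e k j)

  Closed : Subset n → Set
  Closed p = ∀ e v w → v ∈ₛ p → K e → Joins Γ e v w → w ∈ₛ p

  -- This makes the component of `a` a vertex set that no kept edge leaves, to which conditions on
  -- cuts apply. The growth stops because subsets of a finite set cannot increase forever.
  reachable : ∀ a → Σ (Subset n) λ p → a ∈ₛ p × (∀ v → v ∈ₛ p → Reach Γ K a v) × Closed p
  reachable a = grow ⁅ a ⁆ (⊃-wellFounded _) (x∈⁅x⁆ a) λ _ q → subst (Reach Γ K a) (sym (x∈⁅y⁆⇒x≡y a q)) here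
    where
    grow : ∀ p → Acc _ p → a ∈ₛ p → (∀ v → v ∈ₛ p → Reach Γ K a v) →
           Σ (Subset n) λ p → a ∈ₛ p × (∀ v → v ∈ₛ p → Reach Γ K a v) × Closed p
    grow p (acc rec) a∈p r
      with Fin.any? (λ e → Fin.any? (λ v → Fin.any? (λ w → (v ∈ₛ? p) ×-dec (K? e ×-dec (joins? e v w ×-dec ¬? (w ∈ₛ? p))))))
    ... | no none = p , a∈p , r , λ e v w q k j →
            decidable-stable (w ∈ₛ? p) (λ out → none (e , v , w , q , k , j , out))
    ... | yes (e , v , w , q , k , j , out) =
            grow (p ∪ ⁅ w ⁆) (rec ((λ {x} → p⊆p∪q {p = p} ⁅ w ⁆ {x}) , w , q⊆p∪q p ⁅ w ⁆ (x∈⁅x⁆ w) , out)) (p⊆p∪q ⁅ w ⁆ a∈p) λ x m → case x∈p∪q⁻ p ⁅ w ⁆ m of λ where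
              (inj₁ m′) → r x m′
              (inj₂ m′) → subst (Reach Γ K a) (sym (x∈⁅y⁆⇒x≡y w m′)) (reach-snoc (r v q) e k j)

-- The given element fills the spare places when `S` has fewer than `k` members.
enumerate : ∀ {m} k (S : Subset m) → ∣ S ∣ ≤ k → Fin m → Σ (Fin k → Fin m) λ f → ∀ e → e ∈ₛ S → ∃ λ i → e ≡ f i
enumerate k S le z with nonempty? S
... | no empty = (λ _ → z) , λ _ p → ⊥-elim (empty (_ , p))
enumerate zero S le z | yes (x , p) = ⊥-elim (ℕ.<⇒≱ (ℕ.≤-<-trans z≤n (x∈p⇒∣p-x∣<∣p∣ p)) le)
enumerate (suc k) S le z | yes (x , p) with enumerate k (S - x) (ℕ.≤-pred (ℕ.≤-trans (x∈p⇒∣p-x∣<∣p∣ p) le)) z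
... | f , all = (λ { zero → x ; (suc i) → f i }) , λ e q → case e Fin.≟ x of λ where
  (yes r) → zero , r
  (no r) → case all e (x∈p∧x≢y⇒x∈p-y q r) of λ (i , s) → suc i , s

reach-sym : ∀ {Γ K a b} → Reach Γ K a b → Reach Γ K b a
reach-sym {Γ} {K} {a} r = go r here
  where
  go : ∀ {x b} → Reach Γ K x b → Reach Γ K x a → Reach Γ K b a
  go here back = back
  go (step e k j r) back = go r (step e k (Sum.swap j) back)

-- From darts to multigraphs

module Conversion {n} (G : CubicGraph n) where
  open CubicGraph G renaming (tgt to target)

  forward? : (d : Dart n) → Dec (proj₁ d Fin.< target d)
  forward? d = proj₁ d Fin.<? target d

  -- Without loops exactly one of the two darts of an edge goes to a larger vertex.
  edges : List (Dart n)
  edges = filter forward? (darts n)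

  dart : Fin (length edges) → Dart n
  dart = lookup edges

  graph : Graph
  graph = record { n = n ; m = length edges ; src = proj₁ ∘ dart ; tgt = target ∘ dart }

  dart-forward : ∀ e → proj₁ (dart e) Fin.< target (dart e)
  dart-forward e = proj₂ (∈-filter⁻ forward? {xs = darts n} (∈-lookup e))

  dart-injective : ∀ {e f} → dart e ≡ dart f → e ≡ f
  dart-injective = lookup-injective (Unique.filter⁺ forward? (darts-unique n))

  forward-asym : ∀ {d} → proj₁ d Fin.< target d → ¬ (proj₁ (inv d) Fin.< target (inv d))
  forward-asym {d} p q = ℕ.<-asym p (subst (λ x → target d Fin.< proj₁ x) (inv-inv d) q)

  inv-forward : ∀ d → ¬ (proj₁ d Fin.< target d) → target d Fin.< target (inv d)
  inv-forward d p with Fin.<-cmp (proj₁ d) (target d)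
  ... | tri< a _ _ = ⊥-elim (p a)
  ... | tri≈ _ b _ = ⊥-elim (loopless d (sym b))
  ... | tri> _ _ c = subst (λ x → target d Fin.< proj₁ x) (sym (inv-inv d)) c

  edge-of : ∀ d → ∃ λ e → dart e ≡ d ⊎ dart e ≡ inv d
  edge-of d with forward? d
  ... | yes p = index m , inj₁ (sym (lookup-index m))
    where m = ∈-filter⁺ forward? (∈-darts d) p
  ... | no p = index m , inj₂ (sym (lookup-index m))
    where m = ∈-filter⁺ forward? (∈-darts (inv d)) (inv-forward d p)

  edge : Dart n → Fin (length edges)
  edge = proj₁ ∘ edge-of

  edge-unique : ∀ {e d} → dart e ≡ d ⊎ dart e ≡ inv d → e ≡ edge d
  edge-unique {e} {d} p with edge-of d
  edge-unique {e} (inj₁ refl) | f , inj₁ q = dart-injective (sym q)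
  edge-unique {e} (inj₂ p) | f , inj₂ q = dart-injective (trans p (sym q))
  edge-unique {e} (inj₁ refl) | f , inj₂ q = ⊥-elim (forward-asym (dart-forward e) (subst (λ x → proj₁ x Fin.< target x) q (dart-forward f)))
  edge-unique {e} (inj₂ p) | f , inj₁ refl = ⊥-elim (forward-asym (dart-forward f) (subst (λ x → proj₁ x Fin.< target x) p (dart-forward e)))

  edge-inv : ∀ d → edge (inv d) ≡ edge d
  edge-inv d = edge-unique (case proj₂ (edge-of (inv d)) of λ where
    (inj₁ p) → inj₂ p
    (inj₂ p) → inj₁ (trans p (inv-inv d)))

  same-edge : ∀ {d d′} → edge d ≡ edge d′ → d ≡ d′ ⊎ d ≡ inv d′
  same-edge {d} {d′} p with edge-of d | edge-of d′
  ... | e , inj₁ q | _ , inj₁ r = inj₁ (trans (sym q) (trans (cong dart p) r))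
  ... | e , inj₁ q | _ , inj₂ r = inj₂ (trans (sym q) (trans (cong dart p) r))
  ... | e , inj₂ q | _ , inj₁ r = inj₂ (inv-injective (trans (sym q) (trans (cong dart p) (trans r (sym (inv-inv d′))))))
  ... | e , inj₂ q | _ , inj₂ r = inj₁ (inv-injective (trans (sym q) (trans (cong dart p) r)))

  edge-distinct : ∀ v {i j} → i ≢ j → edge (v , i) ≢ edge (v , j)
  edge-distinct v {i} {j} p q with same-edge q
  ... | inj₁ refl = p refl
  ... | inj₂ r = loopless (v , j) (sym (cong proj₁ r))

  record Arc (e : Fin (length edges)) (a b : Fin n) : Set where
    constructor arc
    field
      i      : Fin 3
      head   : target (a , i) ≡ b
      edge≡ : e ≡ edge (a , i)

  orient : ∀ {e a b} → Joins graph e a b → Arc e a b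
  orient {e} (inj₁ (refl , q)) = arc (proj₂ (dart e)) q (edge-unique (inj₁ refl))
  orient {e} (inj₂ (q , refl)) = arc (proj₂ (inv (dart e))) (trans (cong proj₁ (inv-inv (dart e))) q)
    (edge-unique (inj₂ (sym (inv-inv (dart e)))))

  incident : ∀ {e v} → IncidentTo graph e v → ∃ λ i → e ≡ edge (v , i)
  incident {e} (inj₁ refl) = _ , edge-unique (inj₁ refl)
  incident {e} (inj₂ refl) = _ , edge-unique (inj₂ (sym (inv-inv (dart e))))

  joins : ∀ d → Joins graph (edge d) (proj₁ d) (target d)
  joins d with edge-of d
  ... | e , inj₁ p = inj₁ (cong proj₁ p , cong target p)
  ... | e , inj₂ p = inj₂ (cong proj₁ p , trans (cong target p) (cong proj₁ (inv-inv d)))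

  no-loop : ∀ {e a} → ¬ Joins graph e a a
  no-loop j with orient j
  ... | arc i p _ = loopless _ p

  -- Every dart is counted once: forward darts as sources, the others as targets of their inverses.
  cubic : Cubic graph
  cubic v = begin
    length (filter (λ e → proj₁ (dart e) Fin.≟ v) (allFin _)) + length (filter (λ e → target (dart e) Fin.≟ v) (allFin _))
      ≡⟨ cong₂ _+_ (over-edges (λ d → proj₁ d Fin.≟ v)) (over-edges (λ d → target d Fin.≟ v)) ⟩
    count (λ d → indicator (proj₁ d Fin.≟ v)) edges + count (λ d → indicator (target d Fin.≟ v)) edges
      ≡⟨ cong₂ _+_ (count-filter forward? _ out out-yes out-no (darts n)) (count-filter forward? _ into into-yes into-no (darts n)) ⟩
    count out (darts n) + count into (darts n)
      ≡⟨ cong (count out (darts n) +_) (sym (sum-inv G ℕ.+-0-isCommutativeMonoid into)) ⟩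
    count out (darts n) + count (into ∘ inv) (darts n)
      ≡⟨ sym (sum-∙ G ℕ.+-0-isCommutativeMonoid out (into ∘ inv) (darts n)) ⟩
    count (λ d → out d + into (inv d)) (darts n)
      ≡⟨ cong (foldr _+_ 0) (map-cong once (darts n)) ⟩
    count (λ d → indicator (proj₁ d Fin.≟ v)) (darts n)
      ≡⟨ count-vertex v ⟩
    3 ∎
    where
    open ≡-Reasoning
    over-edges : ∀ {P : Dart n → Set} (P? : Decidable P) →
                 length (filter (P? ∘ dart) (allFin (length edges))) ≡ count (indicator ∘ P?) edges
    over-edges P? = trans (length-filter (P? ∘ dart) (allFin _)) (cong (foldr _+_ 0)
      (trans (map-∘ (allFin _)) (cong (map (indicator ∘ P?)) (trans (map-tabulate id dart) (tabulate-lookup edges)))))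
    when : ∀ {P : Set} → Dec P → ℕ → ℕ
    when (yes _) k = k
    when (no _) k = 0
    when-yes : ∀ {P : Set} (P? : Dec P) {k} → P → k ≡ when P? k
    when-yes (yes _) p = refl
    when-yes (no q) p = ⊥-elim (q p)
    when-no : ∀ {P : Set} (P? : Dec P) {k} → ¬ P → when P? k ≡ 0
    when-no (yes p) q = ⊥-elim (q p)
    when-no (no _) q = refl
    out into : Dart n → ℕ
    out d = when (forward? d) (indicator (proj₁ d Fin.≟ v))
    into d = when (forward? d) (indicator (target d Fin.≟ v))
    out-yes : ∀ d → proj₁ d Fin.< target d → indicator (proj₁ d Fin.≟ v) ≡ out d
    out-yes d p = when-yes (forward? d) p
    out-no : ∀ d → ¬ (proj₁ d Fin.< target d) → out d ≡ 0
    out-no d p = when-no (forward? d) p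
    into-yes : ∀ d → proj₁ d Fin.< target d → indicator (target d Fin.≟ v) ≡ into d
    into-yes d p = when-yes (forward? d) p
    into-no : ∀ d → ¬ (proj₁ d Fin.< target d) → into d ≡ 0
    into-no d p = when-no (forward? d) p
    once : ∀ d → out d + into (inv d) ≡ indicator (proj₁ d Fin.≟ v)
    once d with forward? d | forward? (inv d)
    ... | yes p | yes q = ⊥-elim (forward-asym p q)
    ... | yes p | no q = ℕ.+-identityʳ _
    ... | no p | yes q = cong (λ x → indicator (proj₁ x Fin.≟ v)) (inv-inv d)
    ... | no p | no q = ⊥-elim (q (inv-forward d p))

  module Circuits {K len} (C : Circuit graph K len) where
    open Circuit C

    prev : Fin (suc k) → Fin (suc k)
    prev zero = fromℕ k
    prev (suc i) = inject₁ i

    joins-prev : ∀ i → Joins graph (es (prev i)) (vs (prev i)) (vs i)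
    joins-prev zero = close
    joins-prev (suc i) = path i

    joins-next : ∀ i → ∃ λ j → Joins graph (es i) (vs i) (vs j)
    joins-next i with top i
    ... | ‵fromℕ = zero , close
    ... | ‵inject₁ j = suc j , path j

    prev≢ : ∀ i → prev i ≢ i
    prev≢ i p = no-loop (subst (λ j → Joins graph (es j) (vs j) (vs i)) p (joins-prev i))

    open Walks G

    module _ (i₀ : Fin (suc k)) (d : Dart n) (d-edge : es i₀ ≡ edge d) where

      avoids : ∀ {j d′} → j ≢ i₀ → es j ≡ edge d′ → Avoiding d d′
      avoids p q =
        (λ r → p (es-inj (trans q (trans (cong edge r) (sym d-edge))))) ,
        (λ r → p (es-inj (trans q (trans (cong edge r) (trans (edge-inv d) (sym d-edge))))))

      before : ∀ i → toℕ i ≤ toℕ i₀ → Walk (Avoiding d) (vs zero) (vs i) (toℕ i)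
      before = <-weakInduction _ (λ _ → []) λ i rec le → case orient (path i) of λ where
        (arc l h e) → to h (snoc l (subst (Walk _ _ _) (Fin.toℕ-inject₁ i)
                        (rec (subst (_≤ toℕ i₀) (sym (Fin.toℕ-inject₁ i)) (ℕ.<⇒≤ le))))
                        (avoids (λ q → ℕ.<-irrefl (trans (sym (Fin.toℕ-inject₁ i)) (cong toℕ q)) le) e))

      after : ∀ i → toℕ i₀ < toℕ i → ∃ λ l → l + toℕ i ≡ k × Walk (Avoiding d) (vs i) (vs (fromℕ k)) l
      after = >-weakInduction _ (λ _ → 0 , Fin.toℕ-fromℕ k , []) λ i rec lt → case orient (path i) of λ where
        (arc l h e) → case rec (ℕ.<-trans lt (ℕ.≤-reflexive (cong suc (Fin.toℕ-inject₁ i)))) of λ where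
          (m , p , w) → suc m , trans (cong (suc m +_) (Fin.toℕ-inject₁ i)) (trans (sym (ℕ.+-suc m (toℕ i))) p) ,
                        step l (avoids (λ q → ℕ.<-irrefl (sym (cong toℕ q)) lt) e) (from (sym h) w)

    -- The other `k` edges of the circuit lead from the far end of the chosen edge back to its near
    -- end. Unless the chosen edge is the closing one, this walk passes over the closing edge.
    around : ∀ i₀ → ∃ λ i → (∃ λ j → target (vs i₀ , i) ≡ vs j × es i₀ ≡ edge (vs i₀ , i) × Walk (Avoiding (vs i₀ , i)) (vs j) (vs i₀) k)
    around i₀ with top i₀
    ... | ‵fromℕ with orient close
    ...   | arc i h e = i , zero , h , e ,
              subst (Walk _ _ _) (Fin.toℕ-fromℕ k) (before (fromℕ k) _ e (fromℕ k) ℕ.≤-refl)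
    around .(inject₁ j) | ‵inject₁ j with orient (path j) | orient close
    ...   | arc i h e | arc i′ h′ e′ with after (inject₁ j) (vs (inject₁ j) , i) e (suc j) (s≤s (ℕ.≤-reflexive (Fin.toℕ-inject₁ j)))
    ...     | l , p , w = i , suc j , h , e , subst (Walk _ _ _) total-length
                (w ++ʷ step i′ (avoids (inject₁ j) _ e Fin.fromℕ≢inject₁ e′) (from (sym h′) (before (inject₁ j) _ e (inject₁ j) ℕ.≤-refl)))
      where
      total-length : l + suc (toℕ (inject₁ j)) ≡ k
      total-length = trans (cong (λ x → l + suc x) (Fin.toℕ-inject₁ j)) p

  circuit-bound : ∀ {K len t} (C : Circuit graph K len) i → (∀ d → Circuit.es C i ≡ edge d → Walks.Far G d t) → suc t ≤ len
  circuit-bound C i₀ far with Circuits.around C i₀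
  ... | i , j , h , e , w = subst (suc _ ≤_) (sym (Circuit.len≡ C)) (s≤s (far _ e _ (Walks.from G (sym h) w)))

  module Connectivity (sct : SmallCutsTrivial G) where
    open Cuts G sct

    inside : Subset n → Fin n → Bool
    inside p v = does (v ∈ₛ? p)

    inside-true : ∀ {p v} → v ∈ₛ p → inside p v ≡ true
    inside-true {p} {v} q with v ∈ₛ? p
    ... | yes _ = refl
    ... | no r = ⊥-elim (r q)

    true-inside : ∀ {p v} → inside p v ≡ true → v ∈ₛ p
    true-inside {p} {v} q with v ∈ₛ? p
    ... | yes r = r

    inside-false : ∀ {p v} → ¬ v ∈ₛ p → inside p v ≡ false
    inside-false {p} {v} q with v ∈ₛ? p
    ... | yes r = ⊥-elim (q r)
    ... | no _ = refl

    false-inside : ∀ {p v} → inside p v ≡ false → ¬ v ∈ₛ p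
    false-inside {p} {v} q r with v ∈ₛ? p
    ... | no s = s r

    connected : Connected graph
    connected a b with Closure.reachable graph {AllEdges graph} (λ _ → yes tt) a
    ... | p , a∈p , r , closed with no-2-cuts (inside p) (a , 0F) (a , 0F)
              (λ d x y → ⊥-elim (false-inside {p} y (closed _ _ _ (true-inside {p} x) tt (joins d))))
    ...   | inj₁ none = ⊥-elim (false-inside {p} (none a) a∈p)
    ...   | inj₂ all = r _ (true-inside {p} (all b))

    incident? : ∀ e w → Dec (IncidentTo graph e w)
    incident? e w = (_ Fin.≟ w) ⊎-dec (_ Fin.≟ w)

    Avoids : Fin n → Fin (length edges) → Set
    Avoids w e = ¬ IncidentTo graph e w

    joins-incident : ∀ {e a b} → Joins graph e a b → IncidentTo graph e b
    joins-incident (inj₁ (_ , q)) = inj₂ q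
    joins-incident (inj₂ (q , _)) = inj₁ q

    reach-avoids : ∀ {w a b} → a ≢ w → Reach graph (Avoids w) a b → b ≢ w
    reach-avoids p here = p
    reach-avoids p (step e k j r) = reach-avoids (λ { refl → k (joins-incident j) }) r

    at : ∀ {w} d → target d ≡ w → OneOf d (inv (w , 0F)) (inv (w , 1F)) (inv (w , 2F))
    at d refl with inv d in eq
    ... | w , 0F = inj₁ (trans (sym (inv-inv d)) (cong inv eq))
    ... | w , 1F = inj₂ (inj₁ (trans (sym (inv-inv d)) (cong inv eq)))
    ... | w , 2F = inj₂ (inj₂ (trans (sym (inv-inv d)) (cong inv eq)))

    -- Darts leaving the component of `a` end at `w`, so there are at most three. If `b` is not
    -- reached, both `b` and `w` lie outside, and the trivial side must be `a` alone.
    reach-or-star : ∀ w a b → a ≢ w → b ≢ w → Reach graph (Avoids w) a b ⊎ (∀ i → target (a , i) ≡ w)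
    reach-or-star w a b a≢w b≢w with Closure.reachable graph {Avoids w} (λ e → ¬? (incident? e w)) a
    ... | p , a∈p , r , closed with b ∈ₛ? p
    ...   | yes b∈p = inj₁ (r _ b∈p)
    ...   | no b∉p with sct (inside p) _ _ _ (λ d x y → at d (leaves d x y))
      where
      leaves : ∀ d → inside p (proj₁ d) ≡ true → inside p (target d) ≡ false → target d ≡ w
      leaves d x y with incident? (edge d) w
      ... | no out = ⊥-elim (false-inside {p} y (closed _ _ _ (true-inside {p} x) out (joins d)))
      ... | yes inc with incident {edge d} inc
      ...   | i , q with same-edge {d} q
      ...     | inj₁ refl = ⊥-elim (reach-avoids a≢w (r _ (true-inside {p} x)) refl)
      ...     | inj₂ s = cong proj₁ (trans (cong inv s) (inv-inv (w , i)))
    ...     | inj₂ one = ⊥-elim (b≢w (one b w (cong not (inside-false b∉p)) (cong not (inside-false λ w∈p → reach-avoids a≢w (r _ w∈p) refl))))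
    ...     | inj₁ one = inj₂ λ i → target-w i
      where
      target-w : ∀ i → target (a , i) ≡ w
      target-w i with incident? (edge (a , i)) w
      ... | no out = ⊥-elim (loopless (a , i) (one _ _ (inside-true (closed _ _ _ a∈p out (joins (a , i)))) (inside-true a∈p)))
      ... | yes inc with incident {edge (a , i)} inc
      ...   | j , q with same-edge {a , i} q
      ...     | inj₁ refl = ⊥-elim (a≢w refl)
      ...     | inj₂ s = cong proj₁ (trans (cong inv s) (inv-inv (w , j)))

    connected-without : ∀ w → ConnectedWithout graph w
    connected-without w a b a≢w b≢w with a Fin.≟ b
    ... | yes refl = here
    ... | no a≢b with reach-or-star w a b a≢w b≢w | reach-or-star w b a b≢w a≢w
    ...   | inj₁ r | _ = r
    ...   | inj₂ _ | inj₁ r = reach-sym r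
    -- All edges at `a` and at `b` would end at `w`, which has only three darts.
    ...   | inj₂ p | inj₂ q = ⊥-elim (4-in-3 {x = a , 0F} {a , 1F} {a , 2F} {b , 0F} (λ ()) (λ ()) ne (λ ()) ne ne
              (at _ (p 0F)) (at _ (p 1F)) (at _ (p 2F)) (at _ (q 0F)))
      where
      ne : ∀ {i j} → (a , i) ≢ (b , j)
      ne r = a≢b (cong proj₁ r)

    -- The component of a vertex of `C₁` is bounded by at most three edges. Neither side can be a
    -- single vertex, since each contains both ends of an edge of one of the circuits.
    cyclically-4-connected : CyclicallyEdgeConnected graph 4
    cyclically-4-connected S (s≤s small) (_ , _ , C₁ , C₂ , apart)
      with Closure.reachable graph {_∉ₛ S} (λ e → ¬? (e ∈ₛ? S)) (Circuit.vs C₁ zero) | enumerate 3 S small (Circuit.es C₁ zero)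
    ... | p , v∈p , r , closed | f , all with sct (inside p) _ _ _ crossing
      where
      oriented : Fin (length edges) → Dart n
      oriented e with inside p (proj₁ (dart e))
      ... | true = dart e
      ... | false = inv (dart e)
      oriented-edge : ∀ d → inside p (proj₁ d) ≡ true → inside p (target d) ≡ false → d ≡ oriented (edge d)
      oriented-edge d x y with edge-of d
      ... | e , q with inside p (proj₁ (dart e)) in eq
      oriented-edge d x y | e , inj₁ q | true = sym q
      oriented-edge d x y | e , inj₁ q | false = ⊥-elim (true≢false x (trans (cong (inside p ∘ proj₁) (sym q)) eq))
      oriented-edge d x y | e , inj₂ q | true = ⊥-elim (true≢false eq (trans (cong (inside p ∘ proj₁) q) y))
      oriented-edge d x y | e , inj₂ q | false = trans (sym (inv-inv d)) (cong inv (sym q))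
      crossing : CutWithin G (inside p) (oriented (f 0F)) (oriented (f 1F)) (oriented (f 2F))
      crossing d x y with edge d ∈ₛ? S
      ... | no out = ⊥-elim (false-inside {p} y (closed _ _ _ (true-inside {p} x) out (joins d)))
      ... | yes e∈S with all _ e∈S
      ...   | 0F , q = inj₁ (trans (oriented-edge d x y) (cong oriented q))
      ...   | 1F , q = inj₂ (inj₁ (trans (oriented-edge d x y) (cong oriented q)))
      ...   | 2F , q = inj₂ (inj₂ (trans (oriented-edge d x y) (cong oriented q)))
    ...   | inj₁ one with Circuits.joins-next C₁ zero
    ...     | j , q = no-loop (subst (Joins graph _ _) (sym (one _ _ (inside-true v∈p) (inside-true (closed _ _ _ v∈p (Circuit.kept C₁ zero) q)))) q)
    cyclically-4-connected S (s≤s small) (_ , _ , C₁ , C₂ , apart) | p , v∈p , r , closed | f , all | inj₂ one with Circuits.joins-next C₂ zero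
    ...     | j , q = no-loop (subst (Joins graph _ _) (sym (one _ _ (outside out) (outside λ m → out (closed _ _ _ m (Circuit.kept C₂ zero) (Sum.swap q))))) q)
      where
      out : ¬ Circuit.vs C₂ zero ∈ₛ p
      out m = apart (r _ m)
      outside : ∀ {v} → ¬ v ∈ₛ p → not (inside p v) ≡ true
      outside m = cong not (inside-false m)

  colour : Fin 3 → V₄
  colour 0F = true , false
  colour 1F = false , true
  colour 2F = true , true

  colour≢O : ∀ c → colour c ≢ O
  colour≢O 0F ()
  colour≢O 1F ()
  colour≢O 2F ()

  colours-sum : ∀ a b c → a ≢ b → b ≢ c → a ≢ c → colour a ⊕ colour b ⊕ colour c ≡ O
  colours-sum 0F 0F _ p _ _ = ⊥-elim (p refl)
  colours-sum 1F 1F _ p _ _ = ⊥-elim (p refl)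
  colours-sum 2F 2F _ p _ _ = ⊥-elim (p refl)
  colours-sum _ 0F 0F _ p _ = ⊥-elim (p refl)
  colours-sum _ 1F 1F _ p _ = ⊥-elim (p refl)
  colours-sum _ 2F 2F _ p _ = ⊥-elim (p refl)
  colours-sum 0F _ 0F _ _ p = ⊥-elim (p refl)
  colours-sum 1F _ 1F _ _ p = ⊥-elim (p refl)
  colours-sum 2F _ 2F _ _ p = ⊥-elim (p refl)
  colours-sum 0F 1F 2F _ _ _ = refl
  colours-sum 0F 2F 1F _ _ _ = refl
  colours-sum 1F 0F 2F _ _ _ = refl
  colours-sum 1F 2F 0F _ _ _ = refl
  colours-sum 2F 0F 1F _ _ _ = refl
  colours-sum 2F 1F 0F _ _ _ = refl

  uncolourable : ∀ {m} {label : Dart n → Maybe (Fin m)} → (∀ d → label (inv d) ≡ label d) → NoFlow G label →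
                 ¬ ThreeEdgeColourable graph
  uncolourable label-inv none (c , proper) = none (colour ∘ c ∘ edge)
    (flow-of-colouring G label-inv (λ d → cong (colour ∘ c) (edge-inv d)) (λ d → colour≢O (c (edge d)))
      (λ v → colours-sum _ _ _ (differ v λ ()) (differ v λ ()) (differ v λ ())))
    where
    inc : ∀ v i → IncidentTo graph (edge (v , i)) v
    inc v i with joins (v , i)
    ... | inj₁ (p , _) = inj₁ p
    ... | inj₂ (_ , p) = inj₂ p
    differ : ∀ v {i j} → i ≢ j → c (edge (v , i)) ≢ c (edge (v , j))
    differ v {i} {j} p = proper _ _ v tt tt (edge-distinct v p) (inc v i) (inc v j)

-- Girth and colouring of the grown graphs

base-colour : ∀ {p b} → (Fin p → Fin 3) → (Fin b → Fin 3) → Kind p b → Fin 3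
base-colour α γ (plain c) = c
base-colour α γ (low s) = α s
base-colour α γ (high s) = α s
base-colour α γ (chord b) = γ b

module _ (Φ : Frame) where
  open Frame Φ

  -- The first step along a path leads to a point, never to `uF` or `vF`, so only plain edges
  -- disappear from the remaining frame vertices.
  survives : Fin frames → Fin 3 → Bool
  survives x i with kindF x i
  ... | plain _ = not (does (proj₁ (mateF x i) Fin.≟ uF) ∨ does (proj₁ (mateF x i) Fin.≟ vF))
  ... | _ = true

-- Segments of even rank get `α`, those of odd rank `β`, and chords `γ`. Both end segments have even
-- rank, so at the frame a path shows only its colour `α`.
record Colouring (Φ : Frame) : Set where
  open Frame Φ
  field
    α β : Fin paths → Fin 3
    γ   : Fin blobs → Fin 3
    α≢β : ∀ s → α s ≢ β s
    α≢γ : ∀ s → α s ≢ γ (blob s)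
    β≢γ : ∀ s → β s ≢ γ (blob s)
    proper : ∀ x → x ≢ uF → x ≢ vF → ∀ i j → i ≢ j → survives Φ x i ≡ true → survives Φ x j ≡ true →
             base-colour α γ (kindF x i) ≢ base-colour α γ (kindF x j)
    u≢v    : uF ≢ vF
    uv     : Fin 3
    uv-plain : ∃ λ c → kindF uF uv ≡ plain c
    uv-mate  : proj₁ (mateF uF uv) ≡ vF

-- A certificate of acyclicity that is checked vertex by vertex: on a cycle of plain edges a vertex
-- of largest `order` would have two neighbours that are not later.
record Forest (Φ : Frame) : Set where
  open Frame Φ
  field
    order    : Fin frames → ℕ
    no-chord : ∀ x i b → kindF x i ≢ chord b
    earlier  : ∀ x i j {c c′} → kindF x i ≡ plain c → kindF x j ≡ plain c′ →
               order (proj₁ (mateF x i)) ≤ order x → order (proj₁ (mateF x j)) ≤ order x → i ≡ j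

maximum : ∀ {k} (f : Fin (suc k) → ℕ) → ∃ λ i → ∀ j → f j ≤ f i
maximum {zero} f = zero , λ { zero → ℕ.≤-refl }
maximum {suc k} f with maximum (f ∘ suc)
... | i , max with f zero ℕ.≤? f (suc i)
...   | yes p = suc i , λ { zero → p ; (suc j) → max j }
...   | no p = zero , λ { zero → ℕ.≤-refl ; (suc j) → ℕ.≤-trans (max j) (ℕ.<⇒≤ (ℕ.≰⇒> p)) }

module Final (Φ : Frame) (ends : Ends Φ) (colouring : Colouring Φ) (forest : Forest Φ) (3≤frames : 3 ≤ Frame.frames Φ) where
  open Frame Φ
  open States Φ
  open Growth Φ ends
  open Colouring colouring
  open Forest forest

  module _ {n} (st : State n) {R} (far : FarFrom st R) where
    open State st renaming (graph to G)
    open Conversion G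

    on-path? : ∀ k → Dec (OnPath k)
    on-path? (plain _) = no λ { (_ , inj₁ ()) ; (_ , inj₂ ()) }
    on-path? (low s) = yes (s , inj₁ refl)
    on-path? (high s) = yes (s , inj₂ refl)
    on-path? (chord _) = no λ { (_ , inj₁ ()) ; (_ , inj₂ ()) }

    on-path-inv : ∀ d → OnPath (kind d) → OnPath (kind (inv d))
    on-path-inv d (s , inj₁ p) = s , inj₂ (trans (kind-inv d) (cong mate p))
    on-path-inv d (s , inj₂ p) = s , inj₁ (trans (kind-inv d) (cong mate p))

    on-path-edge : ∀ d → OnPath (kind (dart (edge d))) → OnPath (kind d)
    on-path-edge d p with edge-of d
    ... | e , inj₁ q = subst (OnPath ∘ kind) q p
    ... | e , inj₂ q = subst (OnPath ∘ kind) (trans (cong inv q) (inv-inv d)) (on-path-inv _ p)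

    edge-on-path : ∀ d → OnPath (kind d) → OnPath (kind (dart (edge d)))
    edge-on-path d p with edge-of d
    ... | e , inj₁ q = subst (OnPath ∘ kind) (sym q) p
    ... | e , inj₂ q = subst (OnPath ∘ kind) (sym q) (on-path-inv _ p)

    ordV : Fin n → ℕ
    ordV v with role v
    ... | point _ = 0
    ... | frame x = order x

    ordV-frame : ∀ {v x} → role v ≡ frame x → ordV v ≡ order x
    ordV-frame {v} p with role v
    ordV-frame refl | frame x = refl

    -- Only the chord of a point lies off its path, so a circuit without segments passes through no
    -- point and stays in the frame.
    point-off : ∀ {v s i} → role v ≡ point s → ¬ OnPath (kind (v , i)) → i ≡ 2F
    point-off {v} p q with role v
    point-off {i = 0F} refl q | point s = ⊥-elim (q (s , inj₂ refl))
    point-off {i = 1F} refl q | point s = ⊥-elim (q (s , inj₁ refl))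
    point-off {i = 2F} refl q | point s = refl

    frame-off : ∀ {x i} → ¬ OnPath (kind (frameV x , i)) → ∃ λ c → kindF x i ≡ plain c
    frame-off {x} {i} p with kindF x i in eq
    ... | plain c = c , refl
    ... | low s = ⊥-elim (p (s , inj₁ (trans (kind-frameV st x i) eq)))
    ... | high s = ⊥-elim (p (s , inj₂ (trans (kind-frameV st x i) eq)))
    ... | chord b = ⊥-elim (no-chord x i b eq)

    -- A last vertex, in the order of the forest, has no two edges to earlier vertices.
    circuit-on-path : ∀ {K len} (C : Circuit graph K len) → ∃ λ i → OnPath (kind (dart (Circuit.es C i)))
    circuit-on-path C with Fin.any? (λ i → on-path? (kind (dart (Circuit.es C i))))
    ... | yes p = p
    ... | no none with maximum (ordV ∘ Circuit.vs C)
    ...   | i , max with orient (proj₂ (Circuits.joins-next C i)) | orient (Sum.swap (Circuits.joins-prev C i))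
    ...     | arc a h e | arc b h′ e′ = ⊥-elim (split (role (vs i)) refl)
      where
      open Circuit C
      a≢b : a ≢ b
      a≢b p = Circuits.prev≢ C i (sym (es-inj (trans e (trans (cong (λ x → edge (vs i , x)) p) (sym e′)))))
      off : ∀ {c j} → es j ≡ edge (vs i , c) → ¬ OnPath (kind (vs i , c))
      off {c} {j} p q = none (j , subst (OnPath ∘ kind ∘ dart) (sym p) (edge-on-path _ q))
      split : ∀ ρ → role (vs i) ≡ ρ → ⊥
      split (point s) p = a≢b (trans (point-off p (off e)) (sym (point-off p (off e′))))
      split (frame x) p = a≢b (earlier x a b (proj₂ plain-a) (proj₂ plain-b) (below h plain-a) (below h′ plain-b))
        where
        v≡ : vs i ≡ frameV x
        v≡ = frame-unique p
        plain-a : ∃ λ c → kindF x a ≡ plain c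
        plain-a = frame-off (subst (λ v → ¬ OnPath (kind (v , a))) v≡ (off e))
        plain-b : ∃ λ c → kindF x b ≡ plain c
        plain-b = frame-off (subst (λ v → ¬ OnPath (kind (v , b))) v≡ (off e′))
        below : ∀ {c j} → tgt (vs i , c) ≡ vs j → (∃ λ k → kindF x c ≡ plain k) → order (proj₁ (mateF x c)) ≤ order x
        below {c} {j} q (_ , k) = subst₂ _≤_
          (trans (cong ordV (trans (sym q) (trans (cong (λ v → tgt (v , c)) v≡) (cong proj₁ (frame-inv k))))) (ordV-frame (role-frameV _)))
          (ordV-frame p) (max j)

    girth : GirthAtLeast graph (suc R)
    girth len C with circuit-on-path C
    ... | i , p = circuit-bound C i λ d q → far d (on-path-edge d (subst (OnPath ∘ kind ∘ dart) q p))

    tint : Kind paths blobs → Bool → Fin 3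
    tint (plain c) _ = c
    tint (low s) b = if b then β s else α s
    tint (high s) b = if b then β s else α s
    tint (chord b) _ = γ b

    dart-colour : Dart n → Fin 3
    dart-colour d = tint (kind d) (odd (rank d))

    tint-mate : ∀ k b → tint (mate k) b ≡ tint k b
    tint-mate (plain _) b = refl
    tint-mate (low _) b = refl
    tint-mate (high _) b = refl
    tint-mate (chord _) b = refl

    dart-colour-inv : ∀ d → dart-colour (inv d) ≡ dart-colour d
    dart-colour-inv d = trans (cong₂ tint (kind-inv d) (cong odd (rank-inv d))) (tint-mate (kind d) (odd (rank d)))

    dart-colour-edge : ∀ d → dart-colour (dart (edge d)) ≡ dart-colour d
    dart-colour-edge d with edge-of d
    ... | e , inj₁ p = cong dart-colour p
    ... | e , inj₂ p = trans (cong dart-colour p) (dart-colour-inv d)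

    α/β : ∀ s b → (if b then β s else α s) ≢ (if not b then β s else α s)
    α/β s true p = α≢β s (sym p)
    α/β s false p = α≢β s p

    α/β≢γ : ∀ s b → (if b then β s else α s) ≢ γ (blob s)
    α/β≢γ s true = β≢γ s
    α/β≢γ s false = α≢γ s

    proper-point : ∀ {v s} → role v ≡ point s → ∀ i j → i ≢ j → dart-colour (v , i) ≢ dart-colour (v , j)
    proper-point {v} p i j q with role v
    proper-point refl 0F 0F q | point s = λ _ → q refl
    proper-point refl 1F 1F q | point s = λ _ → q refl
    proper-point refl 2F 2F q | point s = λ _ → q refl
    proper-point {v} refl 0F 1F q | point s = α/β s (odd (rk v))
    proper-point {v} refl 1F 0F q | point s = α/β s (odd (rk v)) ∘ sym
    proper-point {v} refl 0F 2F q | point s = α/β≢γ s (odd (rk v))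
    proper-point {v} refl 2F 0F q | point s = α/β≢γ s (odd (rk v)) ∘ sym
    proper-point {v} refl 1F 2F q | point s = α/β≢γ s (not (odd (rk v)))
    proper-point {v} refl 2F 1F q | point s = α/β≢γ s (not (odd (rk v))) ∘ sym

    frame-colour : ∀ {v x} → role v ≡ frame x → ∀ i → dart-colour (v , i) ≡ base-colour α γ (kindF x i)
    frame-colour {v} p i with role v
    frame-colour {v} {x} refl i | frame _ with kindF x i
    ... | plain c = refl
    ... | low s = refl
    ... | high s = cong (λ b → if b then β s else α s) (len-even s)
    ... | chord b = refl

    u v : Fin n
    u = frameV uF
    v = frameV vF

    Removed : Fin n → Set
    Removed x = x ≡ u ⊎ x ≡ v

    ends-in : ∀ {e w i} → e ≡ edge (w , i) → EdgesOfMinus graph Removed e → ¬ Removed w × ¬ Removed (tgt (w , i))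
    ends-in {w = w} {i} refl (p , q) with joins (w , i)
    ... | inj₁ (a , b) = subst (¬_ ∘ Removed) a p , subst (¬_ ∘ Removed) b q
    ... | inj₂ (a , b) = subst (¬_ ∘ Removed) b q , subst (¬_ ∘ Removed) a p

    differ : ∀ w i j → i ≢ j → ¬ Removed w → ¬ Removed (tgt (w , i)) → ¬ Removed (tgt (w , j)) →
             ∀ ρ → role w ≡ ρ → dart-colour (w , i) ≢ dart-colour (w , j)
    differ w i j i≢j w∉ i∉ j∉ (point s) p = proper-point p i j i≢j
    differ w i j i≢j w∉ i∉ j∉ (frame x) p same = proper x (λ { refl → w∉ (inj₁ w≡) }) (λ { refl → w∉ (inj₂ w≡) }) i j i≢j
        (lives i i∉) (lives j j∉) (trans (sym (frame-colour p i)) (trans same (frame-colour p j)))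
      where
      w≡ : w ≡ frameV x
      w≡ = frame-unique p
      tgt≡ : ∀ l {c} → kindF x l ≡ plain c → tgt (w , l) ≡ frameV (proj₁ (mateF x l))
      tgt≡ l k = trans (cong (λ y → tgt (y , l)) w≡) (cong proj₁ (frame-inv k))
      lives : ∀ l → ¬ Removed (tgt (w , l)) → survives Φ x l ≡ true
      lives l l∉ with kindF x l in eq
      ... | low _ = refl
      ... | high _ = refl
      ... | chord _ = refl
      ... | plain c with proj₁ (mateF x l) Fin.≟ uF | proj₁ (mateF x l) Fin.≟ vF
      ...   | yes r | _ = ⊥-elim (l∉ (inj₁ (trans (tgt≡ l eq) (cong frameV r))))
      ...   | no _ | yes r = ⊥-elim (l∉ (inj₂ (trans (tgt≡ l eq) (cong frameV r))))
      ...   | no _ | no _ = refl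

    non-removable : NonRemovable graph Removed
    non-removable = dart-colour ∘ dart , λ e f w ke kf e≢f ie jf → separate w ke kf e≢f (incident ie) (incident jf)
      where
      separate : ∀ {e f} w → EdgesOfMinus graph Removed e → EdgesOfMinus graph Removed f → e ≢ f →
                 (∃ λ i → e ≡ edge (w , i)) → (∃ λ j → f ≡ edge (w , j)) → dart-colour (dart e) ≢ dart-colour (dart f)
      separate w ke kf e≢f (i , refl) (j , refl) same =
        differ w i j (λ { refl → e≢f refl }) (proj₁ (ends-in refl ke)) (proj₂ (ends-in refl ke)) (proj₂ (ends-in refl kf)) (role w) refl
          (trans (sym (dart-colour-edge (w , i))) (trans same (dart-colour-edge (w , j))))

    adjacent : Adjacent graph u v
    adjacent = edge (u , uv) , subst (Joins graph _ u) (trans (cong proj₁ (frame-inv (proj₂ uv-plain))) (cong frameV uv-mate)) (joins (u , uv))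

    label-inv : ∀ d → label (kind (inv d)) ≡ label (kind d)
    label-inv d = trans (cong label (kind-inv d)) (mate-label (kind d))
      where
      mate-label : ∀ k → label (mate k) ≡ label k
      mate-label (plain _) = refl
      mate-label (low _) = refl
      mate-label (high _) = refl
      mate-label (chord _) = refl

    snark : Snark graph
    snark = cubic , (ℕ.≤-trans 3≤frames (Fin.injective⇒≤ (frameV-injective st)) ,
      Connectivity.connected small-cuts , Connectivity.connected-without small-cuts) , uncolourable label-inv no-flow

    conclusion : ∀ {g} → g ≤ suc R → 5 ≤ suc R → Σ Graph λ Γ → NontrivialSnark Γ × GirthAtLeast Γ g ×
      Σ (Vertex Γ) λ u → Σ (Vertex Γ) λ v → u ≢ v × Adjacent Γ u v × NonRemovable Γ (λ x → x ≡ u ⊎ x ≡ v)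
    conclusion p q = graph , (snark , Connectivity.cyclically-4-connected small-cuts , λ len C → ℕ.≤-trans q (girth len C)) ,
      (λ len C → ℕ.≤-trans p (girth len C)) , u , v , (λ r → u≢v (frameV-injective st r)) , adjacent , non-removable

  from-base : ∀ {n} → State n → (g : ℕ) → Σ Graph λ Γ → NontrivialSnark Γ × GirthAtLeast Γ g ×
    Σ (Vertex Γ) λ u → Σ (Vertex Γ) λ v → u ≢ v × Adjacent Γ u v × NonRemovable Γ (λ x → x ≡ u ⊎ x ≡ v)
  -- The resulting girth is at least `5 + g`, enough for both bounds.
  from-base st g = finish (enlarge st (4 + g) (4 + g) ℕ.≤-refl)
    where
    finish : (∃ λ n → Σ (State n) λ st → Ready (4 + g) st × FarFrom st (4 + g)) → _
    finish (_ , st′ , _ , far) = conclusion st′ far (ℕ.m≤n+m g 5) (s≤s (s≤s (s≤s (s≤s (s≤s z≤n)))))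

-- The dart i of the vertex v is encoded as 3 v + i.
decode : ∀ n → .{{_ : NonZero n}} → ℕ → Dart n
decode n k = (k / 3) mod n , k mod 3

Table : ℕ → Set
Table n = Vec (Vec ℕ 3) n

at : ∀ {n} → .{{_ : NonZero n}} → Table n → Dart n → Dart n
at {n} t (v , i) = decode n (lookupᵛ (lookupᵛ t v) i)

-- The small cuts of the initial graph

record Rigid (n : ℕ) : Set where
  constructor rigid
  field
    graph      : CubicGraph n
    small-cuts : SmallCutsTrivial graph

Quad : Set
Quad = ℕ × ℕ × ℕ × ℕ

quad : ∀ {n} → .{{_ : NonZero n}} → Quad → Fin 2 → Fin 2 → Dart n
quad {n} (a , b , c , d) 0F 0F = decode n a
quad {n} (a , b , c , d) 0F 1F = decode n b
quad {n} (a , b , c , d) 1F 0F = decode n c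
quad {n} (a , b , c , d) 1F 1F = decode n d

site? : ∀ {n} (G : CubicGraph n) (D : Fin 2 → Fin 2 → Dart n) → Maybe (Sites G)
site? G D with Fin.all? (λ j → Fin.all? (λ i → CubicGraph.inv G (D j i) ≟ᵈ D j (flip i)))
             | Fin.all? (λ j → Fin.all? (λ i → Fin.all? (λ i′ → ¬? (proj₁ (D j i) Fin.≟ proj₁ (D (flip j) i′)))))
... | yes p | yes q = just (record { D = D ; D-inv = p ; apart = q })
... | _ | _ = nothing

grown : ℕ → List Quad → ℕ
grown n [] = n
grown n (_ ∷ qs) = grown (2 + n) qs

grow : ∀ {n} → .{{NonZero n}} → Rigid n → (qs : List Quad) → Maybe (Rigid (grown n qs))
grow r [] = just r
grow {n} (rigid G sct) (q ∷ qs) = site? G (quad q) >>= λ S →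
  grow (rigid (AddEdge.G⁺ G S) (AddEdge.small-cuts-trivial⁺ G S sct)) qs

extract : ∀ {A : Set} (m : Maybe A) → T (is-just m) → A
extract (just x) _ = x

K₄-table : Table 4
K₄-table = (3 ∷ 6 ∷ 9 ∷ []) ∷ (0 ∷ 7 ∷ 10 ∷ []) ∷ (1 ∷ 4 ∷ 11 ∷ []) ∷ (2 ∷ 5 ∷ 8 ∷ []) ∷ []

involution? : ∀ {n} (f : Dart n → Dart n) → Dec (∀ v i → f (f (v , i)) ≡ (v , i))
involution? f = Fin.all? λ v → Fin.all? λ i → f (f (v , i)) ≟ᵈ (v , i)

loopless? : ∀ {n} (f : Dart n → Dart n) → Dec (∀ v i → proj₁ (f (v , i)) ≢ v)
loopless? f = Fin.all? λ v → Fin.all? λ i → ¬? (proj₁ (f (v , i)) Fin.≟ v)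

K₄ : CubicGraph 4
K₄ = record
  { inv = at K₄-table
  ; inv-inv = λ (v , i) → toWitness {a? = involution? (at K₄-table)} tt v i
  ; loopless = λ (v , i) → toWitness {a? = loopless? (at K₄-table)} tt v i }

at-most-one? : ∀ {n} (X : Fin n → Bool) → Dec (AtMostOne X)
at-most-one? X = Fin.all? λ v → Fin.all? λ w → (X v Bool.≟ true) →-dec ((X w Bool.≟ true) →-dec (v Fin.≟ w))

trivial-ext : ∀ {n} {X Y : Fin n → Bool} → (∀ v → X v ≡ Y v) → TrivialCut X → TrivialCut Y
trivial-ext eq (inj₁ one) = inj₁ λ v w p q → one v w (trans (eq v) p) (trans (eq w) q)
trivial-ext eq (inj₂ one) = inj₂ λ v w p q → one v w (trans (cong not (eq v)) p) (trans (cong not (eq w)) q)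

module _ {n} (G : CubicGraph n) where
  open CubicGraph G

  crossing? : (X : Fin n → Bool) → ∀ d → Dec (X (proj₁ d) ≡ true × X (tgt d) ≡ false)
  crossing? X d = (X (proj₁ d) Bool.≟ true) ×-dec (X (tgt d) Bool.≟ false)

  Good : (Fin n → Bool) → Set
  Good X = TrivialCut X ⊎ 4 ≤ length (filter (crossing? X) (darts n))

  good? : ∀ X → Dec (Good X)
  good? X = (at-most-one? X ⊎-dec at-most-one? (not ∘ X)) ⊎-dec (4 ℕ.≤? length (filter (crossing? X) (darts n)))

  three-values : ∀ {A : Set} {a b c : A} xs → Unique xs → All (λ x → OneOf x a b c) xs → ¬ 4 ≤ length xs
  three-values (x ∷ y ∷ z ∷ w ∷ xs) ((xy ∷ xz ∷ xw ∷ _) ∷ (yz ∷ yw ∷ _) ∷ (zw ∷ _) ∷ _) (p ∷ q ∷ r ∷ s ∷ _) _ =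
    4-in-3 xy xz xw yz zw yw p q r s
  three-values (x ∷ []) _ _ (s≤s ())
  three-values (x ∷ y ∷ []) _ _ (s≤s (s≤s ()))
  three-values (x ∷ y ∷ z ∷ []) _ _ (s≤s (s≤s (s≤s ())))

  -- Counting crossing darts replaces the quantification over triples of darts, so one test per
  -- subset decides the property.
  good-trivial : (∀ (p : Subset n) → Good (lookupᵛ p)) → SmallCutsTrivial G
  good-trivial good X a b c within with good (tabulateᵛ X)
  ... | inj₁ t = trivial-ext (lookup∘tabulate X) t
  ... | inj₂ four = ⊥-elim (three-values _ (Unique.filter⁺ (crossing? Y) (darts-unique n))
          (All.map (λ {d} (p , q) → within d (trans (sym (lookup∘tabulate X (proj₁ d))) p) (trans (sym (lookup∘tabulate X (tgt d))) q))
            (All.all-filter (crossing? Y) (darts n))) four)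
    where Y = lookupᵛ (tabulateᵛ X)

-- These sixteen subsets are the only ones ever searched.
K₄-rigid : Rigid 4
K₄-rigid = rigid K₄ (good-trivial K₄ λ p → decidable-stable (good? K₄ (lookupᵛ p)) λ bad →
  from-no (anySubset? (λ p → ¬? (good? K₄ (lookupᵛ p)))) (p , bad))

module _ {m n} (F : CubicGraph m) (G : CubicGraph n) (σ : Dart n → Dart m) (τ : Dart m → Dart n) (ρ : Fin n → Fin m) (π : Fin m → Fin n)
         (σ-τ : ∀ d → σ (τ d) ≡ d) (π-ρ : ∀ v → π (ρ v) ≡ v) (τ-vertex : ∀ d → proj₁ (τ d) ≡ π (proj₁ d))
         (τ-inv : ∀ d → τ (CubicGraph.inv F d) ≡ CubicGraph.inv G (τ d)) where

  rename-cuts : SmallCutsTrivial F → SmallCutsTrivial G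
  rename-cuts sct X a b c within with sct (X ∘ π) (σ a) (σ b) (σ c) within′
    where
    within′ : CutWithin F (X ∘ π) (σ a) (σ b) (σ c)
    within′ d p q with within (τ d) (trans (cong X (τ-vertex d)) p)
                         (trans (cong (X ∘ proj₁) (sym (τ-inv d))) (trans (cong X (τ-vertex (CubicGraph.inv F d))) q))
    ... | inj₁ r = inj₁ (trans (sym (σ-τ d)) (cong σ r))
    ... | inj₂ (inj₁ r) = inj₂ (inj₁ (trans (sym (σ-τ d)) (cong σ r)))
    ... | inj₂ (inj₂ r) = inj₂ (inj₂ (trans (sym (σ-τ d)) (cong σ r)))
  ... | inj₁ one = inj₁ λ v w p q → back (one (ρ v) (ρ w) (trans (cong X (π-ρ v)) p) (trans (cong X (π-ρ w)) q))
    where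
    back : ∀ {v w} → ρ v ≡ ρ w → v ≡ w
    back {v} {w} r = trans (sym (π-ρ v)) (trans (cong π r) (π-ρ w))
  ... | inj₂ one = inj₂ λ v w p q → back (one (ρ v) (ρ w) (trans (cong (not ∘ X) (π-ρ v)) p) (trans (cong (not ∘ X) (π-ρ w)) q))
    where
    back : ∀ {v w} → ρ v ≡ ρ w → v ≡ w
    back {v} {w} r = trans (sym (π-ρ v)) (trans (cong π r) (π-ρ w))

-- The frame consists of four large blocks 10 k + i (Petersen graphs) and three small blocks 40 + 6 m + j
-- (Petersen graphs without the ends of the two edges 49 and 58).  The vertices 3 and 7 of the large blocks
-- are inserted at the missing vertices of the first two small blocks, the vertices 0 at those of the third.
H-table : Table 58
H-table =
  (3 ∷ 166 ∷ 15 ∷ []) ∷ (0 ∷ 6 ∷ 18 ∷ []) ∷ (4 ∷ 9 ∷ 21 ∷ []) ∷ (7 ∷ 137 ∷ 24 ∷ []) ∷ (157 ∷ 134 ∷ 27 ∷ []) ∷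
  (2 ∷ 22 ∷ 25 ∷ []) ∷ (5 ∷ 26 ∷ 28 ∷ []) ∷ (8 ∷ 16 ∷ 130 ∷ []) ∷ (11 ∷ 17 ∷ 19 ∷ []) ∷ (14 ∷ 20 ∷ 121 ∷ []) ∷
  (33 ∷ 173 ∷ 45 ∷ []) ∷ (30 ∷ 36 ∷ 48 ∷ []) ∷ (34 ∷ 39 ∷ 51 ∷ []) ∷ (37 ∷ 131 ∷ 54 ∷ []) ∷ (170 ∷ 133 ∷ 57 ∷ []) ∷
  (32 ∷ 52 ∷ 55 ∷ []) ∷ (35 ∷ 56 ∷ 58 ∷ []) ∷ (38 ∷ 46 ∷ 122 ∷ []) ∷ (41 ∷ 47 ∷ 49 ∷ []) ∷ (44 ∷ 50 ∷ 136 ∷ []) ∷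
  (63 ∷ 158 ∷ 75 ∷ []) ∷ (60 ∷ 66 ∷ 78 ∷ []) ∷ (64 ∷ 69 ∷ 81 ∷ []) ∷ (67 ∷ 155 ∷ 84 ∷ []) ∷ (172 ∷ 152 ∷ 87 ∷ []) ∷
  (62 ∷ 82 ∷ 85 ∷ []) ∷ (65 ∷ 86 ∷ 88 ∷ []) ∷ (68 ∷ 76 ∷ 148 ∷ []) ∷ (71 ∷ 77 ∷ 79 ∷ []) ∷ (74 ∷ 80 ∷ 139 ∷ []) ∷
  (93 ∷ 167 ∷ 105 ∷ []) ∷ (90 ∷ 96 ∷ 108 ∷ []) ∷ (94 ∷ 99 ∷ 111 ∷ []) ∷ (97 ∷ 149 ∷ 114 ∷ []) ∷
  (169 ∷ 151 ∷ 117 ∷ []) ∷ (92 ∷ 112 ∷ 115 ∷ []) ∷ (95 ∷ 116 ∷ 118 ∷ []) ∷ (98 ∷ 106 ∷ 140 ∷ []) ∷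
  (101 ∷ 107 ∷ 109 ∷ []) ∷ (104 ∷ 110 ∷ 154 ∷ []) ∷ (123 ∷ 29 ∷ 53 ∷ []) ∷ (120 ∷ 126 ∷ 132 ∷ []) ∷
  (124 ∷ 129 ∷ 135 ∷ []) ∷ (127 ∷ 23 ∷ 40 ∷ []) ∷ (125 ∷ 43 ∷ 13 ∷ []) ∷ (128 ∷ 59 ∷ 10 ∷ []) ∷
  (141 ∷ 89 ∷ 113 ∷ []) ∷ (138 ∷ 144 ∷ 150 ∷ []) ∷ (142 ∷ 147 ∷ 153 ∷ []) ∷ (145 ∷ 83 ∷ 100 ∷ []) ∷
  (143 ∷ 103 ∷ 73 ∷ []) ∷ (146 ∷ 119 ∷ 70 ∷ []) ∷ (159 ∷ 12 ∷ 61 ∷ []) ∷ (156 ∷ 162 ∷ 168 ∷ []) ∷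
  (160 ∷ 165 ∷ 171 ∷ []) ∷ (163 ∷ 1 ∷ 91 ∷ []) ∷ (161 ∷ 102 ∷ 42 ∷ []) ∷ (164 ∷ 72 ∷ 31 ∷ []) ∷ []

-- Successive edge additions that produce H from K₄, up to the renaming to-H; found by a computer search.
steps : List Quad
steps =
  (3 , 0 , 11 , 8) ∷ (8 , 15 , 2 , 5) ∷ (2 , 5 , 12 , 7) ∷ (24 , 19 , 23 , 28) ∷ (25 , 1 , 16 , 23) ∷
  (24 , 33 , 29 , 4) ∷ (25 , 45 , 28 , 9) ∷ (15 , 4 , 38 , 33) ∷ (57 , 7 , 51 , 13) ∷ (26 , 29 , 48 , 18) ∷
  (25 , 10 , 58 , 68) ∷ (22 , 57 , 26 , 29) ∷ (56 , 59 , 31 , 19) ∷ (84 , 54 , 88 , 58) ∷ (80 , 39 , 10 , 31) ∷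
  (37 , 4 , 48 , 79) ∷ (42 , 105 , 45 , 99) ∷ (111 , 1 , 52 , 37) ∷ (97 , 16 , 13 , 22) ∷ (22 , 1 , 28 , 4) ∷
  (100 , 40 , 58 , 128) ∷ (94 , 100 , 129 , 28) ∷ (36 , 79 , 13 , 19) ∷ (79 , 113 , 1 , 85) ∷ (90 , 42 , 40 , 79) ∷
  (61 , 105 , 113 , 82) ∷ (28 , 58 , 155 , 123) ∷ []

to-H from-H : Table 58
to-H =
  (139 ∷ 140 ∷ 138 ∷ []) ∷ (142 ∷ 143 ∷ 141 ∷ []) ∷ (50 ∷ 48 ∷ 49 ∷ []) ∷ (55 ∷ 54 ∷ 56 ∷ []) ∷ (93 ∷ 94 ∷ 95 ∷ []) ∷
  (109 ∷ 110 ∷ 108 ∷ []) ∷ (162 ∷ 164 ∷ 163 ∷ []) ∷ (166 ∷ 167 ∷ 165 ∷ []) ∷ (2 ∷ 1 ∷ 0 ∷ []) ∷ (4 ∷ 5 ∷ 3 ∷ []) ∷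
  (73 ∷ 72 ∷ 74 ∷ []) ∷ (88 ∷ 89 ∷ 87 ∷ []) ∷ (66 ∷ 68 ∷ 67 ∷ []) ∷ (70 ∷ 71 ∷ 69 ∷ []) ∷ (8 ∷ 6 ∷ 7 ∷ []) ∷
  (10 ∷ 11 ∷ 9 ∷ []) ∷ (20 ∷ 18 ∷ 19 ∷ []) ∷ (25 ∷ 24 ∷ 26 ∷ []) ∷ (100 ∷ 99 ∷ 101 ∷ []) ∷ (115 ∷ 116 ∷ 114 ∷ []) ∷
  (96 ∷ 97 ∷ 98 ∷ []) ∷ (112 ∷ 113 ∷ 111 ∷ []) ∷ (15 ∷ 17 ∷ 16 ∷ []) ∷ (23 ∷ 21 ∷ 22 ∷ []) ∷ (57 ∷ 58 ∷ 59 ∷ []) ∷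
  (135 ∷ 137 ∷ 136 ∷ []) ∷ (77 ∷ 75 ∷ 76 ∷ []) ∷ (83 ∷ 81 ∷ 82 ∷ []) ∷ (123 ∷ 125 ∷ 124 ∷ []) ∷
  (127 ∷ 128 ∷ 126 ∷ []) ∷ (36 ∷ 38 ∷ 37 ∷ []) ∷ (40 ∷ 41 ∷ 39 ∷ []) ∷ (117 ∷ 118 ∷ 119 ∷ []) ∷
  (153 ∷ 155 ∷ 154 ∷ []) ∷ (159 ∷ 160 ∷ 161 ∷ []) ∷ (170 ∷ 169 ∷ 168 ∷ []) ∷ (90 ∷ 91 ∷ 92 ∷ []) ∷
  (106 ∷ 107 ∷ 105 ∷ []) ∷ (31 ∷ 32 ∷ 30 ∷ []) ∷ (35 ∷ 34 ∷ 33 ∷ []) ∷ (130 ∷ 129 ∷ 131 ∷ []) ∷ (46 ∷ 45 ∷ 47 ∷ []) ∷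
  (102 ∷ 104 ∷ 103 ∷ []) ∷ (150 ∷ 152 ∷ 151 ∷ []) ∷ (157 ∷ 158 ∷ 156 ∷ []) ∷ (173 ∷ 172 ∷ 171 ∷ []) ∷
  (62 ∷ 61 ∷ 60 ∷ []) ∷ (65 ∷ 64 ∷ 63 ∷ []) ∷ (121 ∷ 122 ∷ 120 ∷ []) ∷ (134 ∷ 133 ∷ 132 ∷ []) ∷ (27 ∷ 28 ∷ 29 ∷ []) ∷
  (51 ∷ 52 ∷ 53 ∷ []) ∷ (42 ∷ 43 ∷ 44 ∷ []) ∷ (145 ∷ 146 ∷ 144 ∷ []) ∷ (13 ∷ 12 ∷ 14 ∷ []) ∷ (80 ∷ 79 ∷ 78 ∷ []) ∷
  (85 ∷ 86 ∷ 84 ∷ []) ∷ (149 ∷ 148 ∷ 147 ∷ []) ∷ []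
from-H =
  (26 ∷ 25 ∷ 24 ∷ []) ∷ (29 ∷ 27 ∷ 28 ∷ []) ∷ (43 ∷ 44 ∷ 42 ∷ []) ∷ (47 ∷ 45 ∷ 46 ∷ []) ∷ (163 ∷ 162 ∷ 164 ∷ []) ∷
  (66 ∷ 68 ∷ 67 ∷ []) ∷ (49 ∷ 50 ∷ 48 ∷ []) ∷ (70 ∷ 71 ∷ 69 ∷ []) ∷ (52 ∷ 51 ∷ 53 ∷ []) ∷ (150 ∷ 151 ∷ 152 ∷ []) ∷
  (116 ∷ 114 ∷ 115 ∷ []) ∷ (119 ∷ 118 ∷ 117 ∷ []) ∷ (90 ∷ 92 ∷ 91 ∷ []) ∷ (95 ∷ 93 ∷ 94 ∷ []) ∷
  (156 ∷ 157 ∷ 158 ∷ []) ∷ (124 ∷ 123 ∷ 125 ∷ []) ∷ (7 ∷ 8 ∷ 6 ∷ []) ∷ (153 ∷ 154 ∷ 155 ∷ []) ∷ (10 ∷ 9 ∷ 11 ∷ []) ∷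
  (72 ∷ 73 ∷ 74 ∷ []) ∷ (140 ∷ 139 ∷ 138 ∷ []) ∷ (143 ∷ 142 ∷ 141 ∷ []) ∷ (36 ∷ 38 ∷ 37 ∷ []) ∷ (41 ∷ 39 ∷ 40 ∷ []) ∷
  (31 ∷ 30 ∷ 32 ∷ []) ∷ (79 ∷ 80 ∷ 78 ∷ []) ∷ (167 ∷ 166 ∷ 165 ∷ []) ∷ (82 ∷ 83 ∷ 81 ∷ []) ∷ (170 ∷ 168 ∷ 169 ∷ []) ∷
  (35 ∷ 33 ∷ 34 ∷ []) ∷ (108 ∷ 109 ∷ 110 ∷ []) ∷ (12 ∷ 13 ∷ 14 ∷ []) ∷ (60 ∷ 61 ∷ 62 ∷ []) ∷ (55 ∷ 54 ∷ 56 ∷ []) ∷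
  (126 ∷ 128 ∷ 127 ∷ []) ∷ (113 ∷ 111 ∷ 112 ∷ []) ∷ (17 ∷ 15 ∷ 16 ∷ []) ∷ (65 ∷ 63 ∷ 64 ∷ []) ∷ (59 ∷ 57 ∷ 58 ∷ []) ∷
  (96 ∷ 97 ∷ 98 ∷ []) ∷ (146 ∷ 144 ∷ 145 ∷ []) ∷ (84 ∷ 86 ∷ 85 ∷ []) ∷ (89 ∷ 87 ∷ 88 ∷ []) ∷ (121 ∷ 120 ∷ 122 ∷ []) ∷
  (149 ∷ 148 ∷ 147 ∷ []) ∷ (75 ∷ 77 ∷ 76 ∷ []) ∷ (2 ∷ 0 ∷ 1 ∷ []) ∷ (5 ∷ 3 ∷ 4 ∷ []) ∷ (161 ∷ 159 ∷ 160 ∷ []) ∷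
  (173 ∷ 172 ∷ 171 ∷ []) ∷ (129 ∷ 131 ∷ 130 ∷ []) ∷ (99 ∷ 101 ∷ 100 ∷ []) ∷ (134 ∷ 132 ∷ 133 ∷ []) ∷
  (102 ∷ 103 ∷ 104 ∷ []) ∷ (18 ∷ 20 ∷ 19 ∷ []) ∷ (23 ∷ 21 ∷ 22 ∷ []) ∷ (107 ∷ 106 ∷ 105 ∷ []) ∷
  (137 ∷ 136 ∷ 135 ∷ []) ∷ []

H-involution : ∀ v i → at H-table (at H-table (v , i)) ≡ (v , i)
H-involution = toWitness {a? = involution? (at H-table)} tt

H-loopless : ∀ v i → proj₁ (at H-table (v , i)) ≢ v
H-loopless = toWitness {a? = loopless? (at H-table)} tt

H : CubicGraph 58
H = record
  { inv = at H-table
  ; inv-inv = λ (v , i) → H-involution v i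
  ; loopless = λ (v , i) → H-loopless v i }

from-to : ∀ v i → at from-H (at to-H (v , i)) ≡ (v , i)
from-to = toWitness {a? = Fin.all? λ v → Fin.all? λ i → at from-H (at to-H (v , i)) ≟ᵈ (v , i)} tt

to-from : ∀ v → proj₁ (at to-H (proj₁ (at from-H (v , 0F)) , 0F)) ≡ v
to-from = toWitness {a? = Fin.all? λ v → proj₁ (at to-H (proj₁ (at from-H (v , 0F)) , 0F)) Fin.≟ v} tt

to-vertex : ∀ v i → proj₁ (at to-H (v , i)) ≡ proj₁ (at to-H (v , 0F))
to-vertex = toWitness {a? = Fin.all? λ v → Fin.all? λ i → proj₁ (at to-H (v , i)) Fin.≟ proj₁ (at to-H (v , 0F))} tt

IsoToH : (Dart 58 → Dart 58) → Set
IsoToH inv = ∀ v i → at to-H (inv (v , i)) ≡ at H-table (at to-H (v , i))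

iso-to-H? : ∀ inv → Dec (IsoToH inv)
iso-to-H? inv = Fin.all? λ v → Fin.all? λ i → at to-H (inv (v , i)) ≟ᵈ at H-table (at to-H (v , i))

small-cuts-via : (F : Rigid 58) → IsoToH (CubicGraph.inv (Rigid.graph F)) → SmallCutsTrivial H
small-cuts-via (rigid F sct) iso = rename-cuts F H (at from-H) (at to-H) (λ v → proj₁ (at from-H (v , 0F))) (λ v → proj₁ (at to-H (v , 0F)))
  (λ (v , i) → from-to v i) to-from (λ (v , i) → to-vertex v i) (λ (v , i) → iso v i) sct

H-small-cuts : SmallCutsTrivial H
H-small-cuts = small-cuts-via (extract (grow K₄-rigid steps) tt)
  (toWitness {a? = iso-to-H? (CubicGraph.inv (Rigid.graph (extract (grow K₄-rigid steps) tt)))} tt)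

-- Codes: 0, 1, 2 for the colours of plain darts, 3 + s for low s and 35 + s for high s.
kinds : Table 58
kinds =
  (1 ∷ 0 ∷ 60 ∷ []) ∷ (1 ∷ 0 ∷ 2 ∷ []) ∷ (0 ∷ 1 ∷ 5 ∷ []) ∷ (1 ∷ 39 ∷ 40 ∷ []) ∷ (59 ∷ 38 ∷ 1 ∷ []) ∷
  (28 ∷ 1 ∷ 0 ∷ []) ∷ (2 ∷ 1 ∷ 0 ∷ []) ∷ (37 ∷ 1 ∷ 36 ∷ []) ∷ (8 ∷ 0 ∷ 1 ∷ []) ∷ (1 ∷ 0 ∷ 35 ∷ []) ∷
  (0 ∷ 2 ∷ 62 ∷ []) ∷ (0 ∷ 2 ∷ 1 ∷ []) ∷ (2 ∷ 0 ∷ 11 ∷ []) ∷ (0 ∷ 45 ∷ 46 ∷ []) ∷ (61 ∷ 44 ∷ 2 ∷ []) ∷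
  (30 ∷ 2 ∷ 0 ∷ []) ∷ (1 ∷ 2 ∷ 0 ∷ []) ∷ (43 ∷ 2 ∷ 42 ∷ []) ∷ (14 ∷ 0 ∷ 2 ∷ []) ∷ (2 ∷ 0 ∷ 41 ∷ []) ∷
  (2 ∷ 0 ∷ 64 ∷ []) ∷ (2 ∷ 1 ∷ 0 ∷ []) ∷ (1 ∷ 0 ∷ 17 ∷ []) ∷ (0 ∷ 51 ∷ 52 ∷ []) ∷ (63 ∷ 50 ∷ 1 ∷ []) ∷
  (32 ∷ 2 ∷ 0 ∷ []) ∷ (0 ∷ 1 ∷ 2 ∷ []) ∷ (49 ∷ 2 ∷ 48 ∷ []) ∷ (20 ∷ 0 ∷ 1 ∷ []) ∷ (1 ∷ 2 ∷ 47 ∷ []) ∷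
  (2 ∷ 1 ∷ 66 ∷ []) ∷ (2 ∷ 1 ∷ 0 ∷ []) ∷ (1 ∷ 2 ∷ 23 ∷ []) ∷ (2 ∷ 57 ∷ 58 ∷ []) ∷ (65 ∷ 56 ∷ 2 ∷ []) ∷
  (34 ∷ 2 ∷ 1 ∷ []) ∷ (0 ∷ 2 ∷ 1 ∷ []) ∷ (55 ∷ 2 ∷ 54 ∷ []) ∷ (26 ∷ 1 ∷ 2 ∷ []) ∷ (2 ∷ 1 ∷ 53 ∷ []) ∷
  (1 ∷ 3 ∷ 10 ∷ []) ∷ (1 ∷ 0 ∷ 2 ∷ []) ∷ (0 ∷ 1 ∷ 2 ∷ []) ∷ (1 ∷ 4 ∷ 13 ∷ []) ∷ (2 ∷ 12 ∷ 6 ∷ []) ∷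
  (2 ∷ 9 ∷ 7 ∷ []) ∷ (2 ∷ 15 ∷ 22 ∷ []) ∷ (2 ∷ 0 ∷ 1 ∷ []) ∷ (0 ∷ 2 ∷ 1 ∷ []) ∷ (2 ∷ 16 ∷ 25 ∷ []) ∷
  (1 ∷ 24 ∷ 18 ∷ []) ∷ (1 ∷ 21 ∷ 19 ∷ []) ∷ (1 ∷ 27 ∷ 0 ∷ []) ∷ (1 ∷ 0 ∷ 2 ∷ []) ∷ (0 ∷ 2 ∷ 1 ∷ []) ∷
  (2 ∷ 0 ∷ 1 ∷ []) ∷ (2 ∷ 33 ∷ 29 ∷ []) ∷ (1 ∷ 31 ∷ 2 ∷ []) ∷ []

decode-kind : ℕ → Kind 32 12
decode-kind k = if k <ᵇ 3 then plain (k mod 3) else if k <ᵇ 35 then low ((k ∸ 3) mod 32) else high ((k ∸ 35) mod 32)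

blobs-of : Vec ℕ 32
blobs-of = 0 ∷ 0 ∷ 0 ∷ 1 ∷ 1 ∷ 1 ∷ 2 ∷ 2 ∷ 2 ∷ 3 ∷ 3 ∷ 3 ∷ 4 ∷ 4 ∷ 4 ∷ 5 ∷ 5 ∷ 5 ∷ 6 ∷ 6 ∷ 6 ∷ 7 ∷ 7 ∷ 7 ∷ 8 ∷ 8 ∷ 9 ∷ 9 ∷ 10 ∷ 10 ∷ 11 ∷ 11 ∷ []

Φ : Frame
Φ = record
  { frames = 58
  ; paths = 32
  ; blobs = 12
  ; blob = λ s → lookupᵛ blobs-of s mod 12
  ; kindF = λ x i → decode-kind (lookupᵛ (lookupᵛ kinds x) i)
  ; mateF = λ x i → at H-table (x , i)
  ; uF = 22 mod 58
  ; vF = 23 mod 58 }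

open Frame Φ
open States Φ

labelH : Dart 58 → Maybe (Fin 12)
labelH (x , i) = label (Frame.kindF Φ x i)

-- The Petersen graph

_≟ᵛ_ : (x y : V₄) → Dec (x ≡ y)
_≟ᵛ_ = ≡-dec Bool._≟_ Bool._≟_

nonzero-value : Fin 3 → V₄
nonzero-value 0F = true , false
nonzero-value 1F = false , true
nonzero-value 2F = true , true

value-of : ∀ x → x ≢ O → ∃ λ i → x ≡ nonzero-value i
value-of (true , false) _ = 0F , refl
value-of (false , true) _ = 1F , refl
value-of (true , true) _ = 2F , refl
value-of (false , false) p = ⊥-elim (p refl)

-- The flow is determined by its values on the edges 01, 12, 23, 34, 40 and 57.
petersen-search : ∀ a b c d e f → let x = nonzero-value in
  let s₀ = x e ⊕ x a ; s₁ = x a ⊕ x b ; s₂ = x b ⊕ x c ; s₃ = x c ⊕ x d ; s₄ = x d ⊕ x e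
      n₂ = s₂ ⊕ x f ; n₄ = s₄ ⊕ n₂ ; n₁ = s₁ ⊕ n₄ ; n₃ = s₃ ⊕ n₁ in
  s₀ ≡ O ⊎ s₁ ≡ O ⊎ s₂ ≡ O ⊎ s₃ ≡ O ⊎ s₄ ≡ O ⊎ n₂ ≡ O ⊎ n₄ ≡ O ⊎ n₁ ≡ O ⊎ n₃ ≡ O
petersen-search = toWitness {a? = Fin.all? λ a → Fin.all? λ b → Fin.all? λ c → Fin.all? λ d → Fin.all? λ e → Fin.all? λ f →
  (_ ≟ᵛ O) ⊎-dec (_ ≟ᵛ O) ⊎-dec (_ ≟ᵛ O) ⊎-dec (_ ≟ᵛ O) ⊎-dec (_ ≟ᵛ O) ⊎-dec (_ ≟ᵛ O) ⊎-dec (_ ≟ᵛ O) ⊎-dec (_ ≟ᵛ O) ⊎-dec (_ ≟ᵛ O)} tt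

P-table : Table 10
P-table =
  (3 ∷ 12 ∷ 15 ∷ []) ∷ (0 ∷ 6 ∷ 18 ∷ []) ∷ (4 ∷ 9 ∷ 21 ∷ []) ∷ (7 ∷ 13 ∷ 24 ∷ []) ∷ (1 ∷ 10 ∷ 27 ∷ []) ∷
  (2 ∷ 22 ∷ 25 ∷ []) ∷ (5 ∷ 26 ∷ 28 ∷ []) ∷ (8 ∷ 16 ∷ 29 ∷ []) ∷ (11 ∷ 17 ∷ 19 ∷ []) ∷ (14 ∷ 20 ∷ 23 ∷ []) ∷ []

petersen-no-flow : (φ : Dart 10 → V₄) → (∀ d → φ d ≢ O) → (∀ v i → φ (at P-table (v , i)) ≡ φ (v , i)) →
           (∀ v → φ (v , 0F) ⊕ φ (v , 1F) ⊕ φ (v , 2F) ≡ O) → ⊥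
petersen-no-flow φ nz inv cons with value-of _ (nz (0F , 0F)) | value-of _ (nz (1F , 1F)) | value-of _ (nz (2F , 1F))
                          | value-of _ (nz (3F , 1F)) | value-of _ (nz (0F , 1F)) | value-of _ (nz (5F , 1F))
... | a , pa | b , pb | c , pc | d , pd | e , pe | f , pf = case petersen-search a b c d e f of λ where
    (inj₁ z) → nz (0F , 2F) (trans s₀ z)
    (inj₂ (inj₁ z)) → nz (1F , 2F) (trans s₁ z)
    (inj₂ (inj₂ (inj₁ z))) → nz (2F , 2F) (trans s₂ z)
    (inj₂ (inj₂ (inj₂ (inj₁ z)))) → nz (3F , 2F) (trans s₃ z)
    (inj₂ (inj₂ (inj₂ (inj₂ (inj₁ z))))) → nz (4F , 2F) (trans s₄ z)
    (inj₂ (inj₂ (inj₂ (inj₂ (inj₂ (inj₁ z)))))) → nz (7F , 2F) (trans n₂ z)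
    (inj₂ (inj₂ (inj₂ (inj₂ (inj₂ (inj₂ (inj₁ z))))))) → nz (9F , 1F) (trans n₄ z)
    (inj₂ (inj₂ (inj₂ (inj₂ (inj₂ (inj₂ (inj₂ (inj₁ z)))))))) → nz (6F , 1F) (trans n₁ z)
    (inj₂ (inj₂ (inj₂ (inj₂ (inj₂ (inj₂ (inj₂ (inj₂ z)))))))) → nz (8F , 1F) (trans n₃ z)
  where
  x = nonzero-value
  third : ∀ v → φ (v , 2F) ≡ φ (v , 0F) ⊕ φ (v , 1F)
  third v = sym (⊕-cancel (φ (v , 0F) ⊕ φ (v , 1F)) (φ (v , 2F)) (trans (⊕-assoc (φ (v , 0F)) (φ (v , 1F)) (φ (v , 2F))) (cons v)))
  second : ∀ v → φ (v , 1F) ≡ φ (v , 0F) ⊕ φ (v , 2F)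
  second v = sym (⊕-cancel (φ (v , 0F) ⊕ φ (v , 2F)) (φ (v , 1F)) (trans (⊕-assoc (φ (v , 0F)) (φ (v , 2F)) (φ (v , 1F)))
    (trans (cong (φ (v , 0F) ⊕_) (⊕-comm (φ (v , 2F)) (φ (v , 1F)))) (cons v))))
  s₀ : φ (0F , 2F) ≡ x e ⊕ x a
  s₀ = trans (third 0F) (trans (⊕-comm (φ (0F , 0F)) (φ (0F , 1F))) (cong₂ _⊕_ pe pa))
  s₁ : φ (1F , 2F) ≡ x a ⊕ x b
  s₁ = trans (third 1F) (cong₂ _⊕_ (trans (inv 0F 0F) pa) pb)
  s₂ : φ (2F , 2F) ≡ x b ⊕ x c
  s₂ = trans (third 2F) (cong₂ _⊕_ (trans (inv 1F 1F) pb) pc)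
  s₃ : φ (3F , 2F) ≡ x c ⊕ x d
  s₃ = trans (third 3F) (cong₂ _⊕_ (trans (inv 2F 1F) pc) pd)
  s₄ : φ (4F , 2F) ≡ x d ⊕ x e
  s₄ = trans (third 4F) (trans (⊕-comm (φ (4F , 0F)) (φ (4F , 1F))) (cong₂ _⊕_ (trans (inv 3F 1F) pd) (trans (inv 0F 1F) pe)))
  n₂ : φ (7F , 2F) ≡ (x b ⊕ x c) ⊕ x f
  n₂ = trans (third 7F) (cong₂ _⊕_ (trans (inv 2F 2F) s₂) (trans (inv 5F 1F) pf))
  n₄ : φ (9F , 1F) ≡ (x d ⊕ x e) ⊕ (x b ⊕ x c) ⊕ x f
  n₄ = trans (second 9F) (cong₂ _⊕_ (trans (inv 4F 2F) s₄) (trans (inv 7F 2F) n₂))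
  n₁ : φ (6F , 1F) ≡ (x a ⊕ x b) ⊕ (x d ⊕ x e) ⊕ (x b ⊕ x c) ⊕ x f
  n₁ = trans (second 6F) (cong₂ _⊕_ (trans (inv 1F 2F) s₁) (trans (inv 9F 1F) n₄))
  n₃ : φ (8F , 1F) ≡ (x c ⊕ x d) ⊕ (x a ⊕ x b) ⊕ (x d ⊕ x e) ⊕ (x b ⊕ x c) ⊕ x f
  n₃ = trans (second 8F) (cong₂ _⊕_ (trans (inv 3F 2F) s₃) (trans (inv 6F 1F) n₁))

-- Linear consequences of the flow equations are checked by cancelling darts in pairs,
-- after choosing one dart of every unlabelled edge.

representative : Dart 58 → Dart 58
representative d with labelH d
... | just _ = d
... | nothing = if does (proj₁ d Fin.<? CubicGraph.tgt H d) then d else CubicGraph.inv H d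

-- Every element of the four-group is its own inverse, so a second occurrence of a dart removes the
-- first.
toggle : Dart 58 → List (Dart 58) → List (Dart 58)
toggle d [] = d ∷ []
toggle d (e ∷ es) with d ≟ᵈ e
... | yes _ = es
... | no _ = e ∷ toggle d es

normal : List (Dart 58) → List (Dart 58)
normal = foldr (toggle ∘ representative) []

Cancels : List (Dart 58) → Set
Cancels ds = normal ds ≡ []

cancels? : ∀ ds → Dec (Cancels ds)
cancels? ds with normal ds
... | [] = yes refl
... | _ ∷ _ = no λ ()

vertex-list : Fin 58 → List (Dart 58)
vertex-list v = (v , 0F) ∷ (v , 1F) ∷ (v , 2F) ∷ []

labelled-by : Fin 12 → List (Dart 58) → List (Dart 58)
labelled-by b [] = []
labelled-by b (d ∷ ds) with labelH d
... | nothing = labelled-by b ds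
... | just b′ = if does (b′ Fin.≟ b) then d ∷ labelled-by b ds else labelled-by b ds

module HFlow (c : Dart 58 → V₄) (flow : Flow H labelH c) where
  open CubicGraph H
  open Flow flow

  record Zero (ds : List (Dart 58)) : Set where
    constructor is-zero
    field total≡O : total c ds ≡ O
  open Zero

  total-++ : ∀ xs ys → total c (xs ++ ys) ≡ total c xs ⊕ total c ys
  total-++ [] ys = refl
  total-++ (x ∷ xs) ys = trans (cong (c x ⊕_) (total-++ xs ys)) (sym (⊕-assoc (c x) _ _))

  c-representative : ∀ d → c (representative d) ≡ c d
  c-representative d with labelH d in eq
  ... | just _ = refl
  ... | nothing with does (proj₁ d Fin.<? tgt d)
  ...   | true = refl
  ...   | false = unlabelled d eq

  total-toggle : ∀ d es → total c (toggle d es) ≡ c d ⊕ total c es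
  total-toggle d [] = refl
  total-toggle d (e ∷ es) with d ≟ᵈ e
  ... | yes refl = trans (sym (cong (_⊕ total c es) (⊕-self (c d)))) (⊕-assoc (c d) (c d) _)
  ... | no _ = begin
    c e ⊕ total c (toggle d es)  ≡⟨ cong (c e ⊕_) (total-toggle d es) ⟩
    c e ⊕ c d ⊕ total c es       ≡⟨ sym (⊕-assoc (c e) (c d) _) ⟩
    (c e ⊕ c d) ⊕ total c es     ≡⟨ cong (_⊕ total c es) (⊕-comm (c e) (c d)) ⟩
    (c d ⊕ c e) ⊕ total c es     ≡⟨ ⊕-assoc (c d) (c e) _ ⟩
    c d ⊕ c e ⊕ total c es       ∎
    where open ≡-Reasoning

  total-normal : ∀ ds → total c (normal ds) ≡ total c ds
  total-normal [] = refl
  total-normal (d ∷ ds) = trans (total-toggle (representative d) (normal ds)) (cong₂ _⊕_ (c-representative d) (total-normal ds))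

  concat-zero : ∀ {rs} → All Zero rs → total c (concat rs) ≡ O
  concat-zero [] = refl
  concat-zero {r ∷ rs} (z ∷ zs) = trans (total-++ r (concat rs)) (cong₂ _⊕_ (total≡O z) (concat-zero zs))

  -- As there are no signs, a linear consequence is a choice of relations whose formal sum with `ds`
  -- vanishes modulo 2. The choice `rs` is the whole certificate.
  derive : ∀ ds rs → Cancels (ds ++ concat rs) → All Zero rs → Zero ds
  derive ds rs p zs = is-zero (begin
    total c ds                              ≡⟨ sym (⊕-identityʳ (total c ds)) ⟩
    total c ds ⊕ O                          ≡⟨ cong (total c ds ⊕_) (sym (concat-zero zs)) ⟩
    total c ds ⊕ total c (concat rs)        ≡⟨ sym (total-++ ds (concat rs)) ⟩
    total c (ds ++ concat rs)               ≡⟨ sym (total-normal (ds ++ concat rs)) ⟩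
    total c (normal (ds ++ concat rs))      ≡⟨ cong (total c) p ⟩
    O                                       ∎)
    where open ≡-Reasoning

  vertex-zero : ∀ v → Zero (vertex-list v)
  vertex-zero v = is-zero (trans (cong (λ z → c (v , 0F) ⊕ c (v , 1F) ⊕ z) (⊕-identityʳ (c (v , 2F)))) (conserved v))

  vertices-zero : ∀ vs → All Zero (map vertex-list vs)
  vertices-zero [] = []
  vertices-zero (v ∷ vs) = vertex-zero v ∷ vertices-zero vs

  blob-zero : ∀ b → Zero (labelled-by b (darts 58))
  blob-zero b = is-zero (trans (eq (darts 58)) (labelled b))
    where
    eq : ∀ ds → total c (labelled-by b ds) ≡ total (λ d → select b (labelH d) (c d)) ds
    eq [] = refl
    eq (d ∷ ds) with labelH d
    ... | nothing = eq ds
    ... | just b′ with does (b′ Fin.≟ b)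
    ...   | true = cong (c d ⊕_) (eq ds)
    ...   | false = eq ds

  -- A copy of the Petersen graph whose edges carry totals of lists of darts.
  copy : (list : Dart 10 → List (Dart 58)) (rels : Fin 10 → List (List (Dart 58))) →
         (∀ v i → Cancels ((list (at P-table (v , i)) ++ list (v , i)) ++ [])) →
         (∀ v → Cancels ((list (v , 0F) ++ list (v , 1F) ++ list (v , 2F)) ++ concat (rels v))) →
         (∀ v → All Zero (rels v)) → (∀ d → ¬ Zero (list d)) → ⊥
  copy list rels inv-check vertex-check zeros nz = petersen-no-flow (total c ∘ list) (λ d p → nz d (is-zero p))
    (λ v i → let there = list (at P-table (v , i)) ; here = list (v , i) in
      ⊕-cancel (total c there) (total c here) (trans (sym (total-++ there here)) (total≡O (derive (there ++ here) [] (inv-check v i) []))))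
    (λ v → let x = list (v , 0F) ; y = list (v , 1F) ; z = list (v , 2F) in
      trans (sym (trans (total-++ x (y ++ z)) (cong (total c x ⊕_) (total-++ y z)))) (total≡O (derive (x ++ y ++ z) (rels v) (vertex-check v) (zeros v))))

-- The blocks of the initial graph, and why it has no flow

N : Fin 4 → Fin 10 → Fin 58
N k i = (10 * toℕ k + toℕ i) mod 58

-- The entries for the missing vertices 4, 5, 8, 9 are never used.
M-position : Vec ℕ 10
M-position = 0 ∷ 1 ∷ 2 ∷ 3 ∷ 0 ∷ 0 ∷ 4 ∷ 5 ∷ 0 ∷ 0 ∷ []

M : Fin 3 → Fin 10 → Fin 58
M m i = (40 + 6 * toℕ m + lookupᵛ M-position i) mod 58

N-dart : Fin 4 → Dart 10 → List (Dart 58)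
N-dart k (i , j) = (N k i , j) ∷ []

-- The opened vertices 0, 3 and 7 are pairwise nonadjacent in the Petersen graph, so each edge at
-- one of them can be read off at its other end. For an opened vertex, `N-sum` is the corresponding
-- bundle.
N-list : Fin 4 → Dart 10 → List (Dart 58)
N-list k (0F , j) = N-dart k (at P-table (0F , j))
N-list k (3F , j) = N-dart k (at P-table (3F , j))
N-list k (7F , j) = N-dart k (at P-table (7F , j))
N-list k d = N-dart k d

N-sum : Fin 4 → Fin 10 → List (Dart 58)
N-sum k i = N-list k (i , 0F) ++ N-list k (i , 1F) ++ N-list k (i , 2F)

M-dart : Fin 3 → Dart 10 → List (Dart 58)
M-dart m (i , j) = (M m i , j) ∷ []

-- The two free ends left by a missing vertex. Conservation there would force their sum on the
-- missing edge 49 or 58.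
M-sum : Fin 3 → Fin 10 → List (Dart 58)
M-sum m 4F = M-dart m (at P-table (4F , 0F)) ++ M-dart m (at P-table (4F , 1F))
M-sum m 9F = M-dart m (at P-table (9F , 1F)) ++ M-dart m (at P-table (9F , 2F))
M-sum m 5F = M-dart m (at P-table (5F , 0F)) ++ M-dart m (at P-table (5F , 1F))
M-sum m 8F = M-dart m (at P-table (8F , 0F)) ++ M-dart m (at P-table (8F , 2F))
M-sum m _ = []

M-list : Fin 3 → Dart 10 → List (Dart 58)
M-list m (4F , 2F) = M-sum m 4F
M-list m (9F , 0F) = M-sum m 4F
M-list m (5F , 2F) = M-sum m 5F
M-list m (8F , 1F) = M-sum m 5F
M-list m (4F , j) = M-dart m (at P-table (4F , j))
M-list m (9F , j) = M-dart m (at P-table (9F , j))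
M-list m (5F , j) = M-dart m (at P-table (5F , j))
M-list m (8F , j) = M-dart m (at P-table (8F , j))
M-list m d = M-dart m d

N-vertices : Fin 4 → List (List (Dart 58))
N-vertices k = map vertex-list (N k 1F ∷ N k 2F ∷ N k 4F ∷ N k 5F ∷ N k 6F ∷ N k 8F ∷ N k 9F ∷ [])

M-vertices : Fin 3 → List (List (Dart 58))
M-vertices m = map vertex-list (M m 0F ∷ M m 1F ∷ M m 2F ∷ M m 3F ∷ M m 6F ∷ M m 7F ∷ [])

N-rels : Fin 4 → Fin 10 → List (List (Dart 58))
N-rels k 0F = N-sum k 0F ∷ []
N-rels k 3F = N-sum k 3F ∷ []
N-rels k 7F = N-sum k 7F ∷ []
N-rels k i = vertex-list (N k i) ∷ []

M-rels : Fin 3 → Fin 10 → List (List (Dart 58))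
M-rels m 4F = []
M-rels m 9F = (M-sum m 4F ++ M-sum m 9F) ∷ []
M-rels m 5F = []
M-rels m 8F = (M-sum m 5F ++ M-sum m 8F) ∷ []
M-rels m i = vertex-list (M m i) ∷ []

-- In the sum over the seven vertices of the tree every tree edge occurs twice; the three bundles
-- are left.
N-third-check : ∀ k → Cancels (N-sum k 0F ++ concat (N-sum k 7F ∷ N-sum k 3F ∷ N-vertices k))
N-third-check = toWitness {a? = Fin.all? λ k → cancels? (N-sum k 0F ++ concat (N-sum k 7F ∷ N-sum k 3F ∷ N-vertices k))} tt

N-pair-check : ∀ k → Cancels ((N-sum k 7F ++ N-sum k 3F) ++ concat (N-sum k 0F ∷ N-vertices k))
N-pair-check = toWitness {a? = Fin.all? λ k → cancels? ((N-sum k 7F ++ N-sum k 3F) ++ concat (N-sum k 0F ∷ N-vertices k))} tt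

N-inv-check : ∀ k v i → Cancels ((N-list k (at P-table (v , i)) ++ N-list k (v , i)) ++ [])
N-inv-check = toWitness {a? = Fin.all? λ k → Fin.all? λ v → Fin.all? λ i →
  cancels? ((N-list k (at P-table (v , i)) ++ N-list k (v , i)) ++ [])} tt

N-vertex-check : ∀ k v → Cancels (N-sum k v ++ concat (N-rels k v))
N-vertex-check = toWitness {a? = Fin.all? λ k → Fin.all? λ v → cancels? (N-sum k v ++ concat (N-rels k v))} tt

M-inv-check : ∀ m v i → Cancels ((M-list m (at P-table (v , i)) ++ M-list m (v , i)) ++ [])
M-inv-check = toWitness {a? = Fin.all? λ m → Fin.all? λ v → Fin.all? λ i →
  cancels? ((M-list m (at P-table (v , i)) ++ M-list m (v , i)) ++ [])} tt

M-vertex-check : ∀ m v → Cancels ((M-list m (v , 0F) ++ M-list m (v , 1F) ++ M-list m (v , 2F)) ++ concat (M-rels m v))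
M-vertex-check = toWitness {a? = Fin.all? λ m → Fin.all? λ v →
  cancels? ((M-list m (v , 0F) ++ M-list m (v , 1F) ++ M-list m (v , 2F)) ++ concat (M-rels m v))} tt

-- joint b = (m , x , k , u): the blob b identifies the opened vertex x of the m-th small block with the
-- opened vertex u of the k-th large block.
joint : Fin 12 → Fin 3 × Fin 10 × Fin 4 × Fin 10
joint = lookupᵛ
  ( (0F , 4F , 0F , 7F) ∷ (0F , 9F , 0F , 3F) ∷ (0F , 5F , 1F , 7F) ∷ (0F , 8F , 1F , 3F)
  ∷ (1F , 4F , 2F , 7F) ∷ (1F , 9F , 2F , 3F) ∷ (1F , 5F , 3F , 7F) ∷ (1F , 8F , 3F , 3F)
  ∷ (2F , 4F , 0F , 0F) ∷ (2F , 9F , 1F , 0F) ∷ (2F , 5F , 2F , 0F) ∷ (2F , 8F , 3F , 0F) ∷ [])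

joint-list : Fin 12 → List (Dart 58)
joint-list b = let m , x , k , u = joint b in M-sum m x ++ N-sum k u

joint-rels : Fin 12 → List (List (Dart 58))
joint-rels b = let m , x , k , u = joint b in labelled-by b (darts 58) ∷ vertex-list (N k u) ∷ []

-- The vertex `u` lies inside the joint. Its own conservation law, added to that of the label,
-- removes its darts, and the two bundles remain.
joint-check : ∀ b → Cancels (joint-list b ++ concat (joint-rels b))
joint-check = toWitness {a? = Fin.all? λ b → cancels? (joint-list b ++ concat (joint-rels b))} tt

-- Two large blocks are attached to each of the first two small ones; what flows into such a pair through
-- the vertex 0 of one large block leaves through the vertex 0 of the other.
block : Fin 2 → Fin 3
block 0F = 0F
block 1F = 1F

first second : Fin 2 → Fin 4
first 0F = 0F
first 1F = 2F
second 0F = 1F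
second 1F = 3F

joints : Fin 2 → Fin 4 → Fin 12
joints 0F 0F = 0F
joints 0F 1F = 1F
joints 0F 2F = 2F
joints 0F 3F = 3F
joints 1F 0F = 4F
joints 1F 1F = 5F
joints 1F 2F = 6F
joints 1F 3F = 7F

through : Fin 2 → List (Dart 58)
through m = N-sum (first m) 0F ++ N-sum (second m) 0F

through-rels : Fin 2 → List (List (Dart 58))
through-rels m = joint-list (joints m 0F) ∷ joint-list (joints m 1F) ∷ joint-list (joints m 2F) ∷ joint-list (joints m 3F) ∷
  N-vertices (first m) ++ N-vertices (second m) ++ M-vertices (block m)

-- The inner edges of the three blocks cancel, and the four joints cancel the bundles between the
-- blocks.
through-check : ∀ m → Cancels (through m ++ concat (through-rels m))
through-check = toWitness {a? = Fin.all? λ m → cancels? (through m ++ concat (through-rels m))} tt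

module _ (c : Dart 58 → V₄) (flow : Flow H labelH c) where
  open HFlow c flow
  open Flow flow

  singleton : ∀ d → ¬ Zero (d ∷ [])
  singleton d (is-zero p) = nonzero d (trans (sym (⊕-identityʳ (c d))) p)

  not-all-zero : ∀ k → Zero (N-sum k 7F) → Zero (N-sum k 3F) → ⊥
  not-all-zero k p q = copy (N-list k) (N-rels k) (N-inv-check k) (N-vertex-check k) zeros nz
    where
    r : Zero (N-sum k 0F)
    r = derive (N-sum k 0F) (N-sum k 7F ∷ N-sum k 3F ∷ N-vertices k) (N-third-check k) (p ∷ q ∷ vertices-zero _)
    zeros : ∀ v → All Zero (N-rels k v)
    zeros 0F = r ∷ []
    zeros 1F = vertex-zero _ ∷ []
    zeros 2F = vertex-zero _ ∷ []
    zeros 3F = q ∷ []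
    zeros 4F = vertex-zero _ ∷ []
    zeros 5F = vertex-zero _ ∷ []
    zeros 6F = vertex-zero _ ∷ []
    zeros 7F = p ∷ []
    zeros 8F = vertex-zero _ ∷ []
    zeros 9F = vertex-zero _ ∷ []
    nz : ∀ d → ¬ Zero (N-list k d)
    nz (0F , j) = singleton _
    nz (1F , j) = singleton _
    nz (2F , j) = singleton _
    nz (3F , j) = singleton _
    nz (4F , j) = singleton _
    nz (5F , j) = singleton _
    nz (6F , j) = singleton _
    nz (7F , j) = singleton _
    nz (8F , j) = singleton _
    nz (9F , j) = singleton _

  M-copy : ∀ m → Zero (M-sum m 4F ++ M-sum m 9F) → Zero (M-sum m 5F ++ M-sum m 8F) →
           ¬ Zero (M-sum m 4F) → ¬ Zero (M-sum m 5F) → ⊥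
  M-copy m p q p′ q′ = copy (M-list m) (M-rels m) (M-inv-check m) (M-vertex-check m) zeros nz
    where
    zeros : ∀ v → All Zero (M-rels m v)
    zeros 0F = vertex-zero _ ∷ []
    zeros 1F = vertex-zero _ ∷ []
    zeros 2F = vertex-zero _ ∷ []
    zeros 3F = vertex-zero _ ∷ []
    zeros 4F = []
    zeros 5F = []
    zeros 6F = vertex-zero _ ∷ []
    zeros 7F = vertex-zero _ ∷ []
    zeros 8F = q ∷ []
    zeros 9F = p ∷ []
    nz : ∀ d → ¬ Zero (M-list m d)
    nz (0F , j) = singleton _
    nz (1F , j) = singleton _
    nz (2F , j) = singleton _
    nz (3F , j) = singleton _
    nz (4F , 0F) = singleton _
    nz (4F , 1F) = singleton _
    nz (4F , 2F) = p′
    nz (5F , 0F) = singleton _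
    nz (5F , 1F) = singleton _
    nz (5F , 2F) = q′
    nz (6F , j) = singleton _
    nz (7F , j) = singleton _
    nz (8F , 0F) = singleton _
    nz (8F , 1F) = q′
    nz (8F , 2F) = singleton _
    nz (9F , 0F) = p′
    nz (9F , 1F) = singleton _
    nz (9F , 2F) = singleton _

  joint-zero : ∀ b → Zero (joint-list b)
  joint-zero b = derive (joint-list b) (joint-rels b) (joint-check b) (blob-zero b ∷ vertex-zero _ ∷ [])

  N-vertices-zero : ∀ k → All Zero (N-vertices k)
  N-vertices-zero k = vertices-zero (N k 1F ∷ N k 2F ∷ N k 4F ∷ N k 5F ∷ N k 6F ∷ N k 8F ∷ N k 9F ∷ [])

  M-vertices-zero : ∀ m → All Zero (M-vertices m)
  M-vertices-zero m = vertices-zero (M m 0F ∷ M m 1F ∷ M m 2F ∷ M m 3F ∷ M m 6F ∷ M m 7F ∷ [])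

  through-zero : ∀ m → Zero (through m)
  through-zero m = derive (through m) (through-rels m) (through-check m)
    (joint-zero (joints m 0F) ∷ joint-zero (joints m 1F) ∷ joint-zero (joints m 2F) ∷ joint-zero (joints m 3F) ∷
      All.++⁺ (N-vertices-zero (first m)) (All.++⁺ (N-vertices-zero (second m)) (M-vertices-zero (block m))))

  equal : ∀ xs ys → Zero (xs ++ ys) → total c xs ≡ total c ys
  equal xs ys (is-zero p) = ⊕-cancel (total c xs) (total c ys) (trans (sym (total-++ xs ys)) p)

  zero-sum : ∀ xs ys → total c xs ≡ total c ys → Zero (xs ++ ys)
  zero-sum xs ys p = is-zero (trans (total-++ xs ys) (trans (cong (_⊕ total c ys) p) (⊕-self (total c ys))))

  zero-via : ∀ xs ys → Zero (xs ++ ys) → Zero xs → Zero ys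
  zero-via xs ys p (is-zero q) = is-zero (trans (sym (equal xs ys p)) q)

  -- If nothing flows through its vertex 0, a large block acts as an edge carrying a nonzero flow.
  module _ (m : Fin 3) (x y : Fin 10) (k : Fin 4)
           (jx : Zero (M-sum m x ++ N-sum k 7F)) (jy : Zero (M-sum m y ++ N-sum k 3F)) (z : Zero (N-sum k 0F)) where

    N-equal : total c (N-sum k 7F) ≡ total c (N-sum k 3F)
    N-equal = equal (N-sum k 7F) (N-sum k 3F)
      (derive (N-sum k 7F ++ N-sum k 3F) (N-sum k 0F ∷ N-vertices k) (N-pair-check k) (z ∷ N-vertices-zero k))

    M-equal : Zero (M-sum m x ++ M-sum m y)
    M-equal = zero-sum (M-sum m x) (M-sum m y) (trans (equal (M-sum m x) (N-sum k 7F) jx)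
      (trans N-equal (sym (equal (M-sum m y) (N-sum k 3F) jy))))

    M-nonzero : ¬ Zero (M-sum m x)
    M-nonzero p = not-all-zero k q (is-zero (trans (sym N-equal) (Zero.total≡O q)))
      where q = zero-via (M-sum m x) (N-sum k 7F) jx p

  -- Were this bundle zero, so would be its counterpart in the second large block. Both large blocks
  -- would then act as edges with nonzero flow and complete the small block to a Petersen graph with
  -- a nowhere-zero flow.
  superedge : ∀ m → ¬ Zero (N-sum (first m) 0F)
  superedge 0F z = M-copy 0F (M-equal 0F 4F 9F 0F (joint-zero 0F) (joint-zero 1F) z) (M-equal 0F 5F 8F 1F (joint-zero 2F) (joint-zero 3F) z′)
      (M-nonzero 0F 4F 9F 0F (joint-zero 0F) (joint-zero 1F) z) (M-nonzero 0F 5F 8F 1F (joint-zero 2F) (joint-zero 3F) z′)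
    where z′ = zero-via (N-sum 0F 0F) (N-sum 1F 0F) (through-zero 0F) z
  superedge 1F z = M-copy 1F (M-equal 1F 4F 9F 2F (joint-zero 4F) (joint-zero 5F) z) (M-equal 1F 5F 8F 3F (joint-zero 6F) (joint-zero 7F) z′)
      (M-nonzero 1F 4F 9F 2F (joint-zero 4F) (joint-zero 5F) z) (M-nonzero 1F 5F 8F 3F (joint-zero 6F) (joint-zero 7F) z′)
    where z′ = zero-via (N-sum 2F 0F) (N-sum 3F 0F) (through-zero 1F) z

  -- Each pair of large blocks now plays the role of a missing edge of the third small block, again
  -- giving a flow on a Petersen graph.
  contradictory : ⊥
  contradictory = M-copy 2F (across 4F 9F 0F 1F (joint-zero 8F) (joint-zero 9F) (through-zero 0F))
      (across 5F 8F 2F 3F (joint-zero 10F) (joint-zero 11F) (through-zero 1F))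
      (λ p → superedge 0F (zero-via (M-sum 2F 4F) (N-sum 0F 0F) (joint-zero 8F) p))
      (λ p → superedge 1F (zero-via (M-sum 2F 5F) (N-sum 2F 0F) (joint-zero 10F) p))
    where
    10F 11F : Fin 12
    10F = suc 9F
    11F = suc (suc 9F)
    across : ∀ x y k k′ → Zero (M-sum 2F x ++ N-sum k 0F) → Zero (M-sum 2F y ++ N-sum k′ 0F) → Zero (N-sum k 0F ++ N-sum k′ 0F) →
             Zero (M-sum 2F x ++ M-sum 2F y)
    across x y k k′ p q r = zero-sum (M-sum 2F x) (M-sum 2F y) (trans (equal (M-sum 2F x) (N-sum k 0F) p)
      (trans (equal (N-sum k 0F) (N-sum k′ 0F) r) (sym (equal (M-sum 2F y) (N-sum k′ 0F) q))))

H-no-flow : NoFlow H labelH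
H-no-flow = contradictory

-- From the initial graph to the initial state

record Stage (n : ℕ) : Set where
  constructor stage
  field
    graph      : CubicGraph n
    small-cuts : SmallCutsTrivial graph
    labels     : Dart n → Maybe (Fin 12)
    no-flow    : NoFlow graph labels

-- A label together with two edges. These chords join different paths with the same label, which is
-- harmless for the colouring because the chord colour differs from both colours of every path with
-- that label.
Chord : Set
Chord = ℕ × Quad

extended : ℕ → List Chord → ℕ
extended n [] = n
extended n (_ ∷ qs) = extended (2 + n) qs

add-label : ∀ {n} → Fin 12 → (Dart n → Maybe (Fin 12)) → Dart (2 + n) → Maybe (Fin 12)
add-label b labels (0F , _) = just b
add-label b labels (1F , _) = just b
add-label b labels (suc (suc v) , i) = labels (v , i)

labelled? : ∀ {n} (labels : Dart n → Maybe (Fin 12)) (D : Fin 2 → Fin 2 → Dart n) → Dec (∀ j i → labels (D j i) ≢ nothing)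
labelled? labels D = Fin.all? λ j → Fin.all? λ i → ¬? (Maybe.≡-dec Fin._≟_ (labels (D j i)) nothing)

new-label : ∀ {n} (labels : Dart n → Maybe (Fin 12)) b (G : CubicGraph n) S j i →
            add-label b labels (AddEdge.newV G S j , i) ≡ just b
new-label labels b G S 0F i = refl
new-label labels b G S 1F i = refl

add-chord : ∀ {n} → .{{NonZero n}} → Stage n → Chord → Maybe (Stage (2 + n))
add-chord (stage G sct labels none) (b , q) = site? G (quad q) >>= λ S → case labelled? labels (Sites.D S) of λ where
  (no _) → nothing
  (yes p) → just (stage (AddEdge.G⁺ G S) (AddEdge.small-cuts-trivial⁺ G S sct) (add-label (b mod 12) labels)
    (no-flow⁺ G S (λ _ → refl) (λ j i → trans (new-label labels _ G S j i) (sym (new-label labels _ G S j 0F))) p none))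

extend : ∀ {n} → .{{NonZero n}} → Stage n → (qs : List Chord) → Maybe (Stage (extended n qs))
extend st [] = just st
extend st (q ∷ qs) = add-chord st q >>= λ st′ → extend st′ qs

-- Two points on every path, joined cyclically within each blob.
chords : List Chord
chords =
  (0 , 121 , 29 , 130 , 23) ∷ (0 , 127 , 0 , 14 , 27) ∷ (0 , 142 , 9 , 20 , 3) ∷ (1 , 152 , 31 , 155 , 28) ∷
  (1 , 158 , 0 , 48 , 35) ∷ (1 , 167 , 9 , 54 , 3) ∷ (2 , 172 , 95 , 158 , 89) ∷ (2 , 178 , 0 , 80 , 93) ∷
  (2 , 170 , 9 , 86 , 3) ∷ (3 , 187 , 97 , 185 , 94) ∷ (3 , 193 , 0 , 114 , 101) ∷ (3 , 197 , 9 , 120 , 3) ∷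
  (4 , 211 , 161 , 220 , 155) ∷ (4 , 217 , 0 , 146 , 159) ∷ (4 , 232 , 9 , 152 , 3) ∷ (5 , 242 , 163 , 245 , 160) ∷
  (5 , 248 , 0 , 180 , 167) ∷ (5 , 257 , 9 , 186 , 3) ∷ (6 , 262 , 227 , 248 , 221) ∷ (6 , 268 , 0 , 212 , 225) ∷
  (6 , 260 , 9 , 218 , 3) ∷ (7 , 277 , 229 , 275 , 226) ∷ (7 , 283 , 0 , 246 , 233) ∷ (7 , 287 , 9 , 252 , 3) ∷
  (8 , 301 , 156 , 159 , 146) ∷ (8 , 307 , 0 , 165 , 3) ∷ (9 , 326 , 198 , 201 , 188) ∷ (9 , 332 , 0 , 207 , 3) ∷
  (10 , 340 , 240 , 243 , 230) ∷ (10 , 346 , 0 , 249 , 3) ∷ (11 , 349 , 282 , 285 , 272) ∷ (11 , 355 , 0 , 291 , 3) ∷ []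

base-table : Table 122
base-table =
  (361 ∷ 6 ∷ 5 ∷ []) ∷ (297 ∷ 9 ∷ 2 ∷ []) ∷ (1 ∷ 294 ∷ 11 ∷ []) ∷ (4 ∷ 284 ∷ 8 ∷ []) ∷ (364 ∷ 18 ∷ 17 ∷ []) ∷
  (267 ∷ 21 ∷ 14 ∷ []) ∷ (13 ∷ 264 ∷ 23 ∷ []) ∷ (16 ∷ 254 ∷ 20 ∷ []) ∷ (362 ∷ 30 ∷ 29 ∷ []) ∷ (237 ∷ 33 ∷ 26 ∷ []) ∷
  (25 ∷ 234 ∷ 35 ∷ []) ∷ (28 ∷ 224 ∷ 32 ∷ []) ∷ (349 ∷ 42 ∷ 41 ∷ []) ∷ (207 ∷ 45 ∷ 38 ∷ []) ∷ (37 ∷ 204 ∷ 47 ∷ []) ∷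
  (40 ∷ 194 ∷ 44 ∷ []) ∷ (341 ∷ 63 ∷ 53 ∷ []) ∷ (306 ∷ 57 ∷ 50 ∷ []) ∷ (343 ∷ 60 ∷ 59 ∷ []) ∷ (52 ∷ 293 ∷ 56 ∷ []) ∷
  (55 ∷ 295 ∷ 65 ∷ []) ∷ (49 ∷ 292 ∷ 62 ∷ []) ∷ (332 ∷ 81 ∷ 71 ∷ []) ∷ (290 ∷ 75 ∷ 68 ∷ []) ∷ (346 ∷ 78 ∷ 77 ∷ []) ∷
  (70 ∷ 303 ∷ 74 ∷ []) ∷ (73 ∷ 311 ∷ 83 ∷ []) ∷ (67 ∷ 305 ∷ 80 ∷ []) ∷ (347 ∷ 99 ∷ 89 ∷ []) ∷ (276 ∷ 93 ∷ 86 ∷ []) ∷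
  (344 ∷ 96 ∷ 95 ∷ []) ∷ (88 ∷ 263 ∷ 92 ∷ []) ∷ (91 ∷ 265 ∷ 101 ∷ []) ∷ (85 ∷ 262 ∷ 98 ∷ []) ∷
  (340 ∷ 117 ∷ 107 ∷ []) ∷ (260 ∷ 111 ∷ 104 ∷ []) ∷ (331 ∷ 114 ∷ 113 ∷ []) ∷ (106 ∷ 273 ∷ 110 ∷ []) ∷
  (109 ∷ 281 ∷ 119 ∷ []) ∷ (103 ∷ 275 ∷ 116 ∷ []) ∷ (323 ∷ 135 ∷ 125 ∷ []) ∷ (246 ∷ 129 ∷ 122 ∷ []) ∷
  (325 ∷ 132 ∷ 131 ∷ []) ∷ (124 ∷ 233 ∷ 128 ∷ []) ∷ (127 ∷ 235 ∷ 137 ∷ []) ∷ (121 ∷ 232 ∷ 134 ∷ []) ∷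
  (314 ∷ 153 ∷ 143 ∷ []) ∷ (230 ∷ 147 ∷ 140 ∷ []) ∷ (328 ∷ 150 ∷ 149 ∷ []) ∷ (142 ∷ 243 ∷ 146 ∷ []) ∷
  (145 ∷ 251 ∷ 155 ∷ []) ∷ (139 ∷ 245 ∷ 152 ∷ []) ∷ (329 ∷ 171 ∷ 161 ∷ []) ∷ (216 ∷ 165 ∷ 158 ∷ []) ∷
  (326 ∷ 168 ∷ 167 ∷ []) ∷ (160 ∷ 203 ∷ 164 ∷ []) ∷ (163 ∷ 205 ∷ 173 ∷ []) ∷ (157 ∷ 202 ∷ 170 ∷ []) ∷
  (322 ∷ 189 ∷ 179 ∷ []) ∷ (200 ∷ 183 ∷ 176 ∷ []) ∷ (313 ∷ 186 ∷ 185 ∷ []) ∷ (178 ∷ 213 ∷ 182 ∷ []) ∷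
  (181 ∷ 221 ∷ 191 ∷ []) ∷ (175 ∷ 215 ∷ 188 ∷ []) ∷ (195 ∷ 358 ∷ 46 ∷ []) ∷ (192 ∷ 198 ∷ 210 ∷ []) ∷
  (196 ∷ 201 ∷ 177 ∷ []) ∷ (199 ∷ 172 ∷ 166 ∷ []) ∷ (43 ∷ 169 ∷ 219 ∷ []) ∷ (39 ∷ 214 ∷ 217 ∷ []) ∷
  (197 ∷ 218 ∷ 220 ∷ []) ∷ (184 ∷ 208 ∷ 190 ∷ []) ∷ (159 ∷ 209 ∷ 211 ∷ []) ∷ (206 ∷ 212 ∷ 187 ∷ []) ∷
  (225 ∷ 365 ∷ 34 ∷ []) ∷ (222 ∷ 228 ∷ 240 ∷ []) ∷ (226 ∷ 231 ∷ 141 ∷ []) ∷ (229 ∷ 136 ∷ 130 ∷ []) ∷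
  (31 ∷ 133 ∷ 249 ∷ []) ∷ (27 ∷ 244 ∷ 247 ∷ []) ∷ (227 ∷ 248 ∷ 250 ∷ []) ∷ (148 ∷ 238 ∷ 154 ∷ []) ∷
  (123 ∷ 239 ∷ 241 ∷ []) ∷ (236 ∷ 242 ∷ 151 ∷ []) ∷ (255 ∷ 350 ∷ 22 ∷ []) ∷ (252 ∷ 258 ∷ 270 ∷ []) ∷
  (256 ∷ 261 ∷ 105 ∷ []) ∷ (259 ∷ 100 ∷ 94 ∷ []) ∷ (19 ∷ 97 ∷ 279 ∷ []) ∷ (15 ∷ 274 ∷ 277 ∷ []) ∷
  (257 ∷ 278 ∷ 280 ∷ []) ∷ (112 ∷ 268 ∷ 118 ∷ []) ∷ (87 ∷ 269 ∷ 271 ∷ []) ∷ (266 ∷ 272 ∷ 115 ∷ []) ∷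
  (285 ∷ 359 ∷ 10 ∷ []) ∷ (282 ∷ 288 ∷ 300 ∷ []) ∷ (286 ∷ 291 ∷ 69 ∷ []) ∷ (289 ∷ 64 ∷ 58 ∷ []) ∷
  (7 ∷ 61 ∷ 309 ∷ []) ∷ (3 ∷ 304 ∷ 307 ∷ []) ∷ (287 ∷ 308 ∷ 310 ∷ []) ∷ (76 ∷ 298 ∷ 82 ∷ []) ∷
  (51 ∷ 299 ∷ 301 ∷ []) ∷ (296 ∷ 302 ∷ 79 ∷ []) ∷ (315 ∷ 180 ∷ 138 ∷ []) ∷ (312 ∷ 318 ∷ 324 ∷ []) ∷
  (316 ∷ 321 ∷ 327 ∷ []) ∷ (319 ∷ 174 ∷ 120 ∷ []) ∷ (317 ∷ 126 ∷ 162 ∷ []) ∷ (320 ∷ 144 ∷ 156 ∷ []) ∷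
  (333 ∷ 108 ∷ 66 ∷ []) ∷ (330 ∷ 336 ∷ 342 ∷ []) ∷ (334 ∷ 339 ∷ 345 ∷ []) ∷ (337 ∷ 102 ∷ 48 ∷ []) ∷
  (335 ∷ 54 ∷ 90 ∷ []) ∷ (338 ∷ 72 ∷ 84 ∷ []) ∷ (351 ∷ 36 ∷ 253 ∷ []) ∷ (348 ∷ 354 ∷ 360 ∷ []) ∷
  (352 ∷ 357 ∷ 363 ∷ []) ∷ (355 ∷ 193 ∷ 283 ∷ []) ∷ (353 ∷ 0 ∷ 24 ∷ []) ∷ (356 ∷ 12 ∷ 223 ∷ []) ∷ []

point-path point-rank : Vec ℕ 64
point-path =
  30 ∷ 31 ∷ 30 ∷ 31 ∷ 28 ∷ 29 ∷ 28 ∷ 29 ∷ 26 ∷ 27 ∷ 26 ∷ 27 ∷ 24 ∷ 25 ∷ 24 ∷ 25 ∷ 22 ∷ 23 ∷ 21 ∷ 23 ∷ 21 ∷ 22 ∷ 19 ∷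
  20 ∷ 18 ∷ 20 ∷ 18 ∷ 19 ∷ 16 ∷ 17 ∷ 15 ∷ 17 ∷ 15 ∷ 16 ∷ 13 ∷ 14 ∷ 12 ∷ 14 ∷ 12 ∷ 13 ∷ 10 ∷ 11 ∷ 9 ∷ 11 ∷ 9 ∷ 10 ∷
  7 ∷ 8 ∷ 6 ∷ 8 ∷ 6 ∷ 7 ∷ 4 ∷ 5 ∷ 3 ∷ 5 ∷ 3 ∷ 4 ∷ 1 ∷ 2 ∷ 0 ∷ 2 ∷ 0 ∷ 1 ∷ []
point-rank =
  0 ∷ 0 ∷ 1 ∷ 1 ∷ 0 ∷ 0 ∷ 1 ∷ 1 ∷ 0 ∷ 0 ∷ 1 ∷ 1 ∷ 0 ∷ 0 ∷ 1 ∷ 1 ∷ 0 ∷ 0 ∷ 0 ∷ 1 ∷ 1 ∷ 1 ∷ 0 ∷ 0 ∷ 0 ∷ 1 ∷ 1 ∷ 1 ∷ 0 ∷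
  0 ∷ 0 ∷ 1 ∷ 1 ∷ 1 ∷ 0 ∷ 0 ∷ 0 ∷ 1 ∷ 1 ∷ 1 ∷ 0 ∷ 0 ∷ 0 ∷ 1 ∷ 1 ∷ 1 ∷ 0 ∷ 0 ∷ 0 ∷ 1 ∷ 1 ∷ 1 ∷ 0 ∷ 0 ∷ 0 ∷ 1 ∷ 1 ∷ 1 ∷
  0 ∷ 0 ∷ 0 ∷ 1 ∷ 1 ∷ 1 ∷ []

base-role : Fin 122 → Role
base-role v with splitAt 64 v
... | inj₁ p = point (lookupᵛ point-path p mod 32)
... | inj₂ x = frame x

base-rk : Fin 122 → ℕ
base-rk v with splitAt 64 v
... | inj₁ p = lookupᵛ point-rank p
... | inj₂ _ = 0

base-kind : Dart 122 → Kind 32 12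
base-kind (v , i) = kind-at (base-role v) i

base-rank : Dart 122 → ℕ
base-rank (v , i) = rank-at (λ _ → 2) (base-rk v) (base-role v) i

base-involution : ∀ v i → at base-table (at base-table (v , i)) ≡ (v , i)
base-involution = toWitness {a? = involution? (at base-table)} tt

base-loopless : ∀ v i → proj₁ (at base-table (v , i)) ≢ v
base-loopless = toWitness {a? = loopless? (at base-table)} tt

base-graph : CubicGraph 122
base-graph = record
  { inv = at base-table
  ; inv-inv = λ (v , i) → base-involution v i
  ; loopless = λ (v , i) → base-loopless v i }

SameAs : (Dart 122 → Dart 122) → (Dart 122 → Maybe (Fin 12)) → Set
SameAs inv labels = ∀ v i → inv (v , i) ≡ at base-table (v , i) × labels (v , i) ≡ label (base-kind (v , i))

same-as? : ∀ inv labels → Dec (SameAs inv labels)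
same-as? inv labels = Fin.all? λ v → Fin.all? λ i →
  (inv (v , i) ≟ᵈ at base-table (v , i)) ×-dec (Maybe.≡-dec Fin._≟_ (labels (v , i)) (label (base-kind (v , i))))

module _ (st : Stage 122) (same : SameAs (CubicGraph.inv (Stage.graph st)) (Stage.labels st)) where
  open Stage st

  cuts-via : SmallCutsTrivial base-graph
  cuts-via = rename-cuts graph base-graph id id id id (λ _ → refl) (λ _ → refl) (λ _ → refl) (λ (v , i) → proj₁ (same v i)) small-cuts

  no-flow-via : NoFlow base-graph (label ∘ base-kind)
  no-flow-via c flow = no-flow c record
    { nonzero = nonzero
    ; conserved = conserved
    ; unlabelled = λ (v , i) p → trans (cong c (proj₁ (same v i))) (unlabelled (v , i) (trans (sym (proj₂ (same v i))) p))
    ; labelled = λ b → trans (cong (foldr _⊕_ O) (map-cong (λ (v , i) → cong (λ l → select b l (c (v , i))) (proj₂ (same v i))) (darts 122))) (labelled b) }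
    where open Flow flow

final-stage : Stage 122
final-stage = extract (extend (stage H H-small-cuts labelH H-no-flow) chords) tt

same : SameAs (CubicGraph.inv (Stage.graph final-stage)) (Stage.labels final-stage)
same = toWitness {a? = same-as? (CubicGraph.inv (Stage.graph final-stage)) (Stage.labels final-stage)} tt

_≟ᵏ_ : ∀ {p b} (k l : Kind p b) → Dec (k ≡ l)
_≟ᵏ_ {p} {b} k l = map′ (λ q → trans (sym (code-code k)) (trans (cong uncode q) (code-code l))) (cong code)
  (Sum.≡-dec Fin._≟_ (Sum.≡-dec Fin._≟_ (Sum.≡-dec Fin._≟_ Fin._≟_)) (code k) (code l))
  where
  Code : Set
  Code = Fin 3 ⊎ (Fin p ⊎ (Fin p ⊎ Fin b))
  code : Kind p b → Code
  code (plain c) = inj₁ c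
  code (low s) = inj₂ (inj₁ s)
  code (high s) = inj₂ (inj₂ (inj₁ s))
  code (chord c) = inj₂ (inj₂ (inj₂ c))
  uncode : Code → Kind p b
  uncode (inj₁ c) = plain c
  uncode (inj₂ (inj₁ s)) = low s
  uncode (inj₂ (inj₂ (inj₁ s))) = high s
  uncode (inj₂ (inj₂ (inj₂ c))) = chord c
  code-code : ∀ k → uncode (code k) ≡ k
  code-code (plain _) = refl
  code-code (low _) = refl
  code-code (high _) = refl
  code-code (chord _) = refl

-- A table inverse to path and rank: recovering every low dart from it proves `low-unique` without
-- comparing pairs of darts.
low-darts : Vec (Vec ℕ 3) 32
low-darts =
  (313 ∷ 181 ∷ 187 ∷ []) ∷ (322 ∷ 175 ∷ 190 ∷ []) ∷ (200 ∷ 178 ∷ 184 ∷ []) ∷ (326 ∷ 163 ∷ 169 ∷ []) ∷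
  (329 ∷ 157 ∷ 172 ∷ []) ∷ (216 ∷ 160 ∷ 166 ∷ []) ∷ (328 ∷ 145 ∷ 151 ∷ []) ∷ (314 ∷ 139 ∷ 154 ∷ []) ∷
  (230 ∷ 142 ∷ 148 ∷ []) ∷ (325 ∷ 127 ∷ 133 ∷ []) ∷ (323 ∷ 121 ∷ 136 ∷ []) ∷ (246 ∷ 124 ∷ 130 ∷ []) ∷
  (331 ∷ 109 ∷ 115 ∷ []) ∷ (340 ∷ 103 ∷ 118 ∷ []) ∷ (260 ∷ 106 ∷ 112 ∷ []) ∷ (344 ∷ 91 ∷ 97 ∷ []) ∷
  (347 ∷ 85 ∷ 100 ∷ []) ∷ (276 ∷ 88 ∷ 94 ∷ []) ∷ (346 ∷ 73 ∷ 79 ∷ []) ∷ (332 ∷ 67 ∷ 82 ∷ []) ∷ (290 ∷ 70 ∷ 76 ∷ []) ∷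
  (343 ∷ 55 ∷ 61 ∷ []) ∷ (341 ∷ 49 ∷ 64 ∷ []) ∷ (306 ∷ 52 ∷ 58 ∷ []) ∷ (349 ∷ 37 ∷ 43 ∷ []) ∷ (207 ∷ 40 ∷ 46 ∷ []) ∷
  (362 ∷ 25 ∷ 31 ∷ []) ∷ (237 ∷ 28 ∷ 34 ∷ []) ∷ (364 ∷ 13 ∷ 19 ∷ []) ∷ (267 ∷ 16 ∷ 22 ∷ []) ∷ (361 ∷ 1 ∷ 7 ∷ []) ∷
  (297 ∷ 4 ∷ 10 ∷ []) ∷ []

low-dart : Fin 32 → ℕ → Dart 122
low-dart s r = decode 122 (lookupᵛ (lookupᵛ low-darts s) (r mod 3))

IsLow : Kind 32 12 → Dart 122 → Set
IsLow (low s) d = low-dart s (base-rank d) ≡ d × base-rank d ≤ 2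
IsLow _ d = ⊤

is-low? : ∀ k d → Dec (IsLow k d)
is-low? (low s) d = (low-dart s (base-rank d) ≟ᵈ d) ×-dec (base-rank d ℕ.≤? 2)
is-low? (plain _) d = yes tt
is-low? (high _) d = yes tt
is-low? (chord _) d = yes tt

is-low : ∀ v i → IsLow (base-kind (v , i)) (v , i)
is-low = toWitness {a? = Fin.all? λ v → Fin.all? λ i → is-low? (base-kind (v , i)) (v , i)} tt

is-low-at : ∀ {s} d → base-kind d ≡ low s → low-dart s (base-rank d) ≡ d × base-rank d ≤ 2
is-low-at (v , i) p = subst (λ k → IsLow k (v , i)) p (is-low v i)

base-kind-inv : ∀ v i → base-kind (at base-table (v , i)) ≡ mate (base-kind (v , i))
base-kind-inv = toWitness {a? = Fin.all? λ v → Fin.all? λ i → base-kind (at base-table (v , i)) ≟ᵏ mate (base-kind (v , i))} tt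

base-rank-inv : ∀ v i → base-rank (at base-table (v , i)) ≡ base-rank (v , i)
base-rank-inv = toWitness {a? = Fin.all? λ v → Fin.all? λ i → base-rank (at base-table (v , i)) ℕ.≟ base-rank (v , i)} tt

base-frame : Fin 58 → Fin 122
base-frame x = 64 ↑ʳ x

Mated : Kind 32 12 → Dart 58 → Set
Mated (plain _) (x , i) = at base-table (base-frame x , i) ≡ (base-frame (proj₁ (mateF x i)) , proj₂ (mateF x i))
Mated _ _ = ⊤

mated? : ∀ k d → Dec (Mated k d)
mated? (plain _) (x , i) = at base-table (base-frame x , i) ≟ᵈ (base-frame (proj₁ (mateF x i)) , proj₂ (mateF x i))
mated? (low _) _ = yes tt
mated? (high _) _ = yes tt
mated? (chord _) _ = yes tt

mated : ∀ x i → Mated (kindF x i) (x , i)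
mated = toWitness {a? = Fin.all? λ x → Fin.all? λ i → mated? (kindF x i) (x , i)} tt

base-role-frame : ∀ x → base-role (base-frame x) ≡ frame x
base-role-frame x with splitAt 64 (base-frame x) | Fin.splitAt-↑ʳ 64 58 x
... | _ | refl = refl

base-frame-unique : ∀ {v x} → base-role v ≡ frame x → v ≡ base-frame x
base-frame-unique {v} p with splitAt 64 v in eq
base-frame-unique {v} refl | inj₂ x = sym (Fin.splitAt⁻¹-↑ʳ eq)

base-state : State 122
base-state = record
  { graph = base-graph
  ; role = base-role
  ; rk = base-rk
  ; len = λ _ → 2
  ; frameV = base-frame
  ; small-cuts = cuts-via final-stage same
  ; no-flow = no-flow-via final-stage same
  ; kind-inv = λ (v , i) → base-kind-inv v i
  ; rank-inv = λ (v , i) → base-rank-inv v i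
  ; low-unique = λ {s} {d} {e} p q r → trans (sym (proj₁ (is-low-at d p))) (trans (cong (low-dart s) r) (proj₁ (is-low-at e q)))
  ; rank≤len = λ {_} {d} p → proj₂ (is-low-at d p)
  ; len-even = λ _ → refl
  ; 2≤len = λ _ → s≤s (s≤s z≤n)
  ; role-frameV = base-role-frame
  ; frame-unique = base-frame-unique
  ; frame-inv = λ {x} {i} p → subst (λ k → Mated k (x , i)) p (mated x i) }

-- Ends of the paths, colouring and forest of the frame

starts finishes : Vec ℕ 32
starts =
  121 ∷ 130 ∷ 8 ∷ 134 ∷ 137 ∷ 24 ∷ 136 ∷ 122 ∷ 38 ∷ 133 ∷ 131 ∷ 54 ∷ 139 ∷ 148 ∷ 68 ∷ 152 ∷ 155 ∷ 84 ∷ 154 ∷ 140 ∷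
  98 ∷ 151 ∷ 149 ∷ 114 ∷ 157 ∷ 15 ∷ 170 ∷ 45 ∷ 172 ∷ 75 ∷ 169 ∷ 105 ∷ []
finishes =
  29 ∷ 23 ∷ 21 ∷ 13 ∷ 10 ∷ 11 ∷ 59 ∷ 53 ∷ 51 ∷ 43 ∷ 40 ∷ 41 ∷ 89 ∷ 83 ∷ 81 ∷ 73 ∷ 70 ∷ 71 ∷ 119 ∷ 113 ∷ 111 ∷ 103 ∷
  100 ∷ 101 ∷ 12 ∷ 2 ∷ 42 ∷ 32 ∷ 72 ∷ 62 ∷ 102 ∷ 92 ∷ []

ends : Ends Φ
ends = record
  { start = λ s → decode 58 (lookupᵛ starts s)
  ; finish = λ s → decode 58 (lookupᵛ finishes s)
  ; kind-start = toWitness {a? = Fin.all? λ s → kind-of (decode 58 (lookupᵛ starts s)) ≟ᵏ low s} tt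
  ; kind-finish = toWitness {a? = Fin.all? λ s → kind-of (decode 58 (lookupᵛ finishes s)) ≟ᵏ high s} tt
  ; distinct = toWitness {a? = Fin.all? λ s → ¬? (proj₁ (decode 58 (lookupᵛ starts s)) Fin.≟ proj₁ (decode 58 (lookupᵛ finishes s)))} tt }
  where
  kind-of : Dart 58 → Kind 32 12
  kind-of (x , i) = kindF x i

-- A colouring of the frame without uF and vF; the segments of a path alternate between its two colours.
path-colour other-colour : Vec ℕ 32
path-colour =
  2 ∷ 0 ∷ 2 ∷ 0 ∷ 0 ∷ 2 ∷ 1 ∷ 0 ∷ 1 ∷ 1 ∷ 2 ∷ 1 ∷ 0 ∷ 0 ∷ 1 ∷ 2 ∷ 2 ∷ 2 ∷ 0 ∷ 1 ∷ 0 ∷ 0 ∷ 1 ∷ 0 ∷ 2 ∷ 2 ∷ 0 ∷ 1 ∷ 0 ∷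
  1 ∷ 1 ∷ 0 ∷ []
other-colour =
  0 ∷ 2 ∷ 0 ∷ 2 ∷ 2 ∷ 0 ∷ 0 ∷ 1 ∷ 0 ∷ 2 ∷ 1 ∷ 2 ∷ 1 ∷ 1 ∷ 0 ∷ 1 ∷ 1 ∷ 1 ∷ 1 ∷ 0 ∷ 1 ∷ 1 ∷ 0 ∷ 1 ∷ 1 ∷ 1 ∷ 1 ∷ 0 ∷ 1 ∷
  0 ∷ 0 ∷ 1 ∷ []

chord-colour : Vec ℕ 12
chord-colour =
  1 ∷ 1 ∷ 2 ∷ 0 ∷ 2 ∷ 0 ∷ 2 ∷ 2 ∷ 0 ∷ 2 ∷ 2 ∷ 2 ∷ []

colouring : Colouring Φ
colouring = record
  { α = α
  ; β = β
  ; γ = γ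
  ; α≢β = toWitness {a? = Fin.all? λ s → ¬? (α s Fin.≟ β s)} tt
  ; α≢γ = toWitness {a? = Fin.all? λ s → ¬? (α s Fin.≟ γ (blob s))} tt
  ; β≢γ = toWitness {a? = Fin.all? λ s → ¬? (β s Fin.≟ γ (blob s))} tt
  ; proper = toWitness {a? = Fin.all? λ x → ¬? (x Fin.≟ uF) →-dec (¬? (x Fin.≟ vF) →-dec (Fin.all? λ i → Fin.all? λ j →
      ¬? (i Fin.≟ j) →-dec ((survives Φ x i Bool.≟ true) →-dec ((survives Φ x j Bool.≟ true) →-dec
      ¬? (base-colour α γ (kindF x i) Fin.≟ base-colour α γ (kindF x j))))))} tt
  ; u≢v = λ ()
  ; uv = 1 mod 3
  ; uv-plain = _ , refl
  ; uv-mate = refl }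
  where
  α β : Fin 32 → Fin 3
  α s = lookupᵛ path-colour s mod 3
  β s = lookupᵛ other-colour s mod 3
  γ : Fin 12 → Fin 3
  γ b = lookupᵛ chord-colour b mod 3

orders : Vec ℕ 58
orders =
  0 ∷ 1 ∷ 3 ∷ 7 ∷ 14 ∷ 13 ∷ 4 ∷ 20 ∷ 8 ∷ 9 ∷ 17 ∷ 22 ∷ 27 ∷ 33 ∷ 41 ∷ 40 ∷ 28 ∷ 44 ∷ 34 ∷ 35 ∷ 21 ∷ 26 ∷ 31 ∷ 37 ∷
  43 ∷ 42 ∷ 32 ∷ 45 ∷ 38 ∷ 39 ∷ 6 ∷ 12 ∷ 18 ∷ 23 ∷ 30 ∷ 29 ∷ 19 ∷ 36 ∷ 24 ∷ 25 ∷ 46 ∷ 47 ∷ 48 ∷ 50 ∷ 49 ∷ 51 ∷ 52 ∷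
  53 ∷ 54 ∷ 56 ∷ 55 ∷ 57 ∷ 15 ∷ 10 ∷ 5 ∷ 2 ∷ 16 ∷ 11 ∷ []

is-plain : Kind 32 12 → Bool
is-plain (plain _) = true
is-plain _ = false

is-chord : Kind 32 12 → Bool
is-chord (chord _) = true
is-chord _ = false

frame-forest : Forest Φ
frame-forest = record
  { order = lookupᵛ orders
  ; no-chord = λ x i b p → no-chords x i (cong is-chord p)
  ; earlier = λ x i j p q → earlier x i j (cong is-plain p) (cong is-plain q) }
  where
  no-chords : ∀ x i → is-chord (kindF x i) ≢ true
  no-chords = toWitness {a? = Fin.all? λ x → Fin.all? λ i → ¬? (is-chord (kindF x i) Bool.≟ true)} tt
  below : Fin 58 → Fin 3 → Set
  below x i = lookupᵛ orders (proj₁ (mateF x i)) ≤ lookupᵛ orders x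
  earlier : ∀ x i j → is-plain (kindF x i) ≡ true → is-plain (kindF x j) ≡ true → below x i → below x j → i ≡ j
  earlier = toWitness {a? = Fin.all? λ x → Fin.all? λ i → Fin.all? λ j → (is-plain (kindF x i) Bool.≟ true) →-dec
    ((is-plain (kindF x j) Bool.≟ true) →-dec ((_ ℕ.≤? _) →-dec ((_ ℕ.≤? _) →-dec (i Fin.≟ j))))} tt

theorem5p2 : (g : ℕ) →
    Σ Graph λ G → NontrivialSnark G × GirthAtLeast G g ×
    Σ (Vertex G) λ u → Σ (Vertex G) λ v →
    u ≢ v × Adjacent G u v × NonRemovable G (λ x → x ≡ u ⊎ x ≡ v)
theorem5p2 = Final.from-base Φ ends colouring frame-forest (s≤s (s≤s (s≤s z≤n))) base-state
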